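{- A simple binary matroid belongs to $\mathcal{M}_2$ if and only if it has no induced minor isomorphic to $M(K_4)$ or $U_{3,4}$; that is, the set of forbidden induced minors for $\mathcal{M}_2$ is exactly $\{M(K_4),U_{3,4}\}$ (each of these is not in $\mathcal{M}_2$ while all of its proper induced minors are in $\mathcal{M}_2$, and every simple binary matroid not in $\mathcal{M}_2$ has one of them as an induced minor).
   Context: All matroids are simple; every contraction is immediately followed by simplification. $P_r$ denotes $PG(r-1,2)$. If $M_1,M_2$ are matroids whose ground sets meet in a set $T$ that is a modular flat of $M_1$, with $M_1|T=M_2|T=N$, the generalized parallel connection $P_N(M_1,M_2)$ is the matroid on $E(M_1)\cup E(M_2)$ whose flats are the sets $X$ with $X\cap E(M_1)$ a flat of $M_1$ and $X\cap E(M_2)$ a flat of $M_2$. $\mathcal{M}_2$ is the class of matroids that can be built from projective geometries over $GF(2)$ by a sequence of generalized parallel connections across projective geometries over $GF(2)$. An induced minor of $M$ is a matroid obtainable from $M$ by a sequence of restrictions to flats and contractions (each followed by simplification). -}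

module Defs where

open import Data.Nat using (ℕ; zero; suc; _+_; _≤_)
open import Data.Bool using (Bool; true; false; _xor_; if_then_else_)
open import Data.Fin using (Fin; zero; suc)
open import Data.Vec using (Vec; []; _∷_; replicate; zipWith; lookup; tabulate)
open import Data.Fin.Subset using (Subset; _∈_; _⊆_; ⊥; ∣_∣; _∪_; _∩_; ⁅_⁆)
open import Data.Product using (Σ; ∃; _×_; _,_; proj₁; proj₂)
open import Data.Sum using (_⊎_)
open import Data.Empty using () renaming (⊥ to Empty)
open import Function using (_∘_)
open import Function.Bundles using (_⇔_)
open import Relation.Binary.PropositionalEquality using (_≡_; _≢_; refl; cong; trans; sym)
open import Relation.Nullary using (¬_)

-- The vector space GF(2)^r, as Vec Bool r (true = 1, xor = addition).

zeroV : ∀ {r} → Vec Bool r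
zeroV = replicate _ false

_⊕_ : ∀ {r} → Vec Bool r → Vec Bool r → Vec Bool r
_⊕_ = zipWith _xor_

sumSel : ∀ {m r} → (Fin m → Vec Bool r) → Subset m → Vec Bool r
sumSel {zero}  v []      = zeroV
sumSel {suc m} v (b ∷ Y) = (if b then v zero else zeroV) ⊕ sumSel (v ∘ suc) Y

LinIndep : ∀ {m r} → (Fin m → Vec Bool r) → Subset m → Set
LinIndep v X = ∀ Y → Y ⊆ X → sumSel v Y ≡ zeroV → Y ≡ ⊥

InSpan : ∀ {m r} → (Fin m → Vec Bool r) → Subset m → Vec Bool r → Set
InSpan v X x = ∃ λ Y → Y ⊆ X × sumSel v Y ≡ x

Inj : ∀ {m n} → (Fin m → Fin n) → Set
Inj f = ∀ i j → f i ≡ f j → i ≡ j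

pre : ∀ {m n} → (Fin m → Fin n) → Subset n → Subset m
pre f X = tabulate (λ i → lookup X (f i))

-- A simple binary matroid: the vector matroid of a finite family of
-- pairwise distinct nonzero vectors of GF(2)^dim, ground set Fin size.

record BinMat : Set where
  field
    dim    : ℕ
    size   : ℕ
    vec    : Fin size → Vec Bool dim
    vec-inj : ∀ i j → vec i ≡ vec j → i ≡ j
    vec-nz : ∀ i → vec i ≢ zeroV
open BinMat public

Indep : (M : BinMat) → Subset (size M) → Set
Indep M X = LinIndep (vec M) X

InCl : (M : BinMat) → Subset (size M) → Fin (size M) → Set
InCl M X e = InSpan (vec M) X (vec M e)

Flat : (M : BinMat) → Subset (size M) → Set
Flat M X = ∀ e → InCl M X e → e ∈ X

RankIs : (M : BinMat) → Subset (size M) → ℕ → Set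
RankIs M X k =
  (∃ λ Y → Y ⊆ X × Indep M Y × ∣ Y ∣ ≡ k) ×
  (∀ Z → Z ⊆ X → Indep M Z → ∣ Z ∣ ≤ k)

ModularFlat : (M : BinMat) → Subset (size M) → Set
ModularFlat M T = Flat M T ×
  (∀ F → Flat M F → ∀ a b c d → RankIs M T a → RankIs M F b →
     RankIs M (T ∪ F) c → RankIs M (T ∩ F) d → a + b ≡ c + d)

Iso : BinMat → BinMat → Set
Iso N M = Σ (Fin (size N) → Fin (size M)) λ σ →
  Inj σ × (∀ j → ∃ λ i → σ i ≡ j) ×
  (∀ X → Indep M X ⇔ Indep N (pre σ X))

RestrVia : (N M : BinMat) → (Fin (size N) → Fin (size M)) → Subset (size M) → Set
RestrVia N M f T =
  Inj f × (∀ i → f i ∈ T) × (∀ j → j ∈ T → ∃ λ i → f i ≡ j) ×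
  (∀ X → X ⊆ T → Indep M X ⇔ Indep N (pre f X))

FlatRestriction : BinMat → BinMat → Set
FlatRestriction N M = ∃ λ f → ∃ λ T → Flat M T × RestrVia N M f T

-- N is isomorphic to si(M/e) for some element e of M.  The elements of
-- si(M/e) are the parallel classes of M/e, i.e. the sets
-- cl_M({e,x}) - {e}; g picks one representative of each class, and a set
-- of representatives is independent in M/e iff together with e it is
-- independent in M.
SimpContraction : BinMat → BinMat → Set
SimpContraction N M = Σ (Fin (size M)) λ e → Σ (Fin (size N) → Fin (size M)) λ g →
  (∀ i → g i ≢ e) ×
  (∀ x → x ≢ e → ∃ λ i → InCl M (⁅ e ⁆ ∪ ⁅ g i ⁆) x) ×
  (∀ i j → InCl M (⁅ e ⁆ ∪ ⁅ g j ⁆) (g i) → i ≡ j) ×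
  (∀ X → (∀ x → x ∈ X → ∃ λ i → g i ≡ x) →
     Indep M (X ∪ ⁅ e ⁆) ⇔ Indep N (pre g X))

data IndMinor (N : BinMat) : BinMat → Set where
  base     : ∀ {M} → Iso N M → IndMinor N M
  viaRestr : ∀ {M M'} → FlatRestriction M' M → IndMinor N M' → IndMinor N M
  viaContr : ∀ {M M'} → SimpContraction M' M → IndMinor N M' → IndMinor N M

ProperIndMinor : BinMat → BinMat → Set
ProperIndMinor N M = IndMinor N M × ¬ Iso N M

-- M ≅ P_r = PG(r-1,2) for some r ≥ 0 (ground set of P_r = nonzero vectors of GF(2)^r)
IsPG : BinMat → Set
IsPG M = Σ ℕ λ r → Σ (Fin (size M) → Vec Bool r) λ φ →
  (∀ i j → φ i ≡ φ j → i ≡ j) × (∀ i → φ i ≢ zeroV) ×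
  (∀ x → x ≢ zeroV → ∃ λ i → φ i ≡ x) ×
  (∀ X → Indep M X ⇔ LinIndep φ X)

record GPC (M₁ M₂ M : BinMat) : Set where
  field
    f₁ : Fin (size M₁) → Fin (size M)
    f₂ : Fin (size M₂) → Fin (size M)
    f₁-inj : Inj f₁
    f₂-inj : Inj f₂
    cover : ∀ x → (∃ λ i → f₁ i ≡ x) ⊎ (∃ λ j → f₂ j ≡ x)
    N : BinMat
    N-PG : IsPG N
    T₁ : Subset (size M₁)
    T₂ : Subset (size M₂)
    g₁ : Fin (size N) → Fin (size M₁)
    g₂ : Fin (size N) → Fin (size M₂)
    restr₁ : RestrVia N M₁ g₁ T₁
    restr₂ : RestrVia N M₂ g₂ T₂
    T₁-modular : ModularFlat M₁ T₁
    glue : ∀ k → f₁ (g₁ k) ≡ f₂ (g₂ k)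
    overlap-T : ∀ i j → f₁ i ≡ f₂ j → ∃ λ k → g₁ k ≡ i
    flats : ∀ X → Flat M X ⇔ (Flat M₁ (pre f₁ X) × Flat M₂ (pre f₂ X))

data InM2 : BinMat → Set where
  pg  : ∀ {M} → IsPG M → InM2 M
  gpc : ∀ {M₁ M₂ M} → InM2 M₁ → InM2 M₂ → GPC M₁ M₂ M → InM2 M

private
  e1 e2 e3 e12 e13 e23 e123 : Vec Bool 3
  e1 = true ∷ false ∷ false ∷ []
  e2 = false ∷ true ∷ false ∷ []
  e3 = false ∷ false ∷ true ∷ []
  e12 = true ∷ true ∷ false ∷ []
  e13 = true ∷ false ∷ true ∷ []
  e23 = false ∷ true ∷ true ∷ []
  e123 = true ∷ true ∷ true ∷ []

  k4v : Fin 6 → Vec Bool 3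
  k4v zero = e1
  k4v (suc zero) = e2
  k4v (suc (suc zero)) = e3
  k4v (suc (suc (suc zero))) = e12
  k4v (suc (suc (suc (suc zero)))) = e13
  k4v (suc (suc (suc (suc (suc zero))))) = e23

  k4c : Vec Bool 3 → Fin 6
  k4c (true ∷ false ∷ false ∷ []) = zero
  k4c (false ∷ true ∷ false ∷ []) = suc zero
  k4c (false ∷ false ∷ true ∷ []) = suc (suc zero)
  k4c (true ∷ true ∷ false ∷ []) = suc (suc (suc zero))
  k4c (true ∷ false ∷ true ∷ []) = suc (suc (suc (suc zero)))
  k4c _ = suc (suc (suc (suc (suc zero))))

  k4cv : ∀ i → k4c (k4v i) ≡ i
  k4cv zero = refl
  k4cv (suc zero) = refl
  k4cv (suc (suc zero)) = refl
  k4cv (suc (suc (suc zero))) = refl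
  k4cv (suc (suc (suc (suc zero)))) = refl
  k4cv (suc (suc (suc (suc (suc zero))))) = refl

  k4nz : ∀ i → k4v i ≢ zeroV
  k4nz zero ()
  k4nz (suc zero) ()
  k4nz (suc (suc zero)) ()
  k4nz (suc (suc (suc zero))) ()
  k4nz (suc (suc (suc (suc zero)))) ()
  k4nz (suc (suc (suc (suc (suc zero))))) ()

  u34v : Fin 4 → Vec Bool 3
  u34v zero = e1
  u34v (suc zero) = e2
  u34v (suc (suc zero)) = e3
  u34v (suc (suc (suc zero))) = e123

  u34c : Vec Bool 3 → Fin 4
  u34c (true ∷ false ∷ false ∷ []) = zero
  u34c (false ∷ true ∷ false ∷ []) = suc zero
  u34c (false ∷ false ∷ true ∷ []) = suc (suc zero)
  u34c _ = suc (suc (suc zero))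

  u34cv : ∀ i → u34c (u34v i) ≡ i
  u34cv zero = refl
  u34cv (suc zero) = refl
  u34cv (suc (suc zero)) = refl
  u34cv (suc (suc (suc zero))) = refl

  u34nz : ∀ i → u34v i ≢ zeroV
  u34nz zero ()
  u34nz (suc zero) ()
  u34nz (suc (suc zero)) ()
  u34nz (suc (suc (suc zero))) ()

MK4 : BinMat
MK4 = record
  { dim = 3 ; size = 6 ; vec = k4v
  ; vec-inj = λ i j eq → trans (sym (k4cv i)) (trans (cong k4c eq) (k4cv j))
  ; vec-nz = k4nz }

U34 : BinMat
U34 = record
  { dim = 3 ; size = 4 ; vec = u34v
  ; vec-inj = λ i j eq → trans (sym (u34cv i)) (trans (cong u34c eq) (u34cv j))
  ; vec-nz = u34nz }

{-# OPTIONS --safe #-}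
-- Identify a simple binary matroid with a set S of vectors over GF(2) containing 0. Membership in
-- 𝓜₂ means that S is a subspace or that S ⊆ W₁ ∪ W₂ with W₁ ∩ W₂ ⊆ S and both S ∩ Wᵢ again of this
-- form; this survives images under linear maps whose kernel lies in S, hence induced minors, and it
-- excludes M(K₄) and U₃,₄.
-- Conversely let S have neither minor and let x ∈ S. By induction the quotient of S by x is a
-- subspace or splits, and from this either S splits along a subspace through x, or there is a
-- subspace H avoiding x such that every s ∈ S ∖ H has s + x ∈ S. In the second case choose x with the
-- fewest y ∈ S such that x + y ∈ S. Then all elements of S ∖ H have the same neighbours as x, so
-- they lie in a subspace B ⊆ S, and S splits as (S ∩ H) ∪ B.
module Submission where

open import Defs
open import Data.Nat using (ℕ; zero; suc; _+_; _^_; _≤_; _<_; z≤n; s≤s)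
import Data.Nat.Properties as ℕ
open import Data.Bool using (Bool; true; false; _xor_; if_then_else_)
import Data.Bool.Properties as Bool
open import Data.Fin using (Fin; zero; suc)
import Data.Fin as Fin
import Data.Fin.Properties as Fin
open import Data.Fin.Subset using (Subset; _∈_; _∉_; _⊆_; _⊂_; ⊥; ⊤; ∣_∣; _∪_; _∩_; ⁅_⁆)
open import Data.Fin.Subset.Properties
  using (_⊆?_; _∈?_; anySubset?; ⊆-antisym; ∉⊥; ∈⊤; x∈⁅x⁆; x∈⁅y⁆⇒x≡y; x∈p∪q⁺; x∈p∪q⁻;
         x∈p∩q⁺; x∈p∩q⁻; p⊂q⇒∣p∣<∣q∣; drop-there)
open import Data.Vec using (Vec; []; _∷_; lookup; tabulate)
import Data.Vec as Vec
import Data.Vec.Properties as Vec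
open import Data.List using (List; []; _∷_; filter; length; deduplicate)
import Data.List as List
import Data.List.Properties as List
open import Data.List.Membership.Propositional using (find; lose) renaming (_∈_ to _∈ₗ_)
import Data.List.Membership.Propositional.Properties as List∈
import Data.List.Membership.DecPropositional as DecMembership
open import Data.List.Relation.Unary.Any as Any using (Any; here; there)
import Data.List.Relation.Unary.Any.Properties as Any
open import Data.List.Relation.Unary.All as All using (All; []; _∷_)
import Data.List.Relation.Unary.All.Properties as All
open import Data.Product using (Σ; ∃; _×_; _,_; proj₁; proj₂; swap)
open import Data.Sum using (_⊎_; inj₁; inj₂; [_,_]′) renaming (map to map⊎; swap to swap⊎)
open import Data.Empty using (⊥-elim)
open import Data.Unit using (tt) renaming (⊤ to Unit)
open import Function using (_∘_; id)
open import Function.Bundles using (_⇔_; mk⇔; Equivalence; Inverse)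
open import Relation.Binary.PropositionalEquality
  using (_≡_; _≢_; refl; sym; trans; cong; cong₂; subst; setoid)
open import Relation.Nullary using (¬_; Dec; yes; no; does)
open import Relation.Nullary.Decidable using (_×-dec_; _⊎-dec_; _→-dec_; ¬?; dec-true)
open import Data.List.Relation.Unary.Unique.Propositional using (Unique; []; _∷_)
open import Data.List.Relation.Unary.Unique.DecPropositional.Properties using (deduplicate-!)

open Equivalence using (to; from)

-- Call s ∈ S doubled if s + x ∈ S. A split of the quotient by x pulls back to subspaces P₁, P₂
-- through x, but for v in P₁ ∩ P₂ only v ∈ S or v + x ∈ S is known. If all of S in P₁ ∩ P₂ is
-- doubled, the pullback is already a split. An undoubled q there is the obstacle and the reason for
-- the second alternative: induction applies to both S ∩ Pᵢ with the same x, a split of one side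
-- through x extends to S, and if both sides yield a subspace avoiding x, then q forces the two
-- subspaces to agree on P₁ ∩ P₂. Matroids in different ambient spaces are compared through their
-- zero-sum sets, which over GF(2) are determined by the independent sets. This gives an additive
-- relation between the ambient spaces where no map is at hand. Minimality of the two excluded
-- matroids is a matter of rank: both have rank 3, and a proper induced minor of either has smaller
-- rank.

private
  variable
    k m n : ℕ

-- Vectors over GF(2) and additive maps

V : ℕ → Set
V = Vec Bool

_≟ⱽ_ : (a b : V n) → Dec (a ≡ b)
_≟ⱽ_ = Vec.≡-dec Bool._≟_

⊕-comm : (a b : V n) → a ⊕ b ≡ b ⊕ a
⊕-comm = Vec.zipWith-comm Bool.xor-comm

⊕-assoc : (a b c : V n) → (a ⊕ b) ⊕ c ≡ a ⊕ (b ⊕ c)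
⊕-assoc = Vec.zipWith-assoc Bool.xor-assoc

⊕-identityˡ : (a : V n) → zeroV ⊕ a ≡ a
⊕-identityˡ = Vec.zipWith-identityˡ Bool.xor-identityˡ

⊕-identityʳ : (a : V n) → a ⊕ zeroV ≡ a
⊕-identityʳ = Vec.zipWith-identityʳ Bool.xor-identityʳ

⊕-self : (a : V n) → a ⊕ a ≡ zeroV
⊕-self []      = refl
⊕-self (x ∷ a) = cong₂ _∷_ (Bool.xor-same x) (⊕-self a)

⊕-interchange : (a b c d : V n) → (a ⊕ b) ⊕ (c ⊕ d) ≡ (a ⊕ c) ⊕ (b ⊕ d)
⊕-interchange a b c d =
  trans (⊕-assoc a b (c ⊕ d))
  (trans (cong (a ⊕_) (trans (sym (⊕-assoc b c d))
                      (trans (cong (_⊕ d) (⊕-comm b c)) (⊕-assoc c b d))))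
         (sym (⊕-assoc a c (b ⊕ d))))

⊕≡0⇒≡ : {a b : V n} → a ⊕ b ≡ zeroV → a ≡ b
⊕≡0⇒≡ {a = a} {b} eq =
  trans (sym (⊕-identityʳ a))
  (trans (cong (a ⊕_) (sym (⊕-self b)))
  (trans (sym (⊕-assoc a b b)) (trans (cong (_⊕ b) eq) (⊕-identityˡ b))))

Additive : (V m → V n) → Set
Additive h = ∀ a b → h (a ⊕ b) ≡ h a ⊕ h b

additive-0 : {h : V m → V n} → Additive h → h zeroV ≡ zeroV
additive-0 {h = h} add = trans (sym (⊕-identityʳ _)) (trans (cong (h zeroV ⊕_) (sym (⊕-self (h zeroV))))
  (trans (sym (⊕-assoc _ _ _)) (trans (cong (_⊕ h zeroV) (trans (sym (add zeroV zeroV))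
     (cong h (⊕-self zeroV)))) (⊕-self (h zeroV)))))

-- Stated as a trivial kernel; for additive maps this is injectivity, by `additive-injective`.
Injective : (V m → V n) → Set
Injective h = ∀ a → h a ≡ zeroV → a ≡ zeroV

-- Sums over subsets

sumSel-⊥ : (v : Fin m → V n) → sumSel v ⊥ ≡ zeroV
sumSel-⊥ {zero}  v = refl
sumSel-⊥ {suc m} v = trans (⊕-identityˡ _) (sumSel-⊥ (v ∘ suc))

scale-xor : ∀ b c (x : V n) →
  (if b xor c then x else zeroV) ≡ (if b then x else zeroV) ⊕ (if c then x else zeroV)
scale-xor false c     x = sym (⊕-identityˡ _)
scale-xor true  false x = sym (⊕-identityʳ _)
scale-xor true  true  x = sym (⊕-self x)

sumSel-⊕ : (v : Fin m → V n) (Y Z : Subset m) → sumSel v (Y ⊕ Z) ≡ sumSel v Y ⊕ sumSel v Z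
sumSel-⊕ v []      []      = sym (⊕-self zeroV)
sumSel-⊕ v (b ∷ Y) (c ∷ Z) =
  trans (cong₂ _⊕_ (scale-xor b c (v zero)) (sumSel-⊕ (v ∘ suc) Y Z)) (⊕-interchange _ _ _ _)

sumSel-⁅⁆ : (v : Fin m → V n) (i : Fin m) → sumSel v ⁅ i ⁆ ≡ v i
sumSel-⁅⁆ v zero    = trans (cong (v zero ⊕_) (sumSel-⊥ (v ∘ suc))) (⊕-identityʳ _)
sumSel-⁅⁆ v (suc i) = trans (⊕-identityˡ _) (sumSel-⁅⁆ (v ∘ suc) i)

sumSel-cong : {v w : Fin m → V n} → (∀ i → v i ≡ w i) → ∀ Y → sumSel v Y ≡ sumSel w Y
sumSel-cong eq []          = refl
sumSel-cong eq (true ∷ Y)  = cong₂ _⊕_ (eq zero) (sumSel-cong (eq ∘ suc) Y)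
sumSel-cong eq (false ∷ Y) = cong (zeroV ⊕_) (sumSel-cong (eq ∘ suc) Y)

sumSel-map : {h : V n → V k} → Additive h → (v : Fin m → V n) (Y : Subset m) →
             sumSel (h ∘ v) Y ≡ h (sumSel v Y)
sumSel-map add v []          = sym (additive-0 add)
sumSel-map add v (true ∷ Y)  = trans (cong (_ ⊕_) (sumSel-map add (v ∘ suc) Y)) (sym (add _ _))
sumSel-map {h = h} add v (false ∷ Y) =
  trans (⊕-identityˡ _) (trans (sumSel-map add (v ∘ suc) Y) (cong h (sym (⊕-identityˡ _))))

-- Subsets under symmetric difference are themselves a space over GF(2), with the singletons as
-- basis.
sumSel-singletons : (Y : Subset m) → sumSel ⁅_⁆ Y ≡ Y
sumSel-singletons []      = refl
sumSel-singletons (b ∷ Y) =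
  trans (cong (scaled b ⊕_) (trans (sumSel-map {h = false ∷_} (λ _ _ → refl) ⁅_⁆ Y) (cong (false ∷_) (sumSel-singletons Y))))
        (lemma b)
  where
  scaled : Bool → Subset _
  scaled b = if b then ⁅ zero ⁆ else zeroV
  lemma : ∀ b → scaled b ⊕ (false ∷ Y) ≡ b ∷ Y
  lemma true  = cong (true ∷_) (⊕-identityˡ Y)
  lemma false = cong (false ∷_) (⊕-identityˡ Y)

-- A normalising solver for linear identities over GF(2): the normal form of an
-- expression in k variables is its coefficient vector.

data Expr (k : ℕ) : Set where
  var : Fin k → Expr k
  𝟎   : Expr k
  _⊞_ : Expr k → Expr k → Expr k

infixl 6 _⊞_

⟦_⟧ : Expr k → Vec (V n) k → V n
⟦ var i ⟧ ρ = lookup ρ i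
⟦ 𝟎 ⟧ ρ     = zeroV
⟦ e ⊞ f ⟧ ρ = ⟦ e ⟧ ρ ⊕ ⟦ f ⟧ ρ

coeffs : Expr k → Subset k
coeffs (var i) = ⁅ i ⁆
coeffs 𝟎       = ⊥
coeffs (e ⊞ f) = coeffs e ⊕ coeffs f

⟦_⇓⟧ : Expr k → Vec (V n) k → V n
⟦ e ⇓⟧ ρ = sumSel (lookup ρ) (coeffs e)

⇓-correct : (e : Expr k) (ρ : Vec (V n) k) → ⟦ e ⇓⟧ ρ ≡ ⟦ e ⟧ ρ
⇓-correct (var i) ρ = sumSel-⁅⁆ (lookup ρ) i
⇓-correct 𝟎       ρ = sumSel-⊥ (lookup ρ)
⇓-correct (e ⊞ f) ρ = trans (sumSel-⊕ (lookup ρ) (coeffs e) (coeffs f)) (cong₂ _⊕_ (⇓-correct e ρ) (⇓-correct f ρ))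

infix 4 _⊜_

_⊜_ : Expr k → Expr k → Expr k × Expr k
_⊜_ = _,_

module Solver {n : ℕ} where
  open import Relation.Binary.Reflection (setoid (V n)) var ⟦_⟧ ⟦_⇓⟧ ⇓-correct public
    using (solve)
open Solver

⊕-cancel : (a b : V n) → (a ⊕ b) ⊕ b ≡ a
⊕-cancel = solve 2 (λ a b → ((a ⊞ b) ⊞ b) ⊜ a) refl

additive-injective : {h : V m → V n} → Additive h → Injective h → ∀ {a b} → h a ≡ h b → a ≡ b
additive-injective {h = h} add inj {a} {b} eq =
  ⊕≡0⇒≡ (inj _ (trans (add a b) (trans (cong (_⊕ h b) eq) (⊕-self (h b)))))

-- Subsets

∈⇒≡ : {i : Fin m} {X : Subset m} → i ∈ X → lookup X i ≡ true
∈⇒≡ = Vec.[]=⇒lookup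

≡⇒∈ : {i : Fin m} {X : Subset m} → lookup X i ≡ true → i ∈ X
≡⇒∈ = Vec.lookup⇒[]= _ _

∈-⊕⁻ : {i : Fin m} (Y Z : Subset m) → i ∈ Y ⊕ Z → i ∈ Y ⊎ i ∈ Z
∈-⊕⁻ {i = i} Y Z i∈ with lookup Y i in eqY | lookup Z i in eqZ
                         | trans (sym (Vec.lookup-zipWith _xor_ i Y Z)) (∈⇒≡ i∈)
... | true  | _     | _ = inj₁ (≡⇒∈ eqY)
... | false | true  | _ = inj₂ (≡⇒∈ eqZ)
... | false | false | ()

∈-⊕⁺ˡ : {i : Fin m} (Y Z : Subset m) → i ∈ Y → i ∉ Z → i ∈ Y ⊕ Z
∈-⊕⁺ˡ {i = i} Y Z i∈Y i∉Z with lookup Z i in eqZ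
... | true  = ⊥-elim (i∉Z (≡⇒∈ eqZ))
... | false = ≡⇒∈ (trans (Vec.lookup-zipWith _xor_ i Y Z) (cong₂ _xor_ (∈⇒≡ i∈Y) eqZ))

∉-⊕ : {i : Fin m} (Y Z : Subset m) → i ∈ Y → i ∈ Z → i ∉ Y ⊕ Z
∉-⊕ {i = i} Y Z i∈Y i∈Z i∈
  with trans (sym (trans (Vec.lookup-zipWith _xor_ i Y Z) (cong₂ _xor_ (∈⇒≡ i∈Y) (∈⇒≡ i∈Z)))) (∈⇒≡ i∈)
... | ()

⊆⊥⇒≡⊥ : {Y : Subset m} → Y ⊆ ⊥ → Y ≡ ⊥
⊆⊥⇒≡⊥ Y⊆ = ⊆-antisym Y⊆ (⊥-elim ∘ ∉⊥)

comprehend : {P : Fin m → Set} → (∀ i → Dec (P i)) → Subset m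
comprehend P? = tabulate (does ∘ P?)

∈-comprehend⁺ : {P : Fin m → Set} (P? : ∀ i → Dec (P i)) {i : Fin m} → P i → i ∈ comprehend P?
∈-comprehend⁺ P? {i} p = ≡⇒∈ (trans (Vec.lookup∘tabulate _ i) (dec-true (P? i) p))

∈-comprehend⁻ : {P : Fin m → Set} (P? : ∀ i → Dec (P i)) {i : Fin m} → i ∈ comprehend P? → P i
∈-comprehend⁻ P? {i} i∈ with P? i | trans (sym (Vec.lookup∘tabulate (does ∘ P?) i)) (∈⇒≡ i∈)
... | yes p | _ = p

∈-pre⁺ : {f : Fin m → Fin n} {X : Subset n} {i : Fin m} → f i ∈ X → i ∈ pre f X
∈-pre⁺ {i = i} fi∈ = ≡⇒∈ (trans (Vec.lookup∘tabulate _ i) (∈⇒≡ fi∈))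

∈-pre⁻ : {f : Fin m → Fin n} {X : Subset n} {i : Fin m} → i ∈ pre f X → f i ∈ X
∈-pre⁻ {i = i} i∈ = ≡⇒∈ (trans (sym (Vec.lookup∘tabulate _ i)) (∈⇒≡ i∈))

_⊆Im_ : Subset n → (Fin m → Fin n) → Set
X ⊆Im f = ∀ j → j ∈ X → ∃ λ i → f i ≡ j

pre-⊕ : (f : Fin m → Fin n) → Additive (pre f)
pre-⊕ {zero}  f Y Z = refl
pre-⊕ {suc m} f Y Z = cong₂ _∷_ (Vec.lookup-zipWith _xor_ (f zero) Y Z) (pre-⊕ (f ∘ suc) Y Z)

-- The direct image for injective `f`; otherwise points with an even number of preimages cancel.
-- Being linear, it needs no calculus beyond that of `sumSel`.
image : (Fin m → Fin n) → Subset m → Subset n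
image f = sumSel (⁅_⁆ ∘ f)

sumSel-image : (v : Fin n → V k) (f : Fin m → Fin n) (Y : Subset m) →
               sumSel v (image f Y) ≡ sumSel (v ∘ f) Y
sumSel-image v f Y =
  trans (sym (sumSel-map (sumSel-⊕ v) (⁅_⁆ ∘ f) Y)) (sumSel-cong (sumSel-⁅⁆ v ∘ f) Y)

∈-image⁻ : (f : Fin m → Fin n) (Y : Subset m) {j : Fin n} → j ∈ image f Y → ∃ λ i → i ∈ Y × f i ≡ j
∈-image⁻ f []          j∈ = ⊥-elim (∉⊥ j∈)
∈-image⁻ f (true ∷ Y)  j∈ with ∈-⊕⁻ ⁅ f zero ⁆ (image (f ∘ suc) Y) j∈
... | inj₁ j∈₁ = zero , Vec.here , sym (x∈⁅y⁆⇒x≡y _ j∈₁)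
... | inj₂ j∈₂ with i , i∈ , eq ← ∈-image⁻ (f ∘ suc) Y j∈₂ = suc i , Vec.there i∈ , eq
∈-image⁻ f (false ∷ Y) j∈
  with i , i∈ , eq ← ∈-image⁻ (f ∘ suc) Y (subst (_ ∈_) (⊕-identityˡ _) j∈) = suc i , Vec.there i∈ , eq

pre-image : {f : Fin m → Fin n} → Inj f → (Y : Subset m) → pre f (image f Y) ≡ Y
pre-image {f = f} inj Y =
  trans (sym (sumSel-map (pre-⊕ f) (⁅_⁆ ∘ f) Y)) (trans (sumSel-cong pre-⁅⁆ Y) (sumSel-singletons Y))
  where
  pre-⁅⁆ : ∀ i → pre f ⁅ f i ⁆ ≡ ⁅ i ⁆
  pre-⁅⁆ i = ⊆-antisym
    (λ {j} j∈ → subst (_∈ ⁅ i ⁆) (sym (inj j i (x∈⁅y⁆⇒x≡y _ (∈-pre⁻ j∈)))) (x∈⁅x⁆ i))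
    (λ {j} j∈ → subst (_∈ pre f ⁅ f i ⁆) (sym (x∈⁅y⁆⇒x≡y _ j∈)) (∈-pre⁺ (x∈⁅x⁆ (f i))))

∈-image⁺ : {f : Fin m → Fin n} → Inj f → (Y : Subset m) {i : Fin m} → i ∈ Y → f i ∈ image f Y
∈-image⁺ inj Y i∈ = ∈-pre⁻ (subst (_ ∈_) (sym (pre-image inj Y)) i∈)

image-pre : {f : Fin m → Fin n} → Inj f → {X : Subset n} → X ⊆Im f → image f (pre f X) ≡ X
image-pre {f = f} inj {X} X⊆ = ⊆-antisym
  (λ {j} j∈ → let i , i∈ , eq = ∈-image⁻ f (pre f X) j∈ in subst (_∈ X) eq (∈-pre⁻ i∈))
  (λ {j} j∈ → let i , eq = X⊆ j j∈ in
     subst (_∈ image f (pre f X)) eq (∈-image⁺ inj (pre f X) (∈-pre⁺ (subst (_∈ X) (sym eq) j∈))))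

-- Independence and span of families

image-⊥ : (f : Fin m → Fin n) → image f ⊥ ≡ ⊥
image-⊥ f = sumSel-⊥ (⁅_⁆ ∘ f)

linIndep-pre : (v : Fin n → V k) {f : Fin m → Fin n} → Inj f → (X : Subset n) → X ⊆Im f →
               LinIndep v X ⇔ LinIndep (v ∘ f) (pre f X)
linIndep-pre v {f} inj X X⊆ = mk⇔
  (λ ind Y Y⊆ eq → trans (sym (pre-image inj Y))
     (trans (cong (pre f) (ind (image f Y)
        (λ {_} j∈ → let i , i∈ , eq = ∈-image⁻ f Y j∈ in subst (_∈ X) eq (∈-pre⁻ (Y⊆ i∈)))
        (trans (sumSel-image v f Y) eq)))
      (additive-0 (pre-⊕ f))))
  (λ ind Y Y⊆ eq → trans (sym (image-pre inj (λ j j∈ → X⊆ j (Y⊆ j∈))))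
     (trans (cong (image f) (ind (pre f Y) (λ {_} i∈ → ∈-pre⁺ (Y⊆ (∈-pre⁻ i∈)))
       (trans (sym (sumSel-image v f (pre f Y)))
         (trans (cong (sumSel v) (image-pre inj (λ j j∈ → X⊆ j (Y⊆ j∈)))) eq))))
       (image-⊥ f)))

linIndep-image : (v : Fin n → V k) {f : Fin m → Fin n} → Inj f → (Y : Subset m) →
                 LinIndep v (image f Y) ⇔ LinIndep (v ∘ f) Y
linIndep-image v {f} inj Y =
  subst (λ Z → LinIndep v (image f Y) ⇔ LinIndep (v ∘ f) Z) (pre-image inj Y)
    (linIndep-pre v inj (image f Y) (λ j j∈ → let i , _ , eq = ∈-image⁻ f Y j∈ in i , eq))

linIndep-resp : {v : Fin m → V n} {w : Fin m → V k} →
                (∀ Y → sumSel v Y ≡ zeroV → sumSel w Y ≡ zeroV) → ∀ {X} → LinIndep w X → LinIndep v X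
linIndep-resp imp ind Y Y⊆ eq = ind Y Y⊆ (imp Y eq)

-- Equality of cycle spaces: both families represent the same binary matroid, in possibly unrelated
-- ambient spaces.
CycEq : (Fin m → V n) → (Fin m → V k) → Set
CycEq v w = ∀ Y → sumSel v Y ≡ zeroV ⇔ sumSel w Y ≡ zeroV

cycEq-sym : {v : Fin m → V n} {w : Fin m → V k} → CycEq v w → CycEq w v
cycEq-sym vw Y = mk⇔ (from (vw Y)) (to (vw Y))

cycEq-trans : ∀ {l} {u : Fin m → V l} {v : Fin m → V n} {w : Fin m → V k} → CycEq u v → CycEq v w → CycEq u w
cycEq-trans uv vw Y = mk⇔ (to (vw Y) ∘ to (uv Y)) (from (uv Y) ∘ from (vw Y))

cycEq-linear : {h : V n → V k} → Additive h → Injective h → (v : Fin m → V n) → CycEq (h ∘ v) v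
cycEq-linear {h = h} add inj v Y = mk⇔
  (λ eq → inj _ (trans (sym (sumSel-map add v Y)) eq))
  (λ eq → trans (sumSel-map add v Y) (trans (cong h eq) (additive-0 add)))

cycEq-cong : {v w : Fin m → V n} → (∀ i → v i ≡ w i) → CycEq v w
cycEq-cong eq Y = mk⇔ (trans (sym (sumSel-cong eq Y))) (trans (sumSel-cong eq Y))

cycEq-reindex : {v : Fin m → V n} {w : Fin m → V k} → CycEq v w → ∀ {l} (f : Fin l → Fin m) →
                CycEq (v ∘ f) (w ∘ f)
cycEq-reindex {v = v} {w} vw f Y = mk⇔
  (λ eq → trans (sym (sumSel-image w f Y)) (to (vw (image f Y)) (trans (sumSel-image v f Y) eq)))
  (λ eq → trans (sym (sumSel-image v f Y)) (from (vw (image f Y)) (trans (sumSel-image w f Y) eq)))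

cycEq⇒indep : {v : Fin m → V n} {w : Fin m → V k} → CycEq v w → ∀ X → LinIndep v X ⇔ LinIndep w X
cycEq⇒indep {v = v} {w} vw X = mk⇔
  (linIndep-resp {v = w} {w = v} (from ∘ vw)) (linIndep-resp {v = v} {w = w} (to ∘ vw))

≢⊥-witness : (Z : Subset m) → Z ≢ ⊥ → ∃ (_∈ Z)
≢⊥-witness Z Z≢⊥ with Fin.any? (_∈? Z)
... | yes w = w
... | no ¬w = ⊥-elim (Z≢⊥ (⊆⊥⇒≡⊥ (λ {i} i∈ → ⊥-elim (¬w (i , i∈)))))

⊆∧≢⇒∣∣< : {Y Z : Subset m} → Z ⊆ Y → Z ≢ Y → ∣ Z ∣ < ∣ Y ∣
⊆∧≢⇒∣∣< {Y = Y} {Z} Z⊆Y Z≢Y with Fin.any? (λ i → (i ∈? Y) ×-dec ¬? (i ∈? Z))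
... | yes w = p⊂q⇒∣p∣<∣q∣ (Z⊆Y , w)
... | no ¬w = ⊥-elim (Z≢Y (⊆-antisym Z⊆Y Y⊆Z))
  where
  Y⊆Z : Y ⊆ Z
  Y⊆Z {i} i∈Y with i ∈? Z
  ... | yes i∈Z = i∈Z
  ... | no  i∉Z = ⊥-elim (¬w (i , i∈Y , i∉Z))

dependency : (v : Fin m → V n) (X : Subset m) → ¬ LinIndep v X →
             ∃ λ Z → Z ⊆ X × Z ≢ ⊥ × sumSel v Z ≡ zeroV
dependency v X dep
  with anySubset? (λ Z → (Z ⊆? X) ×-dec ¬? (Z ≟ⱽ ⊥) ×-dec (sumSel v Z ≟ⱽ zeroV))
... | yes w = w
... | no ¬w = ⊥-elim (dep indep)
  where
  indep : LinIndep v X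
  indep Y Y⊆ eq with Y ≟ⱽ ⊥
  ... | yes Y≡⊥ = Y≡⊥
  ... | no  Y≢⊥ = ⊥-elim (¬w (Y , Y⊆ , Y≢⊥ , eq))

-- A zero-sum set either splits into two smaller ones or is a circuit, and circuits
-- are determined by the independent sets.
zeroSum-resp : (v : Fin m → V n) (w : Fin m → V k) → (∀ X → LinIndep v X ⇔ LinIndep w X) →
               ∀ s Y → ∣ Y ∣ < s → sumSel v Y ≡ zeroV → sumSel w Y ≡ zeroV
zeroSum-resp v w ind (suc s) Y (s≤s ∣Y∣≤s) eq
  with Y ≟ⱽ ⊥ | anySubset? (λ Z → (Z ⊆? Y) ×-dec ¬? (Z ≟ⱽ ⊥) ×-dec ¬? (Z ≟ⱽ Y) ×-dec (sumSel v Z ≟ⱽ zeroV))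
... | yes Y≡⊥ | _ = trans (cong (sumSel w) Y≡⊥) (sumSel-⊥ w)
... | no Y≢⊥ | yes (Z , Z⊆Y , Z≢⊥ , Z≢Y , sumZ) =
  trans (cong (sumSel w) (sym (⊕-cancel Y Z)))
  (trans (sumSel-⊕ w (Y ⊕ Z) Z)
  (trans (cong₂ _⊕_
     (zeroSum-resp v w ind s (Y ⊕ Z) (ℕ.<-≤-trans (⊆∧≢⇒∣∣< ⊕⊆ ⊕≢) ∣Y∣≤s)
        (trans (sumSel-⊕ v Y Z) (trans (cong₂ _⊕_ eq sumZ) (⊕-self zeroV))))
     (zeroSum-resp v w ind s Z (ℕ.<-≤-trans (⊆∧≢⇒∣∣< Z⊆Y Z≢Y) ∣Y∣≤s) sumZ))
   (⊕-self zeroV)))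
  where
  ⊕⊆ : Y ⊕ Z ⊆ Y
  ⊕⊆ i∈ = [ id , Z⊆Y ]′ (∈-⊕⁻ Y Z i∈)
  ⊕≢ : Y ⊕ Z ≢ Y
  ⊕≢ eq′ with i , i∈Z ← ≢⊥-witness Z Z≢⊥ = ∉-⊕ Y Z (Z⊆Y i∈Z) i∈Z (subst (i ∈_) (sym eq′) (Z⊆Y i∈Z))
... | no Y≢⊥ | no circuit
  with Z , Z⊆Y , Z≢⊥ , sumZ ← dependency w Y (λ indW → Y≢⊥ (from (ind Y) indW Y id eq))
  with Z ≟ⱽ Y
... | yes refl = sumZ
-- `Y` is a circuit of `v`, while a proper `Z` would be dependent for `v` as well.
... | no  Z≢Y
  with Z′ , Z′⊆Z , Z′≢⊥ , sumZ′ ← dependency v Z (λ indV → Z≢⊥ (to (ind Z) indV Z id sumZ)) =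
  ⊥-elim (circuit (Z′ , (λ i∈ → Z⊆Y (Z′⊆Z i∈)) , Z′≢⊥ , Z′≢Y , sumZ′))
  where
  Z′≢Y : Z′ ≢ Y
  Z′≢Y refl = Z≢Y (⊆-antisym Z⊆Y Z′⊆Z)

-- Unique representability over GF(2).
indep⇒cycEq : {v : Fin m → V n} {w : Fin m → V k} → (∀ X → LinIndep v X ⇔ LinIndep w X) → CycEq v w
indep⇒cycEq {v = v} {w} ind Y = mk⇔
  (zeroSum-resp v w ind _ Y ℕ.≤-refl)
  (zeroSum-resp w v (λ X → mk⇔ (from (ind X)) (to (ind X))) _ Y ℕ.≤-refl)

-- Subspaces and quotients

-- Membership is decidable so that a list of vectors can be filtered by a subspace.
record Subspace (n : ℕ) : Set₁ where
  field
    Mem  : V n → Set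
    mem? : ∀ v → Dec (Mem v)
    0∈   : Mem zeroV
    add∈ : ∀ {a b} → Mem a → Mem b → Mem (a ⊕ b)

  cancel∈ : ∀ {a b} → Mem (a ⊕ b) → Mem b → Mem a
  cancel∈ {a} {b} ab b∈ = subst Mem (⊕-cancel a b) (add∈ ab b∈)

open Subspace

trivial : Subspace n
trivial = record
  { Mem = _≡ zeroV ; mem? = _≟ⱽ zeroV ; 0∈ = refl
  ; add∈ = λ { refl refl → ⊕-self zeroV } }

_⊓_ : Subspace n → Subspace n → Subspace n
A ⊓ B = record
  { Mem  = λ v → Mem A v × Mem B v
  ; mem? = λ v → mem? A v ×-dec mem? B v
  ; 0∈   = 0∈ A , 0∈ B
  ; add∈ = λ (a , b) (a′ , b′) → add∈ A a a′ , add∈ B b b′ }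

_⊔_ : Subspace n → Subspace n → Subspace n
A ⊔ B = record
  { Mem  = λ v → ∃ λ a → Mem A a × Mem B (v ⊕ a)
  ; mem? = λ v → anySubset? (λ a → mem? A a ×-dec mem? B (v ⊕ a))
  ; 0∈   = zeroV , 0∈ A , subst (Mem B) (sym (⊕-self zeroV)) (0∈ B)
  ; add∈ = λ {u} {v} (a , a∈ , ua) (b , b∈ , vb) →
      a ⊕ b , add∈ A a∈ b∈ , subst (Mem B) (⊕-interchange u a v b) (add∈ B ua vb) }

⊔-introˡ : (A B : Subspace n) {v : V n} → Mem A v → Mem (A ⊔ B) v
⊔-introˡ A B {v} v∈ = v , v∈ , subst (Mem B) (sym (⊕-self v)) (0∈ B)

⊔-introʳ : (A B : Subspace n) {v : V n} → Mem B v → Mem (A ⊔ B) v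
⊔-introʳ A B {v} v∈ = zeroV , 0∈ A , subst (Mem B) (sym (⊕-identityʳ v)) v∈

comap : (h : V m → V n) → Additive h → Subspace n → Subspace m
comap h add W = record
  { Mem  = Mem W ∘ h
  ; mem? = mem? W ∘ h
  ; 0∈   = subst (Mem W) (sym (additive-0 add)) (0∈ W)
  ; add∈ = λ a b → subst (Mem W) (sym (add _ _)) (add∈ W a b) }

-- `codim` is the dimension of the quotient; `dim≡` is what makes rank drop under contraction.
record Quotient (x : V n) : Set where
  field
    codim    : ℕ
    dim≡     : n ≡ suc codim
    proj     : V n → V codim
    proj-add : Additive proj
    proj-x   : proj x ≡ zeroV
    kernel   : ∀ v → proj v ≡ zeroV → v ≡ zeroV ⊎ v ≡ x

  fibre : ∀ {u v} → proj u ≡ proj v → u ≡ v ⊎ u ≡ v ⊕ x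
  fibre {u} {v} eq with kernel (u ⊕ v) (trans (proj-add u v) (trans (cong (_⊕ proj v) eq) (⊕-self _)))
  ... | inj₁ u⊕v≡0 = inj₁ (⊕≡0⇒≡ u⊕v≡0)
  ... | inj₂ u⊕v≡x = inj₂ (trans (solve 2 (λ u v → u ⊜ v ⊞ (u ⊞ v)) refl u v) (cong (v ⊕_) u⊕v≡x))

  proj-+x : ∀ v → proj (v ⊕ x) ≡ proj v
  proj-+x v = trans (proj-add v x) (trans (cong (proj v ⊕_) proj-x) (⊕-identityʳ _))

open Quotient

-- The first coordinate in which `x` is 1 is the pivot: it is cleared by adding `x` and then
-- dropped.
quotient : (x : V n) → x ≢ zeroV → Quotient x
quotient []           x≢0 = ⊥-elim (x≢0 refl)
quotient (true ∷ x)  x≢0 = record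
  { dim≡     = refl
  ; proj     = λ { (b ∷ v) → v ⊕ (if b then x else zeroV) }
  ; proj-add = λ { (b ∷ u) (c ∷ v) →
      trans (cong ((u ⊕ v) ⊕_) (scale-xor b c x)) (⊕-interchange u v _ _) }
  ; proj-x   = ⊕-self x
  ; kernel   = λ { (false ∷ v) eq → inj₁ (cong (false ∷_) (trans (sym (⊕-identityʳ v)) eq))
                 ; (true ∷ v) eq → inj₂ (cong (true ∷_) (⊕≡0⇒≡ eq)) } }
quotient (false ∷ x) x≢0 = record
  { dim≡     = cong suc (dim≡ q)
  ; proj     = λ { (b ∷ v) → b ∷ proj q v }
  ; proj-add = λ { (b ∷ u) (c ∷ v) → cong (_ ∷_) (proj-add q u v) }
  ; proj-x   = cong (false ∷_) (proj-x q)
  ; kernel   = λ { (b ∷ v) eq → map⊎ (cong₂ _∷_ (Vec.∷-injectiveˡ eq)) (cong₂ _∷_ (Vec.∷-injectiveˡ eq))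
                                  (kernel q v (Vec.∷-injectiveʳ eq)) } }
  where
  q = quotient x (x≢0 ∘ cong (false ∷_))

-- Finite sets of vectors, with the zero vector adjoined

infix 4 _∋_ _∋?_

_∋_ : List (V n) → V n → Set
S ∋ v = v ≡ zeroV ⊎ v ∈ₗ S

_∋?_ : (S : List (V n)) (v : V n) → Dec (S ∋ v)
S ∋? v = (v ≟ⱽ zeroV) ⊎-dec DecMembership._∈?_ _≟ⱽ_ v S

restrict : List (V n) → Subspace n → List (V n)
restrict S W = filter (mem? W) S

nonzero? : (v : V n) → Dec (v ≢ zeroV)
nonzero? v = ¬? (v ≟ⱽ zeroV)

-- Parallel elements stay as repeated entries; removing the zero images, that of a listed `x` among
-- them, already shortens the list.
contract : {x : V n} (S : List (V n)) (q : Quotient x) → List (V (codim q))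
contract S q = filter nonzero? (List.map (proj q) S)

restrict-∋⁻ : {S : List (V n)} (W : Subspace n) {v : V n} → restrict S W ∋ v → S ∋ v
restrict-∋⁻ W (inj₁ eq) = inj₁ eq
restrict-∋⁻ {S = S} W (inj₂ v∈) = inj₂ (proj₁ (List∈.∈-filter⁻ (mem? W) {xs = S} v∈))

restrict-< : {S : List (V n)} (W : Subspace n) {a : V n} → a ∈ₗ S → ¬ Mem W a → length (restrict S W) < length S
restrict-< {S = S} W a∈ a∉ = List.filter-notAll (mem? W) S (lose a∈ a∉)

contract-∈⁻ : {x : V n} {S : List (V n)} (q : Quotient x) {w : V (codim q)} →
              w ∈ₗ contract S q → ∃ λ s → s ∈ₗ S × w ≡ proj q s
contract-∈⁻ {S = S} q w∈ = List∈.∈-map⁻ (proj q) (proj₁ (List∈.∈-filter⁻ nonzero? {xs = List.map (proj q) S} w∈))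

contract-∋⁺ : {x : V n} {S : List (V n)} (q : Quotient x) {v : V n} → S ∋ v → contract S q ∋ proj q v
contract-∋⁺ q (inj₁ refl) = inj₁ (additive-0 (proj-add q))
contract-∋⁺ q {v} (inj₂ v∈) with proj q v ≟ⱽ zeroV
... | yes eq = inj₁ eq
... | no neq = inj₂ (List∈.∈-filter⁺ nonzero? (List∈.∈-map⁺ (proj q) v∈) neq)

contract-lift : {x : V n} {S : List (V n)} (q : Quotient x) {v : V n} → contract S q ∋ proj q v → S ∋ v ⊎ S ∋ v ⊕ x
contract-lift {x = x} {S} q {v} (inj₁ eq) with kernel q v eq
... | inj₁ v≡0 = inj₁ (inj₁ v≡0)
... | inj₂ refl = inj₂ (inj₁ (⊕-self v))
contract-lift {S = S} q (inj₂ w∈) with s , s∈ , eq ← contract-∈⁻ {S = S} q w∈ | fibre q (sym eq)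
... | inj₁ refl = inj₁ (inj₂ s∈)
... | inj₂ refl = inj₂ (inj₂ s∈)

contract-< : {x : V n} {S : List (V n)} (q : Quotient x) → x ∈ₗ S → length (contract S q) < length S
contract-< {S = S} q x∈ = subst (length (contract S q) <_) (List.length-map (proj q) S)
  (List.filter-notAll nonzero? (List.map (proj q) S)
    (lose (List∈.∈-map⁺ (proj q) x∈) (λ neq → neq (proj-x q))))

filter-length-< : {A : Set} {P Q : A → Set} (P? : ∀ a → Dec (P a)) (Q? : ∀ a → Dec (Q a)) (xs : List A) →
                  (∀ {a} → a ∈ₗ xs → P a → Q a) → ∀ {a} → a ∈ₗ xs → Q a → ¬ P a →
                  length (filter P? xs) < length (filter Q? xs)
filter-length-≤ : {A : Set} {P Q : A → Set} (P? : ∀ a → Dec (P a)) (Q? : ∀ a → Dec (Q a)) (xs : List A) →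
                  (∀ {a} → a ∈ₗ xs → P a → Q a) → length (filter P? xs) ≤ length (filter Q? xs)
filter-length-≤ P? Q? [] P⊆Q = z≤n
filter-length-≤ P? Q? (x ∷ xs) P⊆Q with P? x | Q? x
... | yes p | yes q = s≤s (filter-length-≤ P? Q? xs (P⊆Q ∘ there))
... | yes p | no ¬q = ⊥-elim (¬q (P⊆Q (here refl) p))
... | no ¬p | yes q = ℕ.m≤n⇒m≤1+n (filter-length-≤ P? Q? xs (P⊆Q ∘ there))
... | no ¬p | no ¬q = filter-length-≤ P? Q? xs (P⊆Q ∘ there)
filter-length-< P? Q? (x ∷ xs) P⊆Q (here refl) q ¬p with P? x | Q? x
... | yes p | _     = ⊥-elim (¬p p)
... | no _  | no ¬q = ⊥-elim (¬q q)
... | no _  | yes _ = s≤s (filter-length-≤ P? Q? xs (P⊆Q ∘ there))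
filter-length-< P? Q? (x ∷ xs) P⊆Q (there a∈) q ¬p with P? x | Q? x
... | yes p′ | yes _ = s≤s (filter-length-< P? Q? xs (P⊆Q ∘ there) a∈ q ¬p)
... | yes p′ | no ¬q = ⊥-elim (¬q (P⊆Q (here refl) p′))
... | no _   | yes _ = ℕ.m≤n⇒m≤1+n (filter-length-< P? Q? xs (P⊆Q ∘ there) a∈ q ¬p)
... | no _   | no _  = filter-length-< P? Q? xs (P⊆Q ∘ there) a∈ q ¬p

-- Splits, cones, and lifting them from a quotient

Closed : List (V n) → Set
Closed S = ∀ {a b} → S ∋ a → S ∋ b → S ∋ a ⊕ b

-- `out₁` and `out₂` keep both sides proper, so that induction on the number of vectors can descend
-- into them.
record Split (S : List (V n)) : Set₁ where
  field
    W₁ W₂ : Subspace n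
    cover : ∀ {v} → v ∈ₗ S → Mem W₁ v ⊎ Mem W₂ v
    meet  : ∀ {v} → Mem W₁ v → Mem W₂ v → S ∋ v
    out₁  : ∃ λ a → a ∈ₗ S × ¬ Mem W₁ a
    out₂  : ∃ λ a → a ∈ₗ S × ¬ Mem W₂ a

SplitAt : List (V n) → V n → Set₁
SplitAt S x = Σ (Split S) λ d → Mem (Split.W₁ d) x × Mem (Split.W₂ d) x

-- In the quotient by x the set S is the graph of a linear function, apart from the
-- vectors that are doubled by x.
Cone : List (V n) → V n → Set₁
Cone {n} S x = Σ (Subspace n) λ H → ¬ Mem H x × (∀ {s} → s ∈ₗ S → ¬ Mem H s → S ∋ s ⊕ x)

∃∈? : {S : List (V n)} {P : V n → Set} → (∀ v → Dec (P v)) →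
      (∃ λ v → v ∈ₗ S × P v) ⊎ (∀ {v} → v ∈ₗ S → ¬ P v)
∃∈? {S = S} P? with Any.any? P? S
... | yes any = inj₁ (find any)
... | no ¬any = inj₂ (λ v∈ p → ¬any (lose v∈ p))

decidable-¬¬ : {P : Set} → Dec P → ¬ ¬ P → P
decidable-¬¬ (yes p) _   = p
decidable-¬¬ (no ¬p) ¬¬p = ⊥-elim (¬¬p ¬p)

split-swap : {S : List (V n)} → Split S → Split S
split-swap d = record
  { W₁ = Split.W₂ d ; W₂ = Split.W₁ d ; cover = λ v∈ → swap⊎ (Split.cover d v∈)
  ; meet = λ w₂ w₁ → Split.meet d w₁ w₂ ; out₁ = Split.out₂ d ; out₂ = Split.out₁ d }

-- A split of the quotient of S by x, pulled back.
record SplitMod (S : List (V n)) (x : V n) : Set₁ where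
  field
    P₁ P₂ : Subspace n
    x∈₁   : Mem P₁ x
    x∈₂   : Mem P₂ x
    cover : ∀ {v} → v ∈ₗ S → Mem P₁ v ⊎ Mem P₂ v
    meet  : ∀ {v} → Mem P₁ v → Mem P₂ v → S ∋ v ⊎ S ∋ v ⊕ x
    out₁  : ∃ λ a → a ∈ₗ S × ¬ Mem P₁ a
    out₂  : ∃ λ a → a ∈ₗ S × ¬ Mem P₂ a

splitMod-swap : {S : List (V n)} {x : V n} → SplitMod S x → SplitMod S x
splitMod-swap d = record
  { P₁ = P₂ ; P₂ = P₁ ; x∈₁ = x∈₂ ; x∈₂ = x∈₁ ; cover = λ v∈ → swap⊎ (cover v∈)
  ; meet = λ p₂ p₁ → meet p₁ p₂ ; out₁ = out₂ ; out₂ = out₁ }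
  where open SplitMod d

splitMod-pull : {S : List (V n)} {x : V n} (q : Quotient x) → Split (contract S q) → SplitMod S x
splitMod-pull {S = S} {x} q d = record
  { P₁ = comap (proj q) (proj-add q) (Split.W₁ d) ; P₂ = comap (proj q) (proj-add q) (Split.W₂ d)
  ; x∈₁ = subst (Mem (Split.W₁ d)) (sym (proj-x q)) (0∈ (Split.W₁ d))
  ; x∈₂ = subst (Mem (Split.W₂ d)) (sym (proj-x q)) (0∈ (Split.W₂ d))
  ; cover = λ v∈ → cover₀ (contract-∋⁺ q (inj₂ v∈))
  ; meet = λ p₁ p₂ → contract-lift q (Split.meet d p₁ p₂)
  ; out₁ = lift-out (Split.W₁ d) (Split.out₁ d) ; out₂ = lift-out (Split.W₂ d) (Split.out₂ d) }
  where
  cover₀ : ∀ {w} → contract S q ∋ w → Mem (Split.W₁ d) w ⊎ Mem (Split.W₂ d) w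
  cover₀ (inj₁ refl) = inj₁ (0∈ (Split.W₁ d))
  cover₀ (inj₂ w∈)   = Split.cover d w∈
  lift-out : (W : Subspace _) → (∃ λ a → a ∈ₗ contract S q × ¬ Mem W a) → ∃ λ a → a ∈ₗ S × ¬ Mem W (proj q a)
  lift-out W (a , a∈ , a∉) with s , s∈ , refl ← contract-∈⁻ {S = S} q a∈ = s , s∈ , a∉

-- A splitting of one side through x extends to all of S: the intersection with the
-- other side is a clique modulo x, so it lies in one of the two parts.
module Graft {S : List (V n)} {x : V n} (M : SplitMod S x) where
  open SplitMod M

  -- `P₂` is absorbed into the part that contains P₁ ∩ P₂. By the modular law the enlarged part
  -- still meets `P₁` only in W₁ ∩ P₁, so the intersection with the other part does not grow.
  graft′ : (d : SplitAt (restrict S P₁) x) →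
           (∀ {t} → t ∈ₗ S → Mem P₁ t → Mem P₂ t → Mem (Split.W₁ (proj₁ d)) t) → SplitAt S x
  graft′ (d , x∈W₁ , x∈W₂) T⊆ = record
    { W₁ = A ; W₂ = B ; cover = λ v∈ → [ cov₁ v∈ , (λ p₂ → inj₁ (⊔-introʳ (Split.W₁ d ⊓ P₁) P₂ p₂)) ]′ (cover v∈)
    ; meet = meet-AB
    ; out₁ = a , proj₁ (List∈.∈-filter⁻ (mem? P₁) {xs = S} a∈) , a∉A
    ; out₂ = let b , b∈ , b∉ = out₁ in b , b∈ , b∉ ∘ proj₂ }
    , ⊔-introˡ (Split.W₁ d ⊓ P₁) P₂ (x∈W₁ , x∈₁) , x∈W₂ , x∈₁
    where
    module d = Split d
    A = (d.W₁ ⊓ P₁) ⊔ P₂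
    B = d.W₂ ⊓ P₁
    a = proj₁ d.out₁
    a∈ = proj₁ (proj₂ d.out₁)
    U⊆ : ∀ {v} → Mem P₁ v → Mem P₂ v → Mem d.W₁ v
    U⊆ {v} p₁ p₂ with meet p₁ p₂
    ... | inj₁ (inj₁ refl) = 0∈ d.W₁
    ... | inj₁ (inj₂ v∈)   = T⊆ v∈ p₁ p₂
    ... | inj₂ (inj₁ eq)   = subst (Mem d.W₁) (sym (⊕≡0⇒≡ eq)) x∈W₁
    ... | inj₂ (inj₂ vx∈)  = cancel∈ d.W₁ (T⊆ vx∈ (add∈ P₁ p₁ x∈₁) (add∈ P₂ p₂ x∈₂)) x∈W₁
    cov₁ : ∀ {v} → v ∈ₗ S → Mem P₁ v → Mem A v ⊎ Mem B v
    cov₁ v∈ p₁ with d.cover (List∈.∈-filter⁺ (mem? P₁) v∈ p₁)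
    ... | inj₁ w₁ = inj₁ (⊔-introˡ (d.W₁ ⊓ P₁) P₂ (w₁ , p₁))
    ... | inj₂ w₂ = inj₂ (w₂ , p₁)
    meet-AB : ∀ {v} → Mem A v → Mem B v → S ∋ v
    meet-AB (a , (w₁ , p₁) , p₂) (w₂ , p₁v) =
      restrict-∋⁻ P₁ (d.meet (cancel∈ d.W₁ (U⊆ (add∈ P₁ p₁v p₁) p₂) w₁) w₂)
    a∉A : ¬ Mem A a
    a∉A (a′ , (w₁ , p₁) , p₂) = proj₂ (proj₂ d.out₁)
      (cancel∈ d.W₁ (U⊆ (add∈ P₁ (proj₂ (List∈.∈-filter⁻ (mem? P₁) {xs = S} a∈)) p₁) p₂) w₁)

  graft : SplitAt (restrict S P₁) x → SplitAt S x
  graft D@(d , x∈W₁ , x∈W₂)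
    with ∃∈? {S = S} (λ t → mem? P₁ t ×-dec mem? P₂ t ×-dec ¬? (mem? (Split.W₁ d) t))
  ... | inj₂ none = graft′ D (λ t∈ p₁ p₂ → decidable-¬¬ (mem? (Split.W₁ d) _) (λ t∉ → none t∈ (p₁ , p₂ , t∉)))
  ... | inj₁ (t , t∈ , p₁ , p₂ , t∉W₁) = graft′ (split-swap d , x∈W₂ , x∈W₁) T⊆
    where
    module d = Split d
    in-d : ∀ {v} → S ∋ v → Mem P₁ v → Mem d.W₁ v ⊎ Mem d.W₂ v
    in-d (inj₁ refl) _ = inj₁ (0∈ d.W₁)
    in-d (inj₂ v∈) p = d.cover (List∈.∈-filter⁺ (mem? P₁) v∈ p)
    t∈W₂ : Mem d.W₂ t
    t∈W₂ with in-d (inj₂ t∈) p₁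
    ... | inj₁ w₁ = ⊥-elim (t∉W₁ w₁)
    ... | inj₂ w₂ = w₂
    in-d′ : ∀ {v} → S ∋ v ⊎ S ∋ v ⊕ x → Mem P₁ v → Mem d.W₁ v ⊎ Mem d.W₂ v
    in-d′ (inj₁ v∈) p = in-d v∈ p
    in-d′ (inj₂ vx∈) p with in-d vx∈ (add∈ P₁ p x∈₁)
    ... | inj₁ w₁ = inj₁ (cancel∈ d.W₁ w₁ x∈W₁)
    ... | inj₂ w₂ = inj₂ (cancel∈ d.W₂ w₂ x∈W₂)
    T⊆ : ∀ {s} → s ∈ₗ S → Mem P₁ s → Mem P₂ s → Mem d.W₂ s
    T⊆ {s} s∈ q₁ q₂ with in-d (inj₂ s∈) q₁
    ... | inj₂ w₂ = w₂
    -- s + t is in `S` up to adding x, and x lies in both parts, so s + t lies in one of them. With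
    -- `s` in `d.W₁` and `t` outside, it must be `d.W₂`, which also contains `t`.
    ... | inj₁ w₁ with in-d′ (meet (add∈ P₁ q₁ p₁) (add∈ P₂ q₂ p₂)) (add∈ P₁ q₁ p₁)
    ...   | inj₂ w₂ = cancel∈ d.W₂ w₂ t∈W₂
    ...   | inj₁ w₁′ = ⊥-elim (t∉W₁ (cancel∈ d.W₁ (subst (Mem d.W₁) (⊕-comm s t) w₁′) w₁))

-- Closed-or-split dichotomy for sets without the two configurations

-- Only heredity and two local conditions are used. Both conditions may be stated without
-- independence of a, b, c: for dependent triples they hold in every set, because 0 counts as a
-- member.
module Structure
  (Good : ∀ {n} → List (V n) → Set)
  (good-restrict : ∀ {n} {S : List (V n)} → Good S → (W : Subspace n) → Good (restrict S W))
  (good-contract : ∀ {n} {S : List (V n)} {x : V n} → Good S → x ∈ₗ S → x ≢ zeroV →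
                   (q : Quotient x) → Good (contract S q))
  (no-K₄ : ∀ {n} {S : List (V n)} → Good S → ∀ {a b c} → S ∋ a → S ∋ b → S ∋ c →
           S ∋ a ⊕ b → S ∋ a ⊕ c → S ∋ b ⊕ c → S ∋ (a ⊕ b) ⊕ c)
  (no-U₃₄ : ∀ {n} {S : List (V n)} → Good S → ∀ {a b c} → S ∋ a → S ∋ b → S ∋ c →
            S ∋ (a ⊕ b) ⊕ c → S ∋ a ⊕ b ⊎ S ∋ a ⊕ c ⊎ S ∋ b ⊕ c)
  where

  module Doubled {n} {S : List (V n)} (good : Good S) {x : V n} (x∈S : S ∋ x) where

    _≈>_ : ∀ {a b} → S ∋ a → a ≡ b → S ∋ b
    s ≈> eq = subst (S ∋_) eq s

    -- `no-K₄` in the span of a, b and x; in the second case `a ⊕ x` takes the place of `a`.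
    double-add : ∀ {a b} → S ∋ a → S ∋ a ⊕ x → S ∋ b → S ∋ b ⊕ x → S ∋ a ⊕ b ⊎ S ∋ (a ⊕ b) ⊕ x →
                 S ∋ a ⊕ b × S ∋ (a ⊕ b) ⊕ x
    double-add a ax b bx (inj₁ ab) = ab , no-K₄ good a b x∈S ab ax bx
    double-add {u} {v} a ax b bx (inj₂ abx) =
      (no-K₄ good ax b x∈S (abx ≈> solve 3 (λ u v x → (u ⊞ v) ⊞ x ⊜ (u ⊞ x) ⊞ v) refl u v x)
         (a ≈> solve 2 (λ u x → u ⊜ (u ⊞ x) ⊞ x) refl u x) bx
       ≈> solve 3 (λ u v x → ((u ⊞ x) ⊞ v) ⊞ x ⊜ u ⊞ v) refl u v x) , abx

    -- Mostly used in contrapositive form: adding a doubled vector to an undoubled one gives an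
    -- undoubled one, provided the sum is in `S`.
    double-diff : ∀ {a q} → S ∋ a → S ∋ a ⊕ x → S ∋ q → S ∋ a ⊕ q → S ∋ (a ⊕ q) ⊕ x → S ∋ q ⊕ x
    double-diff {a} {q} sa sax sq saq saqx =
      proj₂ (double-add saq saqx sa sax (inj₁ (sq ≈> eq))) ≈> cong (_⊕ x) (sym eq)
      where eq = solve 2 (λ a q → q ⊜ (a ⊞ q) ⊞ a) refl a q

    -- The quotient by x is a projective geometry.
    module ClosedMod (closed : ∀ {s t} → S ∋ s → S ∋ t → S ∋ s ⊕ t ⊎ S ∋ (s ⊕ t) ⊕ x) where

      -- Otherwise s, t, x and s + t + x form a U₃,₄.
      single-add : ∀ {s t} → S ∋ s → ¬ S ∋ s ⊕ x → S ∋ t → ¬ S ∋ t ⊕ x → S ∋ s ⊕ t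
      single-add s ¬sx t ¬tx with closed s t
      ... | inj₁ st = st
      ... | inj₂ stx with no-U₃₄ good s t x∈S stx
      ...   | inj₁ st = st
      ...   | inj₂ (inj₁ sx) = ⊥-elim (¬sx sx)
      ...   | inj₂ (inj₂ tx) = ⊥-elim (¬tx tx)

      -- If q + a + b + x were in S instead, contracting a would leave the seven points
      -- of the plane spanned by b, q and x except for q + x.
      affine : ∀ {q a b} → S ∋ q → ¬ S ∋ q ⊕ x → S ∋ a → S ∋ a ⊕ x → S ∋ b → S ∋ b ⊕ x →
               S ∋ q ⊕ a → S ∋ q ⊕ b → S ∋ q ⊕ (a ⊕ b)
      affine {q} {a} {b} sq ¬qx sa@(inj₁ refl) sax sb sbx qa qb = qb ≈> cong (q ⊕_) (sym (⊕-identityˡ b))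
      affine {q} {a} {b} sq ¬qx sa@(inj₂ a∈) sax sb sbx qa qb with a ≟ⱽ zeroV
      ... | yes refl = qb ≈> cong (q ⊕_) (sym (⊕-identityˡ b))
      ... | no a≢0 with closed sq (proj₁ (double-add sa sax sb sbx (closed sa sb)))
      ...   | inj₁ qab = qab
      ...   | inj₂ qabx = ⊥-elim ([ ¬qx , contra ]′ (contract-lift Q (subst (contract S Q ∋_) eq K)))
        where
        Q = quotient a a≢0
        π = proj Q
        infixl 5 _⟨≈⟩_
        _⟨≈⟩_ : ∀ {u v} → S ∋ u → π u ≡ v → contract S Q ∋ v
        s ⟨≈⟩ e = subst (contract S Q ∋_) e (contract-∋⁺ Q s)
        K = no-K₄ (good-contract good a∈ a≢0 Q) {π b} {π q} {π (b ⊕ x)}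
              (sb ⟨≈⟩ refl) (sq ⟨≈⟩ refl) (sbx ⟨≈⟩ refl)
              ((qb ≈> ⊕-comm q b) ⟨≈⟩ proj-add Q b q)
              ((x∈S ≈> solve 2 (λ b x → x ⊜ b ⊞ (b ⊞ x)) refl b x) ⟨≈⟩ proj-add Q b (b ⊕ x))
              ((qabx ≈> solve 4 (λ q a b x → (q ⊞ (a ⊞ b)) ⊞ x ⊜ (q ⊞ (b ⊞ x)) ⊞ a) refl q a b x)
                 ⟨≈⟩ trans (proj-+x Q (q ⊕ (b ⊕ x))) (proj-add Q q (b ⊕ x)))
        eq : (π b ⊕ π q) ⊕ π (b ⊕ x) ≡ π (q ⊕ x)
        eq = trans (cong (_⊕ π (b ⊕ x)) (sym (proj-add Q b q)))
             (trans (sym (proj-add Q _ _)) (cong π (solve 3 (λ b q x → (b ⊞ q) ⊞ (b ⊞ x) ⊜ q ⊞ x) refl b q x)))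
        contra : ¬ S ∋ (q ⊕ x) ⊕ a
        contra qxa = ¬qx (double-diff sa sax sq (qa ≈> ⊕-comm q a)
          (qxa ≈> solve 3 (λ q x a → (q ⊞ x) ⊞ a ⊜ (a ⊞ q) ⊞ x) refl q x a))

      module _ {q : V n} (sq : S ∋ q) (¬qx : ¬ S ∋ q ⊕ x) where

        -- A cone forces every undoubled vector into its subspace. For a doubled `l` exactly one of
        -- l + q and l + q + x is in `S`, since `q` is undoubled, and this decides which of l and l
        -- + x belongs.
        InH : V n → Set
        InH l = S ∋ l × (S ∋ l ⊕ x → S ∋ l ⊕ q)

        mixed : ∀ {a b} → InH a → S ∋ a ⊕ x → InH b → ¬ S ∋ b ⊕ x → InH (a ⊕ b)
        mixed {a} {b} (sa , ha) sax (sb , _) ¬bx =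
          sab , λ abx → ⊥-elim (¬bx (double-diff sa sax sb sab abx))
          where
          aq = ha sax
          ¬aqx : ¬ S ∋ (a ⊕ q) ⊕ x
          ¬aqx aqx = ¬qx (double-diff sa sax sq aq aqx)
          bq = single-add sb ¬bx sq ¬qx
          sab : S ∋ a ⊕ b
          -- The sum is undoubled by `double-diff`, so only a + b ∈ S is at stake. A doubled b + q
          -- serves, with a, as a direction for `affine` at q; otherwise two uses of `single-add`
          -- pass through a + b + q.
          sab with S ∋? ((b ⊕ q) ⊕ x)
          ... | yes bqx = affine sq ¬qx sa sax bq bqx (aq ≈> ⊕-comm a q)
                            (sb ≈> solve 2 (λ b q → b ⊜ q ⊞ (b ⊞ q)) refl b q)
                          ≈> solve 3 (λ a b q → q ⊞ (a ⊞ (b ⊞ q)) ⊜ a ⊞ b) refl a b q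
          ... | no ¬bqx = single-add aqb ¬aqbx sq ¬qx
                          ≈> solve 3 (λ a b q → (a ⊞ (b ⊞ q)) ⊞ q ⊜ a ⊞ b) refl a b q
            where
            aqb : S ∋ a ⊕ (b ⊕ q)
            aqb = single-add aq ¬aqx sb ¬bx ≈> solve 3 (λ a b q → (a ⊞ q) ⊞ b ⊜ a ⊞ (b ⊞ q)) refl a b q
            ¬aqbx : ¬ S ∋ (a ⊕ (b ⊕ q)) ⊕ x
            ¬aqbx h = ¬bqx (double-diff sa sax bq aqb h)

        InH-add : ∀ {a b} → InH a → InH b → InH (a ⊕ b)
        InH-add {a} {b} ha hb with S ∋? (a ⊕ x) | S ∋? (b ⊕ x)
        ... | yes sax | no ¬bx = mixed ha sax hb ¬bx
        ... | no ¬ax | yes sbx = subst InH (⊕-comm b a) (mixed hb sbx ha ¬ax)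
        ... | yes sax | yes sbx =
          proj₁ (double-add (proj₁ ha) sax (proj₁ hb) sbx (closed (proj₁ ha) (proj₁ hb))) ,
          λ _ → affine sq ¬qx (proj₁ ha) sax (proj₁ hb) sbx
                  (proj₂ ha sax ≈> ⊕-comm a q) (proj₂ hb sbx ≈> ⊕-comm b q)
                ≈> ⊕-comm q (a ⊕ b)
        ... | no ¬ax | no ¬bx = sab , inq
          where
          sab = single-add (proj₁ ha) ¬ax (proj₁ hb) ¬bx
          saq = single-add (proj₁ ha) ¬ax sq ¬qx
          inq : S ∋ (a ⊕ b) ⊕ x → S ∋ (a ⊕ b) ⊕ q
          inq abx with S ∋? ((a ⊕ q) ⊕ x)
          ... | no ¬aqx = single-add saq ¬aqx (proj₁ hb) ¬bx
                          ≈> solve 3 (λ a b q → (a ⊞ q) ⊞ b ⊜ (a ⊞ b) ⊞ q) refl a b q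
          -- The undoubled `a` is now the base point of `affine`, with the doubled directions a + q
          -- and a + b.
          ... | yes aqx = affine (proj₁ ha) ¬ax saq aqx sab abx
                            (sq ≈> solve 2 (λ a q → q ⊜ a ⊞ (a ⊞ q)) refl a q)
                            (proj₁ hb ≈> solve 2 (λ a b → b ⊜ a ⊞ (a ⊞ b)) refl a b)
                          ≈> solve 3 (λ a b q → a ⊞ ((a ⊞ q) ⊞ (a ⊞ b)) ⊜ (a ⊞ b) ⊞ q) refl a b q

        H : Subspace n
        H = record
          { Mem = InH ; mem? = λ l → (S ∋? l) ×-dec ((S ∋? (l ⊕ x)) →-dec (S ∋? (l ⊕ q)))
          ; 0∈ = inj₁ refl , λ _ → sq ≈> sym (⊕-identityˡ q) ; add∈ = InH-add }

      closed⇒cone : x ≢ zeroV → Cone S x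
      closed⇒cone x≢0 with ∃∈? {S = S} (λ q → ¬? (S ∋? (q ⊕ x)))
      ... | inj₂ all = trivial , x≢0 , λ s∈ _ → decidable-¬¬ (S ∋? _) (all s∈)
      ... | inj₁ (q , q∈ , ¬qx) = H (inj₂ q∈) ¬qx
          -- `x` itself is doubled, because x + x = 0; membership would therefore give x + q ∈ S.
          , (λ (_ , h) → ¬qx (h (inj₁ (⊕-self x)) ≈> ⊕-comm x q))
          , λ s∈ s∉ → decidable-¬¬ (S ∋? _) (λ ¬sx → s∉ (inj₂ s∈ , λ sx → ⊥-elim (¬sx sx)))

    -- If the two sides are cones, the two subspaces agree on the intersection, where
    -- they are determined by any vector q of S that is not doubled.
    cone-glue : (M : SplitMod S x) → let P₁ = SplitMod.P₁ M ; P₂ = SplitMod.P₂ M in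
                ∀ {q} → q ∈ₗ S → Mem P₁ q → Mem P₂ q → ¬ S ∋ q ⊕ x →
                Cone (restrict S P₁) x → Cone (restrict S P₂) x → Cone S x
    cone-glue M {q} q∈ q₁ q₂ ¬qx (H₁ , x∉₁ , c₁) (H₂ , x∉₂ , c₂) = (H₁ ⊓ P₁) ⊔ (H₂ ⊓ P₂) , x∉H , cone
      where
      open SplitMod M
      tight : (P H : Subspace n) → (∀ {s} → s ∈ₗ restrict S P → ¬ Mem H s → restrict S P ∋ s ⊕ x) →
              ∀ {t} → S ∋ t → Mem P t → ¬ S ∋ t ⊕ x → Mem H t
      tight P H c (inj₁ refl) _ _ = 0∈ H
      tight P H c (inj₂ t∈) p ¬tx = decidable-¬¬ (mem? H _) (λ t∉ →
        ¬tx (restrict-∋⁻ P (c (List∈.∈-filter⁺ (mem? P) t∈ p) t∉)))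

      -- With `t` missing, t + x would be an undoubled vector of `S`, hence in `H₁`, and then so
      -- would x.
      not-+x : ∀ {t} → Mem H₁ t → Mem P₁ t → S ∋ t ⊕ x → ¬ ¬ S ∋ t
      not-+x {t} h₁ p₁ tx ¬t = x∉₁ (cancel∈ H₁ (subst (Mem H₁) (⊕-comm t x)
        (tight P₁ H₁ c₁ tx (add∈ P₁ p₁ x∈₁) (λ txx → ¬t (txx ≈> ⊕-cancel t x)))) h₁)

      H₁⊆H₂ : ∀ {h} → Mem H₁ h → Mem P₁ h → Mem P₂ h → Mem H₂ h
      H₁⊆H₂ {h} h₁ p₁ p₂ with S ∋? (h ⊕ x)
      ... | no ¬hx with meet p₁ p₂
      ...   | inj₁ sh = tight P₂ H₂ c₂ sh p₂ ¬hx
      ...   | inj₂ hx = ⊥-elim (¬hx hx)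
      -- `h` is doubled, so h + q lies in `S` and is undoubled; thus `H₂` contains both h + q and q.
      H₁⊆H₂ {h} h₁ p₁ p₂ | yes hx =
        cancel∈ H₂ (tight P₂ H₂ c₂ hq (add∈ P₂ p₂ q₂) (λ hqx → ¬qx (double-diff sh hx (inj₂ q∈) hq hqx)))
                   (tight P₂ H₂ c₂ (inj₂ q∈) q₂ ¬qx)
        where
        sh : S ∋ h
        sh = decidable-¬¬ (S ∋? h) (not-+x h₁ p₁ hx)
        hq : S ∋ h ⊕ q
        hq with meet (add∈ P₁ p₁ q₁) (add∈ P₂ p₂ q₂)
        ... | inj₁ s = s
        ... | inj₂ hqx = decidable-¬¬ (S ∋? (h ⊕ q))
                (not-+x (add∈ H₁ h₁ (tight P₁ H₁ c₁ (inj₂ q∈) q₁ ¬qx)) (add∈ P₁ p₁ q₁) hqx)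

      x∉H : ¬ Mem ((H₁ ⊓ P₁) ⊔ (H₂ ⊓ P₂)) x
      x∉H (h , (h₁ , p₁) , (h₂ , p₂)) = x∉₂ (cancel∈ H₂ h₂ (H₁⊆H₂ h₁ p₁
        (cancel∈ P₂ (subst (Mem P₂) (⊕-comm x h) p₂) x∈₂)))

      cone : ∀ {s} → s ∈ₗ S → ¬ Mem ((H₁ ⊓ P₁) ⊔ (H₂ ⊓ P₂)) s → S ∋ s ⊕ x
      cone s∈ s∉ with cover s∈
      ... | inj₁ p₁ = restrict-∋⁻ P₁ (c₁ (List∈.∈-filter⁺ (mem? P₁) s∈ p₁)
                        (λ h₁ → s∉ (⊔-introˡ (H₁ ⊓ P₁) (H₂ ⊓ P₂) (h₁ , p₁))))
      ... | inj₂ p₂ = restrict-∋⁻ P₂ (c₂ (List∈.∈-filter⁺ (mem? P₂) s∈ p₂)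
                        (λ h₂ → s∉ (⊔-introʳ (H₁ ⊓ P₁) (H₂ ⊓ P₂) (h₂ , p₂))))

    -- Where only v + x is known to be in `S`, doubling it returns v.
    splitMod⇒split : (M : SplitMod S x) →
                     (∀ {q} → q ∈ₗ S → Mem (SplitMod.P₁ M) q → Mem (SplitMod.P₂ M) q → S ∋ q ⊕ x) → SplitAt S x
    splitMod⇒split M doubled = record
      { W₁ = P₁ ; W₂ = P₂ ; cover = cover ; meet = λ p₁ p₂ → meet′ p₁ p₂ (meet p₁ p₂)
      ; out₁ = out₁ ; out₂ = out₂ } , x∈₁ , x∈₂
      where
      open SplitMod M
      meet′ : ∀ {v} → Mem P₁ v → Mem P₂ v → S ∋ v ⊎ S ∋ v ⊕ x → S ∋ v
      meet′ p₁ p₂ (inj₁ v) = v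
      meet′ p₁ p₂ (inj₂ (inj₁ eq)) = x∈S ≈> sym (⊕≡0⇒≡ eq)
      meet′ {v} p₁ p₂ (inj₂ (inj₂ vx)) =
        doubled vx (add∈ P₁ p₁ x∈₁) (add∈ P₂ p₂ x∈₂) ≈> ⊕-cancel v x

    -- If the apex x has as few neighbours as possible, then a vector outside the subspace
    -- of the cone has the same neighbours as x, and such vectors form a clique.
    module Apex (x∈ : x ∈ₗ S)
      (minimal : ∀ {e} → e ∈ₗ S → e ≢ zeroV →
         ¬ length (filter (λ y → S ∋? (y ⊕ e)) S) < length (filter (λ y → S ∋? (y ⊕ x)) S))
      (C : Cone S x) where

      H₀ = proj₁ C

      -- Two vectors are neighbours when their sum is in `S`. The one-sided condition suffices for
      -- `B` to be closed under sums, by `no-K₄`.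
      Dominates : V n → Set
      Dominates v = S ∋ v × All (λ y → S ∋ y ⊕ x → S ∋ y ⊕ v) S

      dom : ∀ {v} → Dominates v → ∀ {y} → S ∋ y → S ∋ y ⊕ x → S ∋ y ⊕ v
      dom {v} (sv , _) (inj₁ refl) _ = sv ≈> sym (⊕-identityˡ v)
      dom (_ , all) (inj₂ y∈) yx = All.lookup all y∈ yx

      dom-adj : ∀ {v} → Dominates v → S ∋ v ⊕ x
      dom-adj {v} d = dom d x∈S (inj₁ (⊕-self x)) ≈> ⊕-comm x v

      B : Subspace n
      B = record
        { Mem  = Dominates
        ; mem? = λ v → (S ∋? v) ×-dec All.all? (λ y → (S ∋? (y ⊕ x)) →-dec (S ∋? (y ⊕ v))) S
        ; 0∈   = inj₁ refl , All.tabulate (λ {y} y∈ _ → inj₂ y∈ ≈> sym (⊕-identityʳ y))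
        ; add∈ = λ {v} {w} dv dw →
            let vw = dom dw (proj₁ dv) (dom-adj dv) in
            vw , All.tabulate (λ {y} y∈ yx →
              no-K₄ good (inj₂ y∈) (proj₁ dv) (proj₁ dw) (dom dv (inj₂ y∈) yx) (dom dw (inj₂ y∈) yx) vw
              ≈> ⊕-assoc y v w) }

      -- The neighbours of `e` are among those of `x`; if `e` missed one of them, its degree would
      -- be smaller.
      outside-dominates : ∀ {e} → e ∈ₗ S → ¬ Mem H₀ e → Dominates e
      outside-dominates {e} e∈ e∉ = inj₂ e∈ , All.tabulate (λ y∈ yx → decidable-¬¬ (S ∋? _) (λ ¬ye →
        minimal e∈ (λ e≡0 → e∉ (subst (Mem H₀) (sym e≡0) (0∈ H₀)))
          (filter-length-< (λ y → S ∋? (y ⊕ e)) (λ y → S ∋? (y ⊕ x)) S nbhd y∈ yx ¬ye)))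
        where
        ex : S ∋ e ⊕ x
        ex = proj₂ (proj₂ C) e∈ e∉
        via : ∀ {y} → S ∋ y → ¬ Mem H₀ y → S ∋ y ⊕ x
        via (inj₁ refl) y∉ = ⊥-elim (y∉ (0∈ H₀))
        via (inj₂ y∈)   y∉ = proj₂ (proj₂ C) y∈ y∉
        nbhd : ∀ {y} → y ∈ₗ S → S ∋ y ⊕ e → S ∋ y ⊕ x
        nbhd {y} y∈ ye with mem? H₀ y
        ... | no y∉ = proj₂ (proj₂ C) y∈ y∉
        -- y + e is outside `H₀`, hence doubled, and `no-K₄` applies to x, e and y + e, whose total
        -- is x + y.
        ... | yes y∈H =
          no-K₄ good x∈S (inj₂ e∈) ye (ex ≈> ⊕-comm e x)
            (via ye (λ h → e∉ (cancel∈ H₀ (subst (Mem H₀) (⊕-comm y e) h) y∈H)) ≈> ⊕-comm (y ⊕ e) x)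
            (inj₂ y∈ ≈> solve 2 (λ y e → y ⊜ e ⊞ (y ⊞ e)) refl y e)
          ≈> solve 3 (λ x e y → (x ⊞ e) ⊞ (y ⊞ e) ⊜ y ⊞ x) refl x e y

      apex-split : Closed S ⊎ Split S
      apex-split with ∃∈? {S = S} (λ b → ¬? (mem? B b))
      ... | inj₂ all = inj₁ (λ a b → proj₁ (add∈ B (in-B a) (in-B b)))
        where
        in-B : ∀ {v} → S ∋ v → Dominates v
        in-B (inj₁ refl) = 0∈ B
        in-B (inj₂ v∈) = decidable-¬¬ (mem? B _) (all v∈)
      ... | inj₁ (b , b∈ , b∉) = inj₂ record
        { W₁ = H₀ ; W₂ = B ; cover = cov ; meet = λ _ → proj₁
        ; out₁ = x , x∈ , proj₁ (proj₂ C) ; out₂ = b , b∈ , b∉ }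
        where
        cov : ∀ {v} → v ∈ₗ S → Mem H₀ v ⊎ Dominates v
        cov {v} v∈ with mem? H₀ v
        ... | yes h = inj₁ h
        ... | no ¬h = inj₂ (outside-dominates v∈ ¬h)

  degree : List (V n) → V n → ℕ
  degree S x = length (filter (λ y → S ∋? (y ⊕ x)) S)

  least-degree : (S : List (V n)) → ∀ b {x} → x ∈ₗ S → x ≢ zeroV → degree S x < b →
                 ∃ λ x → x ∈ₗ S × x ≢ zeroV × (∀ {e} → e ∈ₗ S → e ≢ zeroV → ¬ degree S e < degree S x)
  least-degree S (suc b) {x} x∈ x≢0 (s≤s deg≤)
    with ∃∈? {S = S} (λ e → nonzero? e ×-dec (degree S e ℕ.<? degree S x))
  ... | inj₁ (e , e∈ , e≢0 , lt) = least-degree S b e∈ e≢0 (ℕ.<-≤-trans lt deg≤)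
  ... | inj₂ none = x , x∈ , x≢0 , λ e∈ e≢0 lt → none e∈ (e≢0 , lt)

  structure : ∀ b {n} (S : List (V n)) → length S < b → Good S → Closed S ⊎ Split S
  -- `x` is arbitrary because the recursion into the two sides keeps it, with no control over its
  -- degree there; least degree is imposed only in `structure`. The bound `b` on the length
  -- decreases here alone.
  cone-or-split : ∀ b {n} (S : List (V n)) → length S < b → Good S → ∀ {x} → x ∈ₗ S → x ≢ zeroV →
                  Cone S x ⊎ SplitAt S x

  structure b S lt good with ∃∈? {S = S} nonzero?
  ... | inj₂ none = inj₁ (λ a b → inj₁ (trans (cong₂ _⊕_ (null a) (null b)) (⊕-self zeroV)))
    where
    null : ∀ {v} → S ∋ v → v ≡ zeroV
    null (inj₁ eq) = eq
    null (inj₂ v∈) = decidable-¬¬ (_ ≟ⱽ zeroV) (none v∈)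
  ... | inj₁ (y , y∈ , y≢0) with x , x∈ , x≢0 , minimal ← least-degree S _ y∈ y≢0 ℕ.≤-refl
                            | cone-or-split b S lt good x∈ x≢0
  ...   | inj₂ (d , _) = inj₂ d
  ...   | inj₁ C = Doubled.Apex.apex-split good (inj₂ x∈) x∈ minimal C

  cone-or-split (suc b) S (s≤s len≤) good {x} x∈ x≢0
    with structure b (contract S (quotient x x≢0)) (ℕ.<-≤-trans (contract-< (quotient x x≢0) x∈) len≤)
           (good-contract good x∈ x≢0 (quotient x x≢0))
  ... | inj₁ closed = inj₁ (Doubled.ClosedMod.closed⇒cone good (inj₂ x∈)
          (λ {s} {t} a b → contract-lift Q (subst (contract S Q ∋_) (sym (proj-add Q s t))
             (closed (contract-∋⁺ Q a) (contract-∋⁺ Q b)))) x≢0)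
    where Q = quotient x x≢0
  ... | inj₂ d = go (∃∈? {S = S} (λ q → mem? P₁ q ×-dec mem? P₂ q ×-dec ¬? (S ∋? (q ⊕ x))))
    where
    M = splitMod-pull (quotient x x≢0) d
    open SplitMod M
    side : (P : Subspace _) → Mem P x → (∃ λ a → a ∈ₗ S × ¬ Mem P a) →
           Cone (restrict S P) x ⊎ SplitAt (restrict S P) x
    side P p (a , a∈ , a∉) = cone-or-split b (restrict S P) (ℕ.<-≤-trans (restrict-< P a∈ a∉) len≤)
      (good-restrict good P) (List∈.∈-filter⁺ (mem? P) x∈ p) x≢0
    go : (∃ λ q → q ∈ₗ S × Mem P₁ q × Mem P₂ q × ¬ S ∋ q ⊕ x) ⊎
         (∀ {q} → q ∈ₗ S → ¬ (Mem P₁ q × Mem P₂ q × ¬ S ∋ q ⊕ x)) → Cone S x ⊎ SplitAt S x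
    go (inj₂ none) = inj₂ (Doubled.splitMod⇒split good (inj₂ x∈) M
      (λ q∈ p₁ p₂ → decidable-¬¬ (S ∋? _) (λ ¬qx → none q∈ (p₁ , p₂ , ¬qx))))
    go (inj₁ (q , q∈ , p₁ , p₂ , ¬qx)) with side P₁ x∈₁ out₁ | side P₂ x∈₂ out₂
    ... | inj₂ D | _ = inj₂ (Graft.graft M D)
    ... | inj₁ _ | inj₂ D = inj₂ (Graft.graft (splitMod-swap M) D)
    ... | inj₁ C₁ | inj₁ C₂ = inj₁ (Doubled.cone-glue good (inj₂ x∈) M q∈ p₁ p₂ ¬qx C₁ C₂)

-- Spans

sumSel∈ : (W : Subspace n) (v : Fin m → V n) (Y : Subset m) → (∀ i → i ∈ Y → Mem W (v i)) → Mem W (sumSel v Y)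
sumSel∈ W v []          all = 0∈ W
sumSel∈ W v (true ∷ Y)  all = add∈ W (all zero Vec.here) (sumSel∈ W (v ∘ suc) Y (λ i i∈ → all (suc i) (Vec.there i∈)))
sumSel∈ W v (false ∷ Y) all = add∈ W (0∈ W) (sumSel∈ W (v ∘ suc) Y (λ i i∈ → all (suc i) (Vec.there i∈)))

span : (Fin m → V n) → Subset m → Subspace n
span v X = record
  { Mem  = InSpan v X
  ; mem? = λ x → anySubset? (λ Y → (Y ⊆? X) ×-dec (sumSel v Y ≟ⱽ x))
  ; 0∈   = ⊥ , (⊥-elim ∘ ∉⊥) , sumSel-⊥ v
  ; add∈ = λ (Y , Y⊆ , eq) (Z , Z⊆ , eq′) →
      Y ⊕ Z , (λ i∈ → [ Y⊆ , Z⊆ ]′ (∈-⊕⁻ Y Z i∈)) , trans (sumSel-⊕ v Y Z) (cong₂ _⊕_ eq eq′) }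

span-gen : (v : Fin m → V n) {X : Subset m} {i : Fin m} → i ∈ X → InSpan v X (v i)
span-gen v {X} {i} i∈ = ⁅ i ⁆ , (λ j∈ → subst (_∈ X) (sym (x∈⁅y⁆⇒x≡y i j∈)) i∈) , sumSel-⁅⁆ v i

span-least : (v : Fin m → V n) {X : Subset m} (W : Subspace n) → (∀ i → i ∈ X → Mem W (v i)) →
             ∀ {x} → InSpan v X x → Mem W x
span-least v W all (Y , Y⊆ , refl) = sumSel∈ W v Y (λ i i∈ → all i (Y⊆ i∈))

imageˢ : {h : V m → V n} → Additive h → Subspace n
imageˢ {h = h} add = record
  { Mem  = λ v → ∃ λ a → h a ≡ v
  ; mem? = λ v → anySubset? (λ a → h a ≟ⱽ v)
  ; 0∈   = zeroV , additive-0 add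
  ; add∈ = λ { (a , refl) (b , refl) → a ⊕ b , add a b } }

ray : V n → Subspace n
ray u = record
  { Mem  = λ v → v ≡ zeroV ⊎ v ≡ u
  ; mem? = λ v → (v ≟ⱽ zeroV) ⊎-dec (v ≟ⱽ u)
  ; 0∈   = inj₁ refl
  ; add∈ = λ { (inj₁ refl) (inj₁ refl) → inj₁ (⊕-self zeroV)
             ; (inj₁ refl) (inj₂ refl) → inj₂ (⊕-identityˡ _)
             ; (inj₂ refl) (inj₁ refl) → inj₂ (⊕-identityʳ _)
             ; (inj₂ refl) (inj₂ refl) → inj₁ (⊕-self _) } }

-- Matroids of finite sets of vectors

lookup-injective : {A : Set} {xs : List A} → Unique xs → ∀ i j → List.lookup xs i ≡ List.lookup xs j → i ≡ j
lookup-injective (x∉ ∷ u) zero    zero    eq = refl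
lookup-injective (x∉ ∷ u) zero    (suc j) eq = ⊥-elim (All.lookup x∉ (List∈.∈-lookup j) eq)
lookup-injective (x∉ ∷ u) (suc i) zero    eq = ⊥-elim (All.lookup x∉ (List∈.∈-lookup i) (sym eq))
lookup-injective (x∉ ∷ u) (suc i) (suc j) eq = cong suc (lookup-injective u i j eq)

-- Simplification: no loops and no parallel elements remain.
ground : List (V n) → List (V n)
ground S = deduplicate _≟ⱽ_ (filter nonzero? S)

ground⁻ : (S : List (V n)) {v : V n} → v ∈ₗ ground S → v ∈ₗ S × v ≢ zeroV
ground⁻ S v∈ = List∈.∈-filter⁻ nonzero? {xs = S} (List∈.∈-deduplicate⁻ _≟ⱽ_ _ v∈)

mat : List (V n) → BinMat
mat S = record
  { size    = length (ground S)
  ; vec     = List.lookup (ground S)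
  ; vec-inj = lookup-injective {xs = ground S} (deduplicate-! _≟ⱽ_ (filter nonzero? S))
  ; vec-nz  = λ i → proj₂ (ground⁻ S (List∈.∈-lookup i)) }

mat-vec∈ : (S : List (V n)) (i : Fin (size (mat S))) → vec (mat S) i ∈ₗ S
mat-vec∈ S i = proj₁ (ground⁻ S (List∈.∈-lookup i))

mat-index : (S : List (V n)) {v : V n} → v ∈ₗ S → v ≢ zeroV → ∃ λ i → vec (mat S) i ≡ v
mat-index S v∈ v≢0 = Any.index v∈′ , sym (Any.lookup-index v∈′)
  where v∈′ = List∈.∈-deduplicate⁺ _≟ⱽ_ (List∈.∈-filter⁺ nonzero? v∈ v≢0)

mat-size : (S : List (V n)) → size (mat S) ≤ length S
mat-size S = ℕ.≤-trans (List.length-deduplicate _≟ⱽ_ (filter nonzero? S)) (List.length-filter nonzero? S)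

vectors : (M : BinMat) → List (V (dim M))
vectors M = List.tabulate (vec M)

-- Embeddings

trace : (M : BinMat) → Subspace (dim M) → Subset (size M)
trace M W = comprehend (mem? W ∘ vec M)

trace-flat : (M : BinMat) (W : Subspace (dim M)) → Flat M (trace M W)
trace-flat M W e e∈ = ∈-comprehend⁺ (mem? W ∘ vec M)
  (span-least (vec M) W (λ i → ∈-comprehend⁻ (mem? W ∘ vec M)) e∈)

module Embedding (N M : BinMat) {h : V (dim N) → V (dim M)} (add : Additive h) (inj : Injective h)
  (f : Fin (size N) → Fin (size M)) (vec-f : ∀ i → vec M (f i) ≡ h (vec N i)) where

  f-inj : Inj f
  f-inj i j eq = vec-inj N i j (additive-injective add inj
    (trans (sym (vec-f i)) (trans (cong (vec M) eq) (vec-f j))))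

  indep : ∀ X → X ⊆Im f → Indep M X ⇔ Indep N (pre f X)
  indep X X⊆ = mk⇔ (to eq ∘ to lp) (from lp ∘ from eq)
    where
    lp = linIndep-pre (vec M) f-inj X X⊆
    eq = cycEq⇒indep (cycEq-trans (cycEq-cong vec-f) (cycEq-linear add inj (vec N))) (pre f X)

  restrVia : (W : Subspace (dim M)) → (∀ i → Mem W (h (vec N i))) →
             (∀ j → Mem W (vec M j) → ∃ λ i → h (vec N i) ≡ vec M j) → RestrVia N M f (trace M W)
  restrVia W into onto =
    f-inj , (λ i → ∈-comprehend⁺ (mem? W ∘ vec M) (subst (Mem W) (sym (vec-f i)) (into i))) , onto′ ,
    λ X X⊆ → indep X (λ j j∈ → onto′ j (X⊆ j∈))
    where
    onto′ : ∀ j → j ∈ trace M W → ∃ λ i → f i ≡ j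
    onto′ j j∈ with i , eq ← onto j (∈-comprehend⁻ (mem? W ∘ vec M) j∈) =
      i , vec-inj M _ _ (trans (vec-f i) eq)

flatRestriction : (N M : BinMat) {h : V (dim N) → V (dim M)} → Additive h → Injective h →
  (∀ i → ∃ λ j → vec M j ≡ h (vec N i)) → (W : Subspace (dim M)) → (∀ i → Mem W (h (vec N i))) →
  (∀ j → Mem W (vec M j) → ∃ λ i → h (vec N i) ≡ vec M j) → FlatRestriction N M
flatRestriction N M add inj find W into onto =
  proj₁ ∘ find , trace M W , trace-flat M W ,
  Embedding.restrVia N M add inj (proj₁ ∘ find) (proj₂ ∘ find) W into onto

mat-restrict-flat : (S : List (V n)) (W : Subspace n) → FlatRestriction (mat (restrict S W)) (mat S)
mat-restrict-flat S W = flatRestriction (mat (restrict S W)) (mat S) (λ _ _ → refl) (λ _ → id)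
  (λ i → mat-index S (proj₁ (mem i)) (vec-nz (mat (restrict S W)) i)) W (λ i → proj₂ (mem i))
  (λ j w → mat-index (restrict S W) (List∈.∈-filter⁺ (mem? W) (mat-vec∈ S j) w) (vec-nz (mat S) j))
  where
  mem : ∀ i → vec (mat (restrict S W)) i ∈ₗ S × Mem W (vec (mat (restrict S W)) i)
  mem i = List∈.∈-filter⁻ (mem? W) {xs = S} (mat-vec∈ (restrict S W) i)

-- Contractions

-- For Y ⊆ X the sum over Y vanishes in the quotient exactly if the sum over Y or over Y with `e`
-- added vanishes before.
linIndep-quotient : (v : Fin m → V n) (e : Fin m) → v e ≢ zeroV → (q : Quotient (v e)) →
                    ∀ X → e ∉ X → LinIndep v (X ∪ ⁅ e ⁆) ⇔ LinIndep (proj q ∘ v) X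
linIndep-quotient {m} v e ve≢0 q X e∉X = mk⇔ ⇒ ⇐
  where
  πv≡ : ∀ Y → sumSel (proj q ∘ v) Y ≡ proj q (sumSel v Y)
  πv≡ = sumSel-map (proj-add q) v
  ⇒ : LinIndep v (X ∪ ⁅ e ⁆) → LinIndep (proj q ∘ v) X
  ⇒ ind Y Y⊆ eq with kernel q (sumSel v Y) (trans (sym (πv≡ Y)) eq)
  ... | inj₁ sum≡0 = ind Y (λ i∈ → x∈p∪q⁺ (inj₁ (Y⊆ i∈))) sum≡0
  ... | inj₂ sum≡e = ⊥-elim (∉⊥ (subst (e ∈_) Ye≡⊥ e∈Ye))
    where
    e∈Ye : e ∈ Y ⊕ ⁅ e ⁆
    e∈Ye = subst (e ∈_) (⊕-comm ⁅ e ⁆ Y) (∈-⊕⁺ˡ ⁅ e ⁆ Y (x∈⁅x⁆ e) (e∉X ∘ Y⊆))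
    Ye⊆ : Y ⊕ ⁅ e ⁆ ⊆ X ∪ ⁅ e ⁆
    Ye⊆ i∈ = x∈p∪q⁺ ([ inj₁ ∘ Y⊆ , inj₂ ]′ (∈-⊕⁻ Y ⁅ e ⁆ i∈))
    Ye≡⊥ : Y ⊕ ⁅ e ⁆ ≡ ⊥
    Ye≡⊥ = ind (Y ⊕ ⁅ e ⁆) Ye⊆
      (trans (sumSel-⊕ v Y ⁅ e ⁆) (trans (cong₂ _⊕_ sum≡e (sumSel-⁅⁆ v e)) (⊕-self (v e))))
  ⇐ : LinIndep (proj q ∘ v) X → LinIndep v (X ∪ ⁅ e ⁆)
  ⇐ ind Y Y⊆ eq with e ∈? Y
  ... | no e∉Y = ind Y Y⊆X (trans (πv≡ Y) (trans (cong (proj q) eq) (additive-0 (proj-add q))))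
    where
    Y⊆X : Y ⊆ X
    Y⊆X {i} i∈ with x∈p∪q⁻ X ⁅ e ⁆ (Y⊆ i∈)
    ... | inj₁ i∈X = i∈X
    ... | inj₂ i∈e = ⊥-elim (e∉Y (subst (_∈ Y) (x∈⁅y⁆⇒x≡y e i∈e) i∈))
  ... | yes e∈Y = ⊥-elim (ve≢0 (trans (sym (sumSel-⁅⁆ v e)) (trans (cong (sumSel v) (sym (⊕≡0⇒≡ Ye≡⊥))) eq)))
    where
    Ye⊆X : Y ⊕ ⁅ e ⁆ ⊆ X
    Ye⊆X {i} i∈ with i Fin.≟ e
    ... | yes refl = ⊥-elim (∉-⊕ Y ⁅ e ⁆ e∈Y (x∈⁅x⁆ e) i∈)
    ... | no i≢e with ∈-⊕⁻ Y ⁅ e ⁆ i∈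
    ...   | inj₂ i∈e = ⊥-elim (i≢e (x∈⁅y⁆⇒x≡y e i∈e))
    ...   | inj₁ i∈Y with x∈p∪q⁻ X ⁅ e ⁆ (Y⊆ i∈Y)
    ...     | inj₁ i∈X = i∈X
    ...     | inj₂ i∈e = ⊥-elim (i≢e (x∈⁅y⁆⇒x≡y e i∈e))
    Ye≡⊥ : Y ⊕ ⁅ e ⁆ ≡ ⊥
    Ye≡⊥ = ind (Y ⊕ ⁅ e ⁆) Ye⊆X
      (trans (πv≡ _) (trans (cong (proj q) (trans (sumSel-⊕ v Y ⁅ e ⁆)
        (trans (cong₂ _⊕_ eq (sumSel-⁅⁆ v e)) (⊕-identityˡ _)))) (proj-x q)))

linIndep-contract : ∀ {l} (v : Fin m → V n) (e : Fin m) → v e ≢ zeroV → (q : Quotient (v e)) →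
  {g : Fin l → Fin m} → Inj g → (∀ i → g i ≢ e) → ∀ X → X ⊆Im g →
  LinIndep v (X ∪ ⁅ e ⁆) ⇔ LinIndep (proj q ∘ v ∘ g) (pre g X)
linIndep-contract v e ve≢0 q {g} g-inj g≢e X X⊆ = mk⇔ (to lp ∘ to lq) (from lq ∘ from lp)
  where
  lq = linIndep-quotient v e ve≢0 q X (λ e∈ → let i , eq = X⊆ e e∈ in g≢e i eq)
  lp = linIndep-pre (proj q ∘ v) g-inj X X⊆

mat-contract : (S : List (V n)) {x : V n} → x ∈ₗ S → x ≢ zeroV → (q : Quotient x) →
               SimpContraction (mat (contract S q)) (mat S)
mat-contract S x∈ x≢0 q with e , refl ← mat-index S x∈ x≢0 =
  e , g , g≢e , covers , unique , indep
  where
  M = mat S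
  N = mat (contract S q)
  -- One representative of each parallel class.
  lift : ∀ i → ∃ λ j → proj q (vec M j) ≡ vec N i
  lift i with s , s∈ , eq ← contract-∈⁻ {S = S} q (mat-vec∈ (contract S q) i)
    with j , refl ← mat-index S s∈ (λ { refl → vec-nz N i (trans eq (additive-0 (proj-add q))) }) = j , sym eq
  g = proj₁ ∘ lift
  g-inj : Inj g
  g-inj i j eq = vec-inj N i j (trans (sym (proj₂ (lift i))) (trans (cong (proj q ∘ vec M) eq) (proj₂ (lift j))))
  g≢e : ∀ i → g i ≢ e
  g≢e i eq = vec-nz N i (trans (sym (proj₂ (lift i))) (trans (cong (proj q ∘ vec M) eq) (proj-x q)))
  covers : ∀ y → y ≢ e → ∃ λ i → InCl M (⁅ e ⁆ ∪ ⁅ g i ⁆) y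
  covers y y≢e with contract-∋⁺ {S = S} q (inj₂ (mat-vec∈ S y))
  ... | inj₁ eq = ⊥-elim ([ vec-nz M y , y≢e ∘ vec-inj M y e ]′ (kernel q _ eq))
  ... | inj₂ πy∈ with i , eq ← mat-index (contract S q) πy∈
                       (λ eq → [ vec-nz M y , y≢e ∘ vec-inj M y e ]′ (kernel q _ eq)) =
    i , [ (λ eq → subst (Mem sp) (sym eq) gi∈)
        , (λ eq → subst (Mem sp) (sym eq) (add∈ sp gi∈ (span-gen (vec M) (x∈p∪q⁺ (inj₁ (x∈⁅x⁆ e)))))) ]′
        (fibre q (trans (sym eq) (sym (proj₂ (lift i)))))
    where
    sp = span (vec M) (⁅ e ⁆ ∪ ⁅ g i ⁆)
    gi∈ : Mem sp (vec M (g i))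
    gi∈ = span-gen (vec M) (x∈p∪q⁺ (inj₂ (x∈⁅x⁆ (g i))))
  -- The line through `e` and `g j` projects into the ray of `vec N j`.
  unique : ∀ i j → InCl M (⁅ e ⁆ ∪ ⁅ g j ⁆) (g i) → i ≡ j
  unique i j gi∈
    with span-least (vec M) (comap (proj q) (proj-add q) (ray (vec N j))) gens gi∈
    where
    gens : ∀ k → k ∈ ⁅ e ⁆ ∪ ⁅ g j ⁆ → proj q (vec M k) ≡ zeroV ⊎ proj q (vec M k) ≡ vec N j
    gens k k∈ with x∈p∪q⁻ ⁅ e ⁆ ⁅ g j ⁆ k∈
    ... | inj₁ k∈e = inj₁ (trans (cong (proj q ∘ vec M) (x∈⁅y⁆⇒x≡y e k∈e)) (proj-x q))
    ... | inj₂ k∈g = inj₂ (trans (cong (proj q ∘ vec M) (x∈⁅y⁆⇒x≡y (g j) k∈g)) (proj₂ (lift j)))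
  ... | inj₁ eq = ⊥-elim (vec-nz N i (trans (sym (proj₂ (lift i))) eq))
  ... | inj₂ eq = vec-inj N i j (trans (sym (proj₂ (lift i))) eq)
  indep : ∀ X → (∀ y → y ∈ X → ∃ λ i → g i ≡ y) → Indep M (X ∪ ⁅ e ⁆) ⇔ Indep N (pre g X)
  indep X X⊆ = mk⇔ (to eq ∘ to lc) (from lc ∘ from eq)
    where
    lc = linIndep-contract (vec M) e (vec-nz M e) q g-inj g≢e X X⊆
    eq = cycEq⇒indep {v = proj q ∘ vec M ∘ g} {w = vec N} (cycEq-cong (proj₂ ∘ lift)) (pre g X)

-- Forbidden configurations

Free : BinMat → Set
Free M = ¬ IndMinor MK4 M × ¬ IndMinor U34 M

free-restriction : {N M : BinMat} → FlatRestriction N M → Free M → Free N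
free-restriction r (k , u) = k ∘ viaRestr r , u ∘ viaRestr r

free-contraction : {N M : BinMat} → SimpContraction N M → Free M → Free N
free-contraction c (k , u) = k ∘ viaContr c , u ∘ viaContr c

iso-refl : (M : BinMat) → Iso M M
iso-refl M = id , (λ _ _ → id) , (λ j → j , refl) , λ X →
  subst (λ Y → Indep M X ⇔ Indep M Y) (sym (Vec.tabulate∘lookup X)) (mk⇔ id id)

-- The subspace `imageˢ add` cuts out a flat, and by the last hypothesis this flat has no points
-- besides those of `N`.
config-minor : (N : BinMat) {S : List (V n)} {h : V (dim N) → V n} → Additive h → Injective h →
  (∀ i → S ∋ h (vec N i)) → (∀ a → S ∋ h a → a ≡ zeroV ⊎ ∃ λ i → vec N i ≡ a) → IndMinor N (mat S)
config-minor N {S} {h} add inj into onto =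
  viaRestr {M = mat S} {M' = N}
    (flatRestriction N (mat S) add inj find′ (imageˢ add) (λ i → vec N i , refl) onto′)
    (base (iso-refl N))
  where
  find′ : ∀ i → ∃ λ j → vec (mat S) j ≡ h (vec N i)
  find′ i with into i
  ... | inj₁ eq = ⊥-elim (vec-nz N i (inj _ eq))
  ... | inj₂ v∈ = mat-index S v∈ (vec-nz N i ∘ inj _)
  onto′ : ∀ j → (∃ λ a → h a ≡ vec (mat S) j) → ∃ λ i → h (vec N i) ≡ vec (mat S) j
  onto′ j (a , eq) with onto a (subst (S ∋_) (sym eq) (inj₂ (mat-vec∈ S j)))
  ... | inj₁ refl = ⊥-elim (vec-nz (mat S) j (trans (sym eq) (additive-0 add)))
  ... | inj₂ (i , refl) = i , eq

module Triple {n} (a b c : V n) where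

  comb : V 3 → V n
  comb = sumSel (lookup (a ∷ b ∷ c ∷ []))

  x₀ x₁ x₂ : Expr 3
  x₀ = var zero
  x₁ = var (suc zero)
  x₂ = var (suc (suc zero))

  ev : (e : Expr 3) → comb (coeffs e) ≡ ⟦ e ⟧ (a ∷ b ∷ c ∷ [])
  ev e = ⇓-correct e (a ∷ b ∷ c ∷ [])

  comb-add : Additive comb
  comb-add = sumSel-⊕ _

  comb-inj : a ≢ zeroV → b ≢ zeroV → c ≢ zeroV → a ≢ b → a ≢ c → b ≢ c → a ⊕ b ≢ c → Injective comb
  comb-inj a≢ b≢ c≢ a≢b a≢c b≢c ab≢c = λ where
    (false ∷ false ∷ false ∷ []) _ → refl
    (true  ∷ false ∷ false ∷ []) eq → ⊥-elim (a≢ (trans (sym (ev x₀)) eq))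
    (false ∷ true  ∷ false ∷ []) eq → ⊥-elim (b≢ (trans (sym (ev x₁)) eq))
    (false ∷ false ∷ true  ∷ []) eq → ⊥-elim (c≢ (trans (sym (ev x₂)) eq))
    (true  ∷ true  ∷ false ∷ []) eq → ⊥-elim (a≢b (⊕≡0⇒≡ (trans (sym (ev (x₀ ⊞ x₁))) eq)))
    (true  ∷ false ∷ true  ∷ []) eq → ⊥-elim (a≢c (⊕≡0⇒≡ (trans (sym (ev (x₀ ⊞ x₂))) eq)))
    (false ∷ true  ∷ true  ∷ []) eq → ⊥-elim (b≢c (⊕≡0⇒≡ (trans (sym (ev (x₁ ⊞ x₂))) eq)))
    (true  ∷ true  ∷ true  ∷ []) eq → ⊥-elim (ab≢c (⊕≡0⇒≡ (trans (sym (ev (x₀ ⊞ x₁ ⊞ x₂))) eq)))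

  module _ {S : List (V n)} where

    ev⁺ : (e : Expr 3) → S ∋ ⟦ e ⟧ (a ∷ b ∷ c ∷ []) → S ∋ comb (coeffs e)
    ev⁺ e = subst (S ∋_) (sym (ev e))

    ev⁻ : (e : Expr 3) → S ∋ comb (coeffs e) → S ∋ ⟦ e ⟧ (a ∷ b ∷ c ∷ [])
    ev⁻ e = subst (S ∋_) (ev e)

    -- Any linear dependence among a, b, c would put their sum into `S`, so the hypotheses already
    -- force independence.
    K₄-minor : S ∋ a → S ∋ b → S ∋ c → S ∋ a ⊕ b → S ∋ a ⊕ c → S ∋ b ⊕ c →
               ¬ S ∋ (a ⊕ b) ⊕ c → IndMinor MK4 (mat S)
    K₄-minor sa sb sc sab sac sbc ¬sabc = config-minor MK4 comb-add (comb-inj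
      (λ { refl → ¬sabc (subst (S ∋_) (solve 2 (λ b c → b ⊞ c ⊜ (𝟎 ⊞ b) ⊞ c) refl b c) sbc) })
      (λ { refl → ¬sabc (subst (S ∋_) (solve 2 (λ a c → a ⊞ c ⊜ (a ⊞ 𝟎) ⊞ c) refl a c) sac) })
      (λ { refl → ¬sabc (subst (S ∋_) (sym (⊕-identityʳ (a ⊕ b))) sab) })
      (λ { refl → ¬sabc (subst (S ∋_) (solve 2 (λ a c → c ⊜ (a ⊞ a) ⊞ c) refl a c) sc) })
      (λ { refl → ¬sabc (subst (S ∋_) (solve 2 (λ a b → b ⊜ (a ⊞ b) ⊞ a) refl a b) sb) })
      (λ { refl → ¬sabc (subst (S ∋_) (solve 2 (λ a b → a ⊜ (a ⊞ b) ⊞ b) refl a b) sa) })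
      (λ { refl → ¬sabc (inj₁ (⊕-self (a ⊕ b))) }))
      (λ where
        zero                                → ev⁺ x₀ sa
        (suc zero)                          → ev⁺ x₁ sb
        (suc (suc zero))                    → ev⁺ x₂ sc
        (suc (suc (suc zero)))              → ev⁺ (x₀ ⊞ x₁) sab
        (suc (suc (suc (suc zero))))        → ev⁺ (x₀ ⊞ x₂) sac
        (suc (suc (suc (suc (suc zero))))) → ev⁺ (x₁ ⊞ x₂) sbc)
      (λ where
        (false ∷ false ∷ false ∷ []) _ → inj₁ refl
        (true  ∷ false ∷ false ∷ []) _ → inj₂ (zero , refl)
        (false ∷ true  ∷ false ∷ []) _ → inj₂ (suc zero , refl)
        (false ∷ false ∷ true  ∷ []) _ → inj₂ (suc (suc zero) , refl)
        (true  ∷ true  ∷ false ∷ []) _ → inj₂ (suc (suc (suc zero)) , refl)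
        (true  ∷ false ∷ true  ∷ []) _ → inj₂ (suc (suc (suc (suc zero))) , refl)
        (false ∷ true  ∷ true  ∷ []) _ → inj₂ (suc (suc (suc (suc (suc zero)))) , refl)
        (true  ∷ true  ∷ true  ∷ []) s → ⊥-elim (¬sabc (ev⁻ (x₀ ⊞ x₁ ⊞ x₂) s)))

    -- Here a dependence among a, b, c would put one of the pairwise sums into `S`.
    U₃₄-minor : S ∋ a → S ∋ b → S ∋ c → S ∋ (a ⊕ b) ⊕ c →
                ¬ S ∋ a ⊕ b → ¬ S ∋ a ⊕ c → ¬ S ∋ b ⊕ c → IndMinor U34 (mat S)
    U₃₄-minor sa sb sc sabc ¬ab ¬ac ¬bc = config-minor U34 comb-add (comb-inj
      (λ { refl → ¬ab (subst (S ∋_) (sym (⊕-identityˡ b)) sb) })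
      (λ { refl → ¬ab (subst (S ∋_) (sym (⊕-identityʳ a)) sa) })
      (λ { refl → ¬ac (subst (S ∋_) (sym (⊕-identityʳ a)) sa) })
      (λ { refl → ¬ab (inj₁ (⊕-self a)) })
      (λ { refl → ¬ac (inj₁ (⊕-self a)) })
      (λ { refl → ¬bc (inj₁ (⊕-self b)) })
      (λ { refl → ¬ab sc }))
      (λ where
        zero                   → ev⁺ x₀ sa
        (suc zero)             → ev⁺ x₁ sb
        (suc (suc zero))       → ev⁺ x₂ sc
        (suc (suc (suc zero))) → ev⁺ (x₀ ⊞ x₁ ⊞ x₂) sabc)
      (λ where
        (false ∷ false ∷ false ∷ []) _ → inj₁ refl
        (true  ∷ false ∷ false ∷ []) _ → inj₂ (zero , refl)
        (false ∷ true  ∷ false ∷ []) _ → inj₂ (suc zero , refl)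
        (false ∷ false ∷ true  ∷ []) _ → inj₂ (suc (suc zero) , refl)
        (true  ∷ true  ∷ false ∷ []) s → ⊥-elim (¬ab (ev⁻ (x₀ ⊞ x₁) s))
        (true  ∷ false ∷ true  ∷ []) s → ⊥-elim (¬ac (ev⁻ (x₀ ⊞ x₂) s))
        (false ∷ true  ∷ true  ∷ []) s → ⊥-elim (¬bc (ev⁻ (x₁ ⊞ x₂) s))
        (true  ∷ true  ∷ true  ∷ []) s → inj₂ (suc (suc (suc zero)) , refl))

-- A record, so that `S` can be read off the type; `mat S` does not determine it.
record Avoiding (S : List (V n)) : Set where
  constructor avoiding
  field free : Free (mat S)

avoiding-restrict : {S : List (V n)} → Avoiding S → (W : Subspace n) → Avoiding (restrict S W)
avoiding-restrict {S = S} (avoiding free) W =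
  avoiding (free-restriction {mat (restrict S W)} {mat S} (mat-restrict-flat S W) free)

avoiding-contract : {S : List (V n)} {x : V n} → Avoiding S → x ∈ₗ S → x ≢ zeroV →
                    (q : Quotient x) → Avoiding (contract S q)
avoiding-contract {S = S} (avoiding free) x∈ x≢0 q =
  avoiding (free-contraction {mat (contract S q)} {mat S} (mat-contract S x∈ x≢0 q) free)

avoiding-K₄ : {S : List (V n)} → Avoiding S → ∀ {a b c} → S ∋ a → S ∋ b → S ∋ c →
              S ∋ a ⊕ b → S ∋ a ⊕ c → S ∋ b ⊕ c → S ∋ (a ⊕ b) ⊕ c
avoiding-K₄ {S = S} (avoiding free) {a} {b} {c} sa sb sc sab sac sbc = decidable-¬¬ (S ∋? _)
  (λ ¬sabc → proj₁ free (Triple.K₄-minor a b c sa sb sc sab sac sbc ¬sabc))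

avoiding-U₃₄ : {S : List (V n)} → Avoiding S → ∀ {a b c} → S ∋ a → S ∋ b → S ∋ c →
               S ∋ (a ⊕ b) ⊕ c → S ∋ a ⊕ b ⊎ S ∋ a ⊕ c ⊎ S ∋ b ⊕ c
avoiding-U₃₄ {S = S} (avoiding free) {a} {b} {c} sa sb sc sabc with S ∋? (a ⊕ b) | S ∋? (a ⊕ c) | S ∋? (b ⊕ c)
... | yes ab | _ | _ = inj₁ ab
... | _ | yes ac | _ = inj₂ (inj₁ ac)
... | _ | _ | yes bc = inj₂ (inj₂ bc)
... | no ¬ab | no ¬ac | no ¬bc = ⊥-elim (proj₂ free (Triple.U₃₄-minor a b c sa sb sc sabc ¬ab ¬ac ¬bc))

module FreeStructure = Structure Avoiding avoiding-restrict avoiding-contract avoiding-K₄ avoiding-U₃₄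

-- Coordinates and dimension

record Coordinates (U : Subspace n) : Set where
  field
    rank  : ℕ
    ψ     : V rank → V n
    ψ-add : Additive ψ
    ψ-inj : Injective ψ
    into  : ∀ a → Mem U (ψ a)
    onto  : ∀ {v} → Mem U v → ∃ λ a → ψ a ≡ v

-- Elimination by leading coordinate: a vector of `U` with leading 1, if there is one, extends a
-- basis of the vectors with leading 0.
coordinates : (U : Subspace n) → Coordinates U
coordinates {zero} U = record
  { rank = 0 ; ψ = id ; ψ-add = λ _ _ → refl ; ψ-inj = λ _ → id
  ; into = λ { [] → 0∈ U } ; onto = λ {v} _ → v , refl }
coordinates {suc n} U
  with coordinates (comap (false ∷_) (λ _ _ → refl) U) | anySubset? (λ u → mem? U (true ∷ u))
... | C | no none = record
  { rank = rank ; ψ = λ a → false ∷ ψ a ; ψ-add = λ a b → cong (false ∷_) (ψ-add a b)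
  ; ψ-inj = λ a eq → ψ-inj a (Vec.∷-injectiveʳ eq) ; into = into
  ; onto = λ { {true ∷ v} v∈ → ⊥-elim (none (v , v∈))
             ; {false ∷ v} v∈ → let a , eq = onto v∈ in a , cong (false ∷_) eq } }
  where open Coordinates C
... | C | yes (u , u∈) = record
  { rank = suc rank ; ψ = ψ′
  ; ψ-add = λ { (b ∷ v) (c ∷ w) → cong (_ ∷_) (trans (cong₂ _⊕_ (scale-xor b c u) (ψ-add v w)) (⊕-interchange _ _ _ _)) }
  ; ψ-inj = λ { (false ∷ v) eq → cong (false ∷_) (ψ-inj v (trans (sym (⊕-identityˡ _)) (Vec.∷-injectiveʳ eq))) }
  ; into = λ { (false ∷ v) → subst (Mem U) (cong (false ∷_) (sym (⊕-identityˡ _))) (into v)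
             ; (true ∷ v) → subst (Mem U) (cong (true ∷_) refl) (add∈ U u∈ (into v)) }
  ; onto = λ { {false ∷ v} v∈ → let a , eq = onto v∈ in false ∷ a , cong (false ∷_) (trans (⊕-identityˡ _) eq)
             ; {true ∷ v} v∈ → let a , eq = onto (add∈ U u∈ v∈) in
                 true ∷ a , cong (true ∷_) (trans (cong (u ⊕_) eq) (solve 2 (λ u v → u ⊞ (u ⊞ v) ⊜ v) refl u v)) } }
  where
  open Coordinates C
  ψ′ : V (suc rank) → V (suc n)
  ψ′ (b ∷ v) = b ∷ ((if b then u else zeroV) ⊕ ψ v)

-- A bijection with GF(2)^k, not assumed linear: dimensions are compared by counting.
record Param (U : Subspace n) (k : ℕ) : Set where
  field
    ψ    : V k → V n
    inj  : ∀ {a b} → ψ a ≡ ψ b → a ≡ b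
    into : ∀ a → Mem U (ψ a)
    onto : ∀ {v} → Mem U v → ∃ λ a → ψ a ≡ v

param-resp : {A B : Subspace n} → (∀ {v} → Mem A v → Mem B v) → (∀ {v} → Mem B v → Mem A v) →
             Param A k → Param B k
param-resp A⊆B B⊆A p = record { ψ = ψ ; inj = inj ; into = A⊆B ∘ into ; onto = onto ∘ B⊆A }
  where open Param p

private
  module Bit = Inverse Fin.2↔Bool

encode : V k → Fin (2 ^ k)
encode []      = zero
encode (b ∷ v) = Fin.combine (Bit.from b) (encode v)

decode : ∀ k → Fin (2 ^ k) → V k
decode zero    i = []
decode (suc k) i = let b , j = Fin.remQuot {2} (2 ^ k) i in Bit.to b ∷ decode k j

decode-encode : (v : V k) → decode k (encode v) ≡ v
decode-encode []      = refl
decode-encode {suc k} (b ∷ v) = trans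
  (cong (λ (c , j) → Bit.to c ∷ decode k j) (Fin.remQuot-combine {2} {2 ^ k} (Bit.from b) (encode v)))
  (cong₂ _∷_ (Bit.strictlyInverseˡ b) (decode-encode v))

encode-decode : ∀ k (i : Fin (2 ^ k)) → encode (decode k i) ≡ i
encode-decode zero    zero = refl
encode-decode (suc k) i = trans
  (cong₂ Fin.combine (Bit.strictlyInverseʳ (proj₁ (Fin.remQuot {2} (2 ^ k) i))) (encode-decode k _))
  (Fin.combine-remQuot {2} (2 ^ k) i)

injection⇒≤ : (h : V m → V n) → (∀ {a b} → h a ≡ h b → a ≡ b) → m ≤ n
injection⇒≤ {m} {n} h inj = ℕ.≮⇒≥ λ n<m →
  ℕ.<⇒≱ (ℕ.^-monoʳ-< 2 (s≤s (s≤s z≤n)) n<m) (Fin.injective⇒≤ {f = encode ∘ h ∘ decode m} λ {i} {j} eq →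
    trans (sym (encode-decode m i)) (trans (cong encode (inj
      (trans (sym (decode-encode _)) (trans (cong (decode n) eq) (decode-encode _))))) (encode-decode m j)))

injection₂⇒≤ : ∀ a b {c d} (h : V a → V b → V c × V d) →
               (∀ {x y x′ y′} → h x y ≡ h x′ y′ → x ≡ x′ × y ≡ y′) → a + b ≤ c + d
injection₂⇒≤ a b {c} {d} h inj = injection⇒≤ glue glue-inj
  where
  pair : V (a + b) → V c × V d
  pair z = h (Vec.take a z) (Vec.drop a z)
  glue : V (a + b) → V (c + d)
  glue z = proj₁ (pair z) Vec.++ proj₂ (pair z)
  glue-inj : ∀ {z z′} → glue z ≡ glue z′ → z ≡ z′
  glue-inj {z} {z′} eq with e₁ , e₂ ← Vec.++-injective (proj₁ (pair z)) (proj₁ (pair z′)) eq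
                       with t , u ← inj (cong₂ _,_ e₁ e₂) =
    trans (sym (Vec.take++drop≡id a z)) (trans (cong₂ Vec._++_ t u) (Vec.take++drop≡id a z′))

-- Both inequalities send (x , y) to a pair of vectors with the same sum, corrected by a
-- fixed choice of decomposition of the vectors of A ⊔ B.
dimension-formula : {A B : Subspace n} {a b c d : ℕ} → Param A a → Param B b →
                    Param (A ⊔ B) c → Param (A ⊓ B) d → a + b ≡ c + d
dimension-formula {n} {A} {B} {a} {b} {c} {d} PA PB PC PD =
  ℕ.≤-antisym (injection₂⇒≤ a b f f-inj) (injection₂⇒≤ c d g g-inj)
  where
  module PA = Param PA
  module PB = Param PB
  module PC = Param PC
  module PD = Param PD
  left right : V c → V n
  left w = proj₁ (PC.into w)
  right w = PC.ψ w ⊕ left w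
  left∈ : ∀ w → Mem A (left w)
  left∈ w = proj₁ (proj₂ (PC.into w))
  right∈ : ∀ w → Mem B (right w)
  right∈ w = proj₂ (proj₂ (PC.into w))

  sum∈ : ∀ x y → Mem (A ⊔ B) (PA.ψ x ⊕ PB.ψ y)
  sum∈ x y = PA.ψ x , PA.into x , subst (Mem B) (solve 2 (λ x y → y ⊜ (x ⊞ y) ⊞ x) refl (PA.ψ x) (PB.ψ y)) (PB.into y)
  f₁ : V a → V b → V c
  f₁ x y = proj₁ (PC.onto (sum∈ x y))
  f₁-eq : ∀ x y → PC.ψ (f₁ x y) ≡ PA.ψ x ⊕ PB.ψ y
  f₁-eq x y = proj₂ (PC.onto (sum∈ x y))
  diff : V a → V b → V n
  diff x y = PB.ψ y ⊕ right (f₁ x y)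
  diff∈ : ∀ x y → Mem (A ⊓ B) (diff x y)
  diff∈ x y = subst (Mem A) eq (add∈ A (PA.into x) (left∈ (f₁ x y))) , add∈ B (PB.into y) (right∈ (f₁ x y))
    where
    eq : PA.ψ x ⊕ left (f₁ x y) ≡ diff x y
    eq = trans (solve 3 (λ x y l → x ⊞ l ⊜ y ⊞ ((x ⊞ y) ⊞ l)) refl (PA.ψ x) (PB.ψ y) (left (f₁ x y)))
               (cong (λ z → PB.ψ y ⊕ (z ⊕ left (f₁ x y))) (sym (f₁-eq x y)))
  f : V a → V b → V c × V d
  f x y = f₁ x y , proj₁ (PD.onto (diff∈ x y))
  f-inj : ∀ {x y x′ y′} → f x y ≡ f x′ y′ → x ≡ x′ × y ≡ y′
  f-inj {x} {y} {x′} {y′} eq = PA.inj ψx≡ , PB.inj ψy≡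
    where
    e₁ : f₁ x y ≡ f₁ x′ y′
    e₁ = cong proj₁ eq
    e₂ : diff x y ≡ diff x′ y′
    e₂ = trans (sym (proj₂ (PD.onto (diff∈ x y)))) (trans (cong PD.ψ (cong proj₂ eq)) (proj₂ (PD.onto (diff∈ x′ y′))))
    ψy≡ : PB.ψ y ≡ PB.ψ y′
    ψy≡ = trans (sym (⊕-cancel _ (right (f₁ x y)))) (trans (cong₂ _⊕_ e₂ (cong right e₁)) (⊕-cancel _ _))
    ψx≡ : PA.ψ x ≡ PA.ψ x′
    ψx≡ = trans (sym (⊕-cancel _ (PB.ψ y)))
      (trans (cong₂ _⊕_ (trans (sym (f₁-eq x y)) (trans (cong PC.ψ e₁) (f₁-eq x′ y′))) ψy≡) (⊕-cancel _ _))

  g∈A : ∀ w u → Mem A (left w ⊕ PD.ψ u)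
  g∈A w u = add∈ A (left∈ w) (proj₁ (PD.into u))
  g∈B : ∀ w u → Mem B (right w ⊕ PD.ψ u)
  g∈B w u = add∈ B (right∈ w) (proj₂ (PD.into u))
  g : V c → V d → V a × V b
  g w u = proj₁ (PA.onto (g∈A w u)) , proj₁ (PB.onto (g∈B w u))
  g-inj : ∀ {w u w′ u′} → g w u ≡ g w′ u′ → w ≡ w′ × u ≡ u′
  g-inj {w} {u} {w′} {u′} eq = w≡ , PD.inj ψu≡
    where
    e₁ : left w ⊕ PD.ψ u ≡ left w′ ⊕ PD.ψ u′
    e₁ = trans (sym (proj₂ (PA.onto (g∈A w u)))) (trans (cong PA.ψ (cong proj₁ eq)) (proj₂ (PA.onto (g∈A w′ u′))))
    e₂ : right w ⊕ PD.ψ u ≡ right w′ ⊕ PD.ψ u′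
    e₂ = trans (sym (proj₂ (PB.onto (g∈B w u)))) (trans (cong PB.ψ (cong proj₂ eq)) (proj₂ (PB.onto (g∈B w′ u′))))
    total : ∀ w u → (left w ⊕ PD.ψ u) ⊕ (right w ⊕ PD.ψ u) ≡ PC.ψ w
    total w u = solve 3 (λ l u z → (l ⊞ u) ⊞ ((z ⊞ l) ⊞ u) ⊜ z) refl (left w) (PD.ψ u) (PC.ψ w)
    w≡ : w ≡ w′
    w≡ = PC.inj (trans (sym (total w u)) (trans (cong₂ _⊕_ e₁ e₂) (total w′ u′)))
    ψu≡ : PD.ψ u ≡ PD.ψ u′
    ψu≡ = trans (solve 2 (λ l u → u ⊜ l ⊞ (l ⊞ u)) refl (left w) (PD.ψ u))
          (trans (cong₂ _⊕_ (cong left w≡) e₁) (solve 2 (λ l u → l ⊞ (l ⊞ u) ⊜ u) refl (left w′) (PD.ψ u′)))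

-- Matroid rank as dimension of the span

-- With `gather`, identifies the subsets of `Y` with bit vectors of length ∣Y∣, so that an
-- independent `Y` parametrises its span.
spread : (Y : Subset m) → V ∣ Y ∣ → Subset m
spread []          []      = []
spread (true ∷ Y)  (b ∷ w) = b ∷ spread Y w
spread (false ∷ Y) w       = false ∷ spread Y w

gather : (Y : Subset m) → Subset m → V ∣ Y ∣
gather []          []      = []
gather (true ∷ Y)  (b ∷ Z) = b ∷ gather Y Z
gather (false ∷ Y) (b ∷ Z) = gather Y Z

gather-spread : (Y : Subset m) (w : V ∣ Y ∣) → gather Y (spread Y w) ≡ w
gather-spread []          []      = refl
gather-spread (true ∷ Y)  (b ∷ w) = cong (b ∷_) (gather-spread Y w)
gather-spread (false ∷ Y) w       = gather-spread Y w

spread-⊆ : (Y : Subset m) (w : V ∣ Y ∣) → spread Y w ⊆ Y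
spread-⊆ (true ∷ Y)  (b ∷ w) Vec.here       = Vec.here
spread-⊆ (true ∷ Y)  (b ∷ w) (Vec.there i∈) = Vec.there (spread-⊆ Y w i∈)
spread-⊆ (false ∷ Y) w       (Vec.there i∈) = Vec.there (spread-⊆ Y w i∈)

spread-gather : (Y Z : Subset m) → Z ⊆ Y → spread Y (gather Y Z) ≡ Z
spread-gather []          []          Z⊆ = refl
spread-gather (true ∷ Y)  (b ∷ Z)     Z⊆ = cong (b ∷_) (spread-gather Y Z (λ i∈ → drop-there (Z⊆ (Vec.there i∈))))
spread-gather (false ∷ Y) (true ∷ Z)  Z⊆ with () ← Z⊆ Vec.here
spread-gather (false ∷ Y) (false ∷ Z) Z⊆ = cong (false ∷_) (spread-gather Y Z (λ i∈ → drop-there (Z⊆ (Vec.there i∈))))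

basis-spans : (M : BinMat) {X Y : Subset (size M)} → Y ⊆ X → Indep M Y →
              (∀ Z → Z ⊆ X → Indep M Z → ∣ Z ∣ ≤ ∣ Y ∣) → ∀ {x} → x ∈ X → InSpan (vec M) Y (vec M x)
basis-spans M {X} {Y} Y⊆X ind maximal {x} x∈X with mem? (span (vec M) Y) (vec M x)
... | yes x∈ = x∈
... | no  x∉ = ⊥-elim (ℕ.<⇒≱ (p⊂q⇒∣p∣<∣q∣ Y⊂) (maximal (Y ∪ ⁅ x ⁆) Yx⊆X Yx-ind))
  where
  Y⊂ : Y ⊂ Y ∪ ⁅ x ⁆
  Y⊂ = (λ i∈ → x∈p∪q⁺ (inj₁ i∈)) , x , x∈p∪q⁺ (inj₂ (x∈⁅x⁆ x)) , x∉ ∘ span-gen (vec M)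
  Yx⊆X : Y ∪ ⁅ x ⁆ ⊆ X
  Yx⊆X {i} i∈ with x∈p∪q⁻ Y ⁅ x ⁆ i∈
  ... | inj₁ i∈Y = Y⊆X i∈Y
  ... | inj₂ i∈x = subst (_∈ X) (sym (x∈⁅y⁆⇒x≡y x i∈x)) x∈X
  inY : ∀ {Z} → Z ⊆ Y ∪ ⁅ x ⁆ → ∀ {i} → i ∈ Z → i ≢ x → i ∈ Y
  inY Z⊆ i∈ i≢x with x∈p∪q⁻ Y ⁅ x ⁆ (Z⊆ i∈)
  ... | inj₁ i∈Y = i∈Y
  ... | inj₂ i∈x = ⊥-elim (i≢x (x∈⁅y⁆⇒x≡y x i∈x))
  Yx-ind : Indep M (Y ∪ ⁅ x ⁆)
  Yx-ind Z Z⊆ eq with x ∈? Z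
  ... | no x∉Z = ind Z (λ {i} i∈ → inY Z⊆ i∈ (λ { refl → x∉Z i∈ })) eq
  ... | yes x∈Z = ⊥-elim (x∉ (Z ⊕ ⁅ x ⁆ , Zx⊆ ,
      trans (sumSel-⊕ (vec M) Z ⁅ x ⁆) (trans (cong₂ _⊕_ eq (sumSel-⁅⁆ (vec M) x)) (⊕-identityˡ _))))
    where
    Zx⊆ : Z ⊕ ⁅ x ⁆ ⊆ Y
    Zx⊆ {i} i∈ with i Fin.≟ x
    ... | yes refl = ⊥-elim (∉-⊕ Z ⁅ x ⁆ x∈Z (x∈⁅x⁆ x) i∈)
    ... | no i≢x with ∈-⊕⁻ Z ⁅ x ⁆ i∈
    ...   | inj₁ i∈Z = inY Z⊆ i∈Z i≢x
    ...   | inj₂ i∈x = ⊥-elim (i≢x (x∈⁅y⁆⇒x≡y x i∈x))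

rank⇒param : (M : BinMat) (X : Subset (size M)) → RankIs M X k → Param (span (vec M) X) k
rank⇒param M X ((Y , Y⊆X , ind , refl) , maximal) = record
  { ψ = sumSel (vec M) ∘ spread Y
  ; inj = λ {a} {b} eq → trans (sym (gather-spread Y a)) (trans (cong (gather Y) (⊕≡0⇒≡ (ind (spread Y a ⊕ spread Y b)
      (λ i∈ → [ spread-⊆ Y a , spread-⊆ Y b ]′ (∈-⊕⁻ (spread Y a) (spread Y b) i∈))
      (trans (sumSel-⊕ (vec M) (spread Y a) (spread Y b)) (trans (cong (_⊕ sumSel (vec M) (spread Y b)) eq) (⊕-self _))))))
      (gather-spread Y b))
  ; into = λ a → spread Y a , (λ i∈ → Y⊆X (spread-⊆ Y a i∈)) , refl
  ; onto = λ v∈ → let Z , Z⊆ , eq = span-least (vec M) (span (vec M) Y) (λ i i∈ → basis-spans M Y⊆X ind maximal i∈) v∈ in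
      gather Y Z , trans (cong (sumSel (vec M)) (spread-gather Y Z Z⊆)) eq }

-- Projective geometries and generalized parallel connections

subspace⇒IsPG : (M : BinMat) (U : Subspace (dim M)) → (∀ i → Mem U (vec M i)) →
                (∀ {v} → Mem U v → v ≢ zeroV → ∃ λ i → vec M i ≡ v) → IsPG M
subspace⇒IsPG M U into′ onto′ =
  rank , φ , (λ i j eq → vec-inj M i j (trans (sym (φ-eq i)) (trans (cong ψ eq) (φ-eq j)))) ,
  (λ i eq → vec-nz M i (trans (sym (φ-eq i)) (trans (cong ψ eq) (additive-0 ψ-add)))) ,
  (λ x x≢0 → let i , eq = onto′ (into x) (x≢0 ∘ ψ-inj x) in
     i , additive-injective ψ-add ψ-inj (trans (φ-eq i) eq)) ,
  cycEq⇒indep {v = vec M} {w = φ} (cycEq-trans (cycEq-cong (sym ∘ φ-eq)) (cycEq-linear ψ-add ψ-inj φ))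
  where
  open Coordinates (coordinates U)
  φ : Fin (size M) → V rank
  φ i = proj₁ (onto (into′ i))
  φ-eq : ∀ i → ψ (φ i) ≡ vec M i
  φ-eq i = proj₂ (onto (into′ i))

-- Every nonzero vector in the span of T is an element of `M`. Hence span T ∩ span F is spanned by T
-- ∩ F for each flat F, and the dimension formula turns into modularity.
flat-modular : (M : BinMat) (W : Subspace (dim M)) →
               (∀ {v} → Mem (span (vec M) ⊤) v → Mem W v → v ≢ zeroV → ∃ λ i → vec M i ≡ v) →
               ModularFlat M (trace M W)
flat-modular M W full = trace-flat M W , λ F flatF a b c d ra rb rc rd →
  dimension-formula (rank⇒param M T ra) (rank⇒param M F rb)
    (param-resp {A = span (vec M) (T ∪ F)} {B = A ⊔ B F} (⊆⊔ F) (⊔⊆ F) (rank⇒param M (T ∪ F) rc))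
    (param-resp {A = span (vec M) (T ∩ F)} {B = A ⊓ B F} (⊆⊓ F) (⊓⊆ F flatF) (rank⇒param M (T ∩ F) rd))
  where
  T = trace M W
  A = span (vec M) T
  B : Subset (size M) → Subspace (dim M)
  B F = span (vec M) F
  ⊆⊔ : ∀ F {v} → InSpan (vec M) (T ∪ F) v → Mem (A ⊔ B F) v
  ⊆⊔ F = span-least (vec M) (A ⊔ B F) λ i i∈ → [ (λ i∈T → ⊔-introˡ A (B F) (span-gen (vec M) i∈T))
                                             , (λ i∈F → ⊔-introʳ A (B F) (span-gen (vec M) i∈F)) ]′ (x∈p∪q⁻ T F i∈)
  ⊔⊆ : ∀ F {v} → Mem (A ⊔ B F) v → InSpan (vec M) (T ∪ F) v
  ⊔⊆ F {v} (a , a∈ , va∈) = cancel∈ (span (vec M) (T ∪ F))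
    (span-least (vec M) (span (vec M) (T ∪ F)) (λ i i∈ → span-gen (vec M) (x∈p∪q⁺ (inj₂ i∈))) va∈)
    (span-least (vec M) (span (vec M) (T ∪ F)) (λ i i∈ → span-gen (vec M) (x∈p∪q⁺ (inj₁ i∈))) a∈)
  ⊆⊓ : ∀ F {v} → InSpan (vec M) (T ∩ F) v → Mem (A ⊓ B F) v
  ⊆⊓ F = span-least (vec M) (A ⊓ B F) λ i i∈ → let i∈T , i∈F = x∈p∩q⁻ T F i∈ in
    span-gen (vec M) i∈T , span-gen (vec M) i∈F
  ⊓⊆ : ∀ F → Flat M F → ∀ {v} → Mem (A ⊓ B F) v → InSpan (vec M) (T ∩ F) v
  ⊓⊆ F flatF {v} (v∈A@(Y , _ , eq) , v∈B) with v ≟ⱽ zeroV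
  ... | yes refl = 0∈ (span (vec M) (T ∩ F))
  ... | no v≢0
    with w ← span-least (vec M) W (λ i → ∈-comprehend⁻ (mem? W ∘ vec M)) v∈A
    with i , refl ← full (Y , (λ _ → ∈⊤) , eq) w v≢0 =
    span-gen (vec M) (x∈p∩q⁺ (∈-comprehend⁺ (mem? W ∘ vec M) w , flatF i v∈B))

-- From a split to a generalized parallel connection

-- The pieces of a split keep the ambient space of `M`, so that their vectors can be compared
-- directly.
record Restricted (M : BinMat) (W : Subspace (dim M)) : Set where
  field
    size′ : ℕ
    vec′  : Fin size′ → V (dim M)
    inj′  : ∀ i j → vec′ i ≡ vec′ j → i ≡ j
    nz′   : ∀ i → vec′ i ≢ zeroV
    back  : ∀ i → (∃ λ j → vec M j ≡ vec′ i) × Mem W (vec′ i)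
    forth : ∀ j → Mem W (vec M j) → ∃ λ i → vec′ i ≡ vec M j
    size≤ : size′ ≤ length (restrict (vectors M) W)

  matroid : BinMat
  matroid = record { dim = dim M ; size = size′ ; vec = vec′ ; vec-inj = inj′ ; vec-nz = nz′ }

  flat : FlatRestriction matroid M
  flat = flatRestriction matroid M (λ _ _ → refl) (λ _ → id) (proj₁ ∘ back) W (proj₂ ∘ back) forth

restricted : (M : BinMat) (W : Subspace (dim M)) → Restricted M W
restricted M W = record
  { size′ = size N ; vec′ = vec N ; inj′ = vec-inj N ; nz′ = vec-nz N
  ; back = back ; forth = forth ; size≤ = mat-size S }
  where
  S = restrict (vectors M) W
  N = mat S
  back : ∀ i → (∃ λ j → vec M j ≡ vec N i) × Mem W (vec N i)
  back i with v∈ , w ← List∈.∈-filter⁻ (mem? W) {xs = vectors M} (mat-vec∈ S i)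
         with j , eq ← List∈.∈-tabulate⁻ v∈ = (j , sym eq) , w
  forth : ∀ j → Mem W (vec M j) → ∃ λ i → vec N i ≡ vec M j
  forth j w = mat-index S (List∈.∈-filter⁺ (mem? W) (List∈.∈-tabulate⁺ j) w) (vec-nz M j)

module SplitGPC (M : BinMat) (d : Split (vectors M))
  (R₁ : Restricted M (Split.W₁ d)) (R₂ : Restricted M (Split.W₂ d))
  (R : Restricted M (Split.W₁ d ⊓ Split.W₂ d)) where

  open Split d

  M₁ = Restricted.matroid R₁
  M₂ = Restricted.matroid R₂
  N  = Restricted.matroid R

  vector : ∀ {v} → vectors M ∋ v → v ≢ zeroV → ∃ λ i → vec M i ≡ v
  vector (inj₁ eq) v≢0 = ⊥-elim (v≢0 eq)
  vector (inj₂ v∈) _ with i , eq ← List∈.∈-tabulate⁻ v∈ = i , sym eq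

  f₁ : Fin (size M₁) → Fin (size M)
  f₁ i = proj₁ (proj₁ (Restricted.back R₁ i))
  f₁-vec : ∀ i → vec M (f₁ i) ≡ vec M₁ i
  f₁-vec i = proj₂ (proj₁ (Restricted.back R₁ i))
  f₂ : Fin (size M₂) → Fin (size M)
  f₂ i = proj₁ (proj₁ (Restricted.back R₂ i))
  f₂-vec : ∀ i → vec M (f₂ i) ≡ vec M₂ i
  f₂-vec i = proj₂ (proj₁ (Restricted.back R₂ i))

  in₁ : ∀ x → Mem W₁ (vec M x) → ∃ λ i → f₁ i ≡ x
  in₁ x w with i , eq ← Restricted.forth R₁ x w = i , vec-inj M _ _ (trans (f₁-vec i) eq)
  in₂ : ∀ x → Mem W₂ (vec M x) → ∃ λ i → f₂ i ≡ x
  in₂ x w with i , eq ← Restricted.forth R₂ x w = i , vec-inj M _ _ (trans (f₂-vec i) eq)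

  W₁∈ : ∀ i → Mem W₁ (vec M₁ i)
  W₁∈ i = proj₂ (Restricted.back R₁ i)
  W₂∈ : ∀ i → Mem W₂ (vec M₂ i)
  W₂∈ i = proj₂ (Restricted.back R₂ i)

  cover-f : ∀ x → (∃ λ i → f₁ i ≡ x) ⊎ (∃ λ j → f₂ j ≡ x)
  cover-f x with cover (List∈.∈-tabulate⁺ x)
  ... | inj₁ w = inj₁ (in₁ x w)
  ... | inj₂ w = inj₂ (in₂ x w)

  N-vec : ∀ k → (∃ λ x → vec M x ≡ vec N k) × Mem W₁ (vec N k) × Mem W₂ (vec N k)
  N-vec = Restricted.back R

  g₁-spec : ∀ k → ∃ λ i → vec M₁ i ≡ vec N k
  g₁-spec k with (x , eq) , w₁ , _ ← N-vec k
            with i , eq′ ← Restricted.forth R₁ x (subst (Mem W₁) (sym eq) w₁) = i , trans eq′ eq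
  g₂-spec : ∀ k → ∃ λ i → vec M₂ i ≡ vec N k
  g₂-spec k with (x , eq) , _ , w₂ ← N-vec k
            with i , eq′ ← Restricted.forth R₂ x (subst (Mem W₂) (sym eq) w₂) = i , trans eq′ eq

  N-index : ∀ {v} → Mem W₁ v → Mem W₂ v → v ≢ zeroV → ∃ λ k → vec N k ≡ v
  N-index w₁ w₂ v≢0 with x , refl ← vector (meet w₁ w₂) v≢0 = Restricted.forth R x (w₁ , w₂)

  span⊆ : {P : Subspace (dim M)} (v : Fin m → V (dim M)) → (∀ i → Mem P (v i)) → {X : Subset m} →
          ∀ {x} → InSpan v X x → Mem P x
  span⊆ {P = P} v all = span-least v P (λ i _ → all i)

  flats⇒ : ∀ {l} (f : Fin l → Fin (size M)) (w : Fin l → V (dim M)) → (∀ i → vec M (f i) ≡ w i) →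
           ∀ X → Flat M X → ∀ e → InSpan w (pre f X) (w e) → e ∈ pre f X
  flats⇒ f w f-vec X flatX e e∈ = ∈-pre⁺ (flatX (f e) (subst (InSpan (vec M) X) (sym (f-vec e))
    (span-least w (span (vec M) X) (λ i i∈ → subst (InSpan (vec M) X) (f-vec i) (span-gen (vec M) (∈-pre⁻ i∈))) e∈)))

  -- A vector e in the span of X is a + b with a and b spanned by the two traces of X. If e is in
  -- `W₁`, so is b; being in W₁ ∩ W₂, it is zero or an element of `N`, lies in X by flatness on the
  -- second side, and is thus spanned on the first.
  flats⇐ : ∀ X → Flat M₁ (pre f₁ X) → Flat M₂ (pre f₂ X) → Flat M X
  flats⇐ X flat₁ flat₂ e e∈ = [ side₁ , side₂ ]′ (cover-f e)
    where
    A = span (vec M₁) (pre f₁ X)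
    B = span (vec M₂) (pre f₂ X)
    A⊆W₁ : ∀ {v} → Mem A v → Mem W₁ v
    A⊆W₁ = span⊆ {P = W₁} (vec M₁) W₁∈
    B⊆W₂ : ∀ {v} → Mem B v → Mem W₂ v
    B⊆W₂ = span⊆ {P = W₂} (vec M₂) W₂∈
    e∈AB : Mem (A ⊔ B) (vec M e)
    e∈AB = span-least (vec M) (A ⊔ B) gens e∈
      where
      gens : ∀ x → x ∈ X → Mem (A ⊔ B) (vec M x)
      gens x x∈ with cover-f x
      ... | inj₁ (i , refl) = ⊔-introˡ A B (subst (Mem A) (sym (f₁-vec i)) (span-gen (vec M₁) (∈-pre⁺ x∈)))
      ... | inj₂ (j , refl) = ⊔-introʳ A B (subst (Mem B) (sym (f₂-vec j)) (span-gen (vec M₂) (∈-pre⁺ x∈)))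
    a = proj₁ e∈AB
    a∈A : Mem A a
    a∈A = proj₁ (proj₂ e∈AB)
    b∈B : Mem B (vec M e ⊕ a)
    b∈B = proj₂ (proj₂ e∈AB)
    shared : ∀ {u} → Mem W₁ u → Mem W₂ u → u ≢ zeroV →
             ∃ λ k → vec M₁ (proj₁ (g₁-spec k)) ≡ u × vec M₂ (proj₁ (g₂-spec k)) ≡ u
    shared w₁ w₂ u≢0 with k , eq ← N-index w₁ w₂ u≢0 = k , trans (proj₂ (g₁-spec k)) eq , trans (proj₂ (g₂-spec k)) eq
    f-eq : ∀ {i j u} → vec M₁ i ≡ u → vec M₂ j ≡ u → f₁ i ≡ f₂ j
    f-eq {i} {j} eq₁ eq₂ = vec-inj M _ _ (trans (f₁-vec i) (trans eq₁ (trans (sym eq₂) (sym (f₂-vec j)))))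
    B⇒A : ∀ {u} → Mem W₁ u → Mem B u → Mem A u
    B⇒A {u} w₁ u∈B with u ≟ⱽ zeroV
    ... | yes refl = 0∈ A
    ... | no u≢0 with k , eq₁ , eq₂ ← shared w₁ (B⊆W₂ u∈B) u≢0 =
      subst (Mem A) eq₁ (span-gen (vec M₁) (∈-pre⁺ (subst (_∈ X) (sym (f-eq eq₁ eq₂))
        (∈-pre⁻ (flat₂ _ (subst (Mem B) (sym eq₂) u∈B))))))
    A⇒B : ∀ {u} → Mem W₂ u → Mem A u → Mem B u
    A⇒B {u} w₂ u∈A with u ≟ⱽ zeroV
    ... | yes refl = 0∈ B
    ... | no u≢0 with k , eq₁ , eq₂ ← shared (A⊆W₁ u∈A) w₂ u≢0 =
      subst (Mem B) eq₂ (span-gen (vec M₂) (∈-pre⁺ (subst (_∈ X) (f-eq eq₁ eq₂)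
        (∈-pre⁻ (flat₁ _ (subst (Mem A) (sym eq₁) u∈A))))))
    side₁ : (∃ λ i → f₁ i ≡ e) → e ∈ X
    side₁ (i , refl) = ∈-pre⁻ (flat₁ i (subst (Mem A) (f₁-vec i)
      (cancel∈ A (B⇒A (add∈ W₁ (subst (Mem W₁) (sym (f₁-vec i)) (W₁∈ i)) (A⊆W₁ a∈A)) b∈B) a∈A)))
    side₂ : (∃ λ j → f₂ j ≡ e) → e ∈ X
    side₂ (j , refl) = ∈-pre⁻ (flat₂ j (subst (Mem B) (f₂-vec j)
      (cancel∈ B b∈B (A⇒B (cancel∈ W₂ (subst (Mem W₂) (⊕-comm _ a) (B⊆W₂ b∈B))
        (subst (Mem W₂) (sym (f₂-vec j)) (W₂∈ j))) a∈A))))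

  split-gpc : GPC M₁ M₂ M
  split-gpc = record
    { f₁ = f₁ ; f₂ = f₂
    ; f₁-inj = Embedding.f-inj M₁ M (λ _ _ → refl) (λ _ → id) f₁ f₁-vec
    ; f₂-inj = Embedding.f-inj M₂ M (λ _ _ → refl) (λ _ → id) f₂ f₂-vec
    ; cover = cover-f
    ; N = N
    ; N-PG = subspace⇒IsPG N (W₁ ⊓ W₂) (λ k → proj₂ (N-vec k)) (λ (w₁ , w₂) → N-index w₁ w₂)
    ; T₁ = trace M₁ W₂ ; T₂ = trace M₂ W₁
    ; g₁ = proj₁ ∘ g₁-spec ; g₂ = proj₁ ∘ g₂-spec
    ; restr₁ = Embedding.restrVia N M₁ (λ _ _ → refl) (λ _ → id) (proj₁ ∘ g₁-spec) (proj₂ ∘ g₁-spec) W₂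
        (λ k → proj₂ (proj₂ (N-vec k))) (λ i w₂ → N-index (W₁∈ i) w₂ (vec-nz M₁ i))
    ; restr₂ = Embedding.restrVia N M₂ (λ _ _ → refl) (λ _ → id) (proj₁ ∘ g₂-spec) (proj₂ ∘ g₂-spec) W₁
        (λ k → proj₁ (proj₂ (N-vec k))) (λ j w₁ → N-index w₁ (W₂∈ j) (vec-nz M₂ j))
    ; T₁-modular = flat-modular M₁ W₂ λ v∈ w₂ v≢0 →
        let k , eq = N-index (span⊆ {P = W₁} (vec M₁) W₁∈ v∈) w₂ v≢0 in
        proj₁ (g₁-spec k) , trans (proj₂ (g₁-spec k)) eq
    ; glue = λ k → vec-inj M _ _ (trans (f₁-vec _) (trans (proj₂ (g₁-spec k))
        (sym (trans (f₂-vec _) (proj₂ (g₂-spec k))))))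
    ; overlap-T = λ i j eq →
        let v-eq = trans (sym (f₂-vec j)) (trans (cong (vec M) (sym eq)) (f₁-vec i))
            k , eq′ = N-index (W₁∈ i) (subst (Mem W₂) v-eq (W₂∈ j)) (vec-nz M₁ i) in
        k , vec-inj M₁ _ _ (trans (proj₂ (g₁-spec k)) eq′)
    ; flats = λ X → mk⇔ (λ flatX → flats⇒ f₁ (vec M₁) f₁-vec X flatX , flats⇒ f₂ (vec M₂) f₂-vec X flatX)
                        (λ (flat₁ , flat₂) → flats⇐ X flat₁ flat₂) }

-- Membership in the class for matroids without the two minors

closed⇒IsPG : (M : BinMat) → Closed (vectors M) → IsPG M
closed⇒IsPG M closed = subspace⇒IsPG M U (λ i → inj₂ (List∈.∈-tabulate⁺ i)) λ where
    (inj₁ eq) v≢0 → ⊥-elim (v≢0 eq)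
    (inj₂ v∈) _ → let i , eq = List∈.∈-tabulate⁻ v∈ in i , sym eq
  where
  U : Subspace (dim M)
  U = record { Mem = vectors M ∋_ ; mem? = vectors M ∋?_ ; 0∈ = inj₁ refl ; add∈ = closed }

-- Restriction to the flat of all elements stands in for the identification of `M` with
-- `mat (vectors M)`.
mat-vectors-flat : (M : BinMat) → FlatRestriction (mat (vectors M)) M
mat-vectors-flat M = flatRestriction (mat (vectors M)) M (λ _ _ → refl) (λ _ → id)
  (λ i → let j , eq = List∈.∈-tabulate⁻ (mat-vec∈ (vectors M) i) in j , sym eq)
  (record { Mem = λ _ → Unit ; mem? = λ _ → yes tt ; 0∈ = tt ; add∈ = λ _ _ → tt }) (λ _ → tt)
  (λ j _ → mat-index (vectors M) (List∈.∈-tabulate⁺ j) (vec-nz M j))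

free⇒InM2 : ∀ b (M : BinMat) → size M < b → Free M → InM2 M
free⇒InM2 (suc b) M (s≤s size≤b) free =
  decide (FreeStructure.structure _ (vectors M) ℕ.≤-refl
    (avoiding (free-restriction {mat (vectors M)} {M} (mat-vectors-flat M) free)))
  where
  side : {W : Subspace (dim M)} (R : Restricted M W) → (∃ λ a → a ∈ₗ vectors M × ¬ Mem W a) →
         InM2 (Restricted.matroid R)
  side {W} R (a , a∈ , a∉) = free⇒InM2 b (Restricted.matroid R)
    (ℕ.≤-<-trans (Restricted.size≤ R)
      (ℕ.<-≤-trans (restrict-< W a∈ a∉) (subst (_≤ b) (sym (List.length-tabulate (vec M))) size≤b)))
    (free-restriction {Restricted.matroid R} {M} (Restricted.flat R) free)
  decide : Closed (vectors M) ⊎ Split (vectors M) → InM2 M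
  decide (inj₁ closed) = pg (closed⇒IsPG M closed)
  decide (inj₂ d) = gpc (side R₁ (Split.out₁ d)) (side R₂ (Split.out₂ d))
      (SplitGPC.split-gpc M d R₁ R₂ (restricted M (Split.W₁ d ⊓ Split.W₂ d)))
    where
    R₁ = restricted M (Split.W₁ d)
    R₂ = restricted M (Split.W₂ d)

-- Decomposable sets and their images under additive relations

-- Unlike `Subspace` this asks for no decision procedure, as images under arbitrary additive
-- relations are formed.
record Linear (W : V n → Set) : Set where
  field
    lin-0 : W zeroV
    lin-+ : ∀ {a b} → W a → W b → W (a ⊕ b)

  lin-cancel : ∀ {a b} → W (a ⊕ b) → W b → W a
  lin-cancel {a} {b} ab b∈ = subst W (⊕-cancel a b) (lin-+ ab b∈)

  lin-cancelˡ : ∀ {a b} → W (a ⊕ b) → W a → W b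
  lin-cancelˡ {a} {b} ab a∈ = lin-cancel (subst W (⊕-comm a b) ab) a∈

open Linear

-- Predicates are rarely equal on the nose, so `S₁` and `S₂` are tied to S ∩ W₁ and S ∩ W₂ by mutual
-- inclusion.
data Decomposable {n} : (V n → Set) → Set₁ where
  whole   : ∀ {S} → Linear S → Decomposable S
  amalgam : ∀ {S S₁ S₂ W₁ W₂} → Linear W₁ → Linear W₂ →
            (∀ {v} → S v → W₁ v ⊎ W₂ v) → (∀ {v} → W₁ v → W₂ v → S v) →
            (∀ {v} → S₁ v → S v × W₁ v) → (∀ {v} → S v → W₁ v → S₁ v) →
            (∀ {v} → S₂ v → S v × W₂ v) → (∀ {v} → S v → W₂ v → S₂ v) →
            Decomposable S₁ → Decomposable S₂ → Decomposable S

decomposable-0 : {S : V n → Set} → Decomposable S → S zeroV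
decomposable-0 (whole l) = lin-0 l
decomposable-0 (amalgam l₁ l₂ _ meet _ _ _ _ _ _) = meet (lin-0 l₁) (lin-0 l₂)

-- A linear relation instead of a map: it can be confined to a subspace, and it can link two
-- families with equal cycle spaces.
record AdditiveRel (Γ : V m → V n → Set) : Set where
  field
    rel-0 : Γ zeroV zeroV
    rel-+ : ∀ {a b a′ b′} → Γ a b → Γ a′ b′ → Γ (a ⊕ a′) (b ⊕ b′)

  rel-diff : ∀ {a a′ b} → Γ a b → Γ a′ b → Γ (a ⊕ a′) zeroV
  rel-diff {b = b} r r′ = subst (Γ _) (⊕-self b) (rel-+ r r′)

open AdditiveRel

Image : (V m → V n → Set) → (V m → Set) → V n → Set
Image Γ P b = ∃ λ a → P a × Γ a b

image-linear : {Γ : V m → V n → Set} {W : V m → Set} → AdditiveRel Γ → Linear W → Linear (Image Γ W)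
image-linear Γ-add l = record
  { lin-0 = zeroV , lin-0 l , rel-0 Γ-add
  ; lin-+ = λ (a , wa , ra) (b , wb , rb) → a ⊕ b , lin-+ l wa wb , rel-+ Γ-add ra rb }

-- Contraction is the case of a kernel {0, e}: an element of the kernel lies in one of the
-- two parts, so two preimages of a vector that lie in different parts can be moved together.
decomposable-image : {S : V m → Set} {Γ : V m → V n → Set} {T : V n → Set} → Decomposable S → AdditiveRel Γ →
  (∀ {a} → Γ a zeroV → S a) → (∀ {b} → T b → Image Γ S b) → (∀ {b} → Image Γ S b → T b) → Decomposable T
decomposable-image (whole l) Γ-add ker T⊆ ⊆T = whole record
  { lin-0 = ⊆T (lin-0 il)
  ; lin-+ = λ a b → ⊆T (lin-+ il (T⊆ a) (T⊆ b)) }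
  where il = image-linear Γ-add l
decomposable-image {n = n} {S} {Γ} {T} (amalgam {S₁ = S₁} {S₂} {W₁} {W₂} l₁ l₂ cover meet S₁⊆ ⊆S₁ S₂⊆ ⊆S₂ d₁ d₂)
                   Γ-add ker T⊆ ⊆T =
  amalgam (image-linear Γ-add l₁) (image-linear Γ-add l₂) cover′ meet′
    (λ (a , s , r) → ⊆T (a , proj₁ (S₁⊆ s) , r) , a , proj₂ (S₁⊆ s) , r) (shrink l₁ l₂ cover meet ⊆S₁)
    (λ (a , s , r) → ⊆T (a , proj₁ (S₂⊆ s) , r) , a , proj₂ (S₂⊆ s) , r)
    (shrink l₂ l₁ (swap⊎ ∘ cover) (λ w₂ w₁ → meet w₁ w₂) ⊆S₂)
    (part l₁ S₁⊆ ⊆S₁ d₁) (part l₂ S₂⊆ ⊆S₂ d₂)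
  where
  cover′ : ∀ {b} → T b → Image Γ W₁ b ⊎ Image Γ W₂ b
  cover′ t with a , s , r ← T⊆ t | cover s
  ... | inj₁ w₁ = inj₁ (a , w₁ , r)
  ... | inj₂ w₂ = inj₂ (a , w₂ , r)
  meet′ : ∀ {b} → Image Γ W₁ b → Image Γ W₂ b → T b
  meet′ (a₁ , w₁ , r₁) (a₂ , w₂ , r₂) with cover (ker (rel-diff Γ-add r₁ r₂))
  ... | inj₁ k₁ = ⊆T (a₂ , meet (lin-cancelˡ l₁ k₁ w₁) w₂ , r₂)
  ... | inj₂ k₂ = ⊆T (a₁ , meet w₁ (lin-cancel l₂ k₂ w₂) , r₁)
  shrink : {S₁ W₁ W₂ : V _ → Set} → Linear W₁ → Linear W₂ →
           (∀ {v} → S v → W₁ v ⊎ W₂ v) → (∀ {v} → W₁ v → W₂ v → S v) →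
           (∀ {v} → S v → W₁ v → S₁ v) → ∀ {b} → T b → Image Γ W₁ b → Image Γ S₁ b
  shrink l₁ l₂ cover meet ⊆S₁ t (w , w₁ , r) with s , s∈ , r′ ← T⊆ t | cover s∈
  ... | inj₁ s₁ = s , ⊆S₁ s∈ s₁ , r′
  ... | inj₂ s₂ with cover (ker (rel-diff Γ-add r′ r))
  ...   | inj₁ k₁ = s , ⊆S₁ s∈ (lin-cancel l₁ k₁ w₁) , r′
  ...   | inj₂ k₂ = w , ⊆S₁ (meet w₁ (lin-cancelˡ l₂ k₂ s₂)) w₁ , r
  part : {S₁ W₁ : V _ → Set} → Linear W₁ → (∀ {v} → S₁ v → S v × W₁ v) → (∀ {v} → S v → W₁ v → S₁ v) →
         Decomposable S₁ → Decomposable (Image Γ S₁)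
  -- Confining the relation to `W₁` brings its kernel into `S₁`.
  part {S₁} {W₁} l S₁⊆ ⊆S₁ d = decomposable-image {Γ = λ a b → Γ a b × W₁ a} d
    (record { rel-0 = rel-0 Γ-add , lin-0 l ; rel-+ = λ (r , w) (r′ , w′) → rel-+ Γ-add r r′ , lin-+ l w w′ })
    (λ (r , w) → ⊆S₁ (ker r) w) (λ (a , s , r) → a , s , r , proj₂ (S₁⊆ s)) (λ (a , s , r , _) → a , s , r)

-- A triangle u, v, u + v of an amalgam lies on one side, since two of its points share a side and
-- the third is their sum. Of the three triangles on a, b, c two lie on the same side, and these
-- contain a, b and c.
decomposable-K₄ : {S : V n → Set} → Decomposable S → ∀ {a b c} → S a → S b → S c →
                  S (a ⊕ b) → S (a ⊕ c) → S (b ⊕ c) → S ((a ⊕ b) ⊕ c)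
decomposable-K₄ (whole l) a b c _ _ _ = lin-+ l (lin-+ l a b) c
decomposable-K₄ {S = S} (amalgam {S₁ = S₁} {S₂} {W₁} {W₂} l₁ l₂ cover meet S₁⊆ ⊆S₁ S₂⊆ ⊆S₂ d₁ d₂)
                {a} {b} {c} sa sb sc sab sac sbc =
  go (side sa sb sab) (side sa sc sac) (side sb sc sbc)
  where
  side : ∀ {u v} → S u → S v → S (u ⊕ v) → (W₁ u × W₁ v) ⊎ (W₂ u × W₂ v)
  side su sv suv with cover su | cover sv
  ... | inj₁ u | inj₁ v = inj₁ (u , v)
  ... | inj₂ u | inj₂ v = inj₂ (u , v)
  ... | inj₁ u | inj₂ v = [ (λ uv → inj₁ (u , lin-cancelˡ l₁ uv u)) , (λ uv → inj₂ (lin-cancel l₂ uv v , v)) ]′ (cover suv)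
  ... | inj₂ u | inj₁ v = [ (λ uv → inj₁ (lin-cancel l₁ uv v , v)) , (λ uv → inj₂ (u , lin-cancelˡ l₂ uv u)) ]′ (cover suv)
  all₁ : W₁ a → W₁ b → W₁ c → S ((a ⊕ b) ⊕ c)
  all₁ a b c = proj₁ (S₁⊆ (decomposable-K₄ d₁ (⊆S₁ sa a) (⊆S₁ sb b) (⊆S₁ sc c)
    (⊆S₁ sab (lin-+ l₁ a b)) (⊆S₁ sac (lin-+ l₁ a c)) (⊆S₁ sbc (lin-+ l₁ b c))))
  all₂ : W₂ a → W₂ b → W₂ c → S ((a ⊕ b) ⊕ c)
  all₂ a b c = proj₁ (S₂⊆ (decomposable-K₄ d₂ (⊆S₂ sa a) (⊆S₂ sb b) (⊆S₂ sc c)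
    (⊆S₂ sab (lin-+ l₂ a b)) (⊆S₂ sac (lin-+ l₂ a c)) (⊆S₂ sbc (lin-+ l₂ b c))))
  go : (W₁ a × W₁ b) ⊎ (W₂ a × W₂ b) → (W₁ a × W₁ c) ⊎ (W₂ a × W₂ c) →
       (W₁ b × W₁ c) ⊎ (W₂ b × W₂ c) → S ((a ⊕ b) ⊕ c)
  go (inj₁ (a , b)) (inj₁ (_ , c)) _              = all₁ a b c
  go (inj₂ (a , b)) (inj₂ (_ , c)) _              = all₂ a b c
  go (inj₁ (a , b)) (inj₂ _)       (inj₁ (_ , c)) = all₁ a b c
  go (inj₁ _)       (inj₂ (a , c)) (inj₂ (b , _)) = all₂ a b c
  go (inj₂ _)       (inj₁ (a , c)) (inj₁ (b , _)) = all₁ a b c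
  go (inj₂ (a , b)) (inj₁ _)       (inj₂ (_ , c)) = all₂ a b c

-- The four vectors a, b, c, a + b + c sum to 0. Three on one side bring in the fourth; if two lie
-- on each side, the sum of a pair is in both subspaces, hence in `S`.
decomposable-U₃₄ : {S : V n → Set} → Decomposable S → ∀ {a b c} → S a → S b → S c →
                   S ((a ⊕ b) ⊕ c) → S (a ⊕ b) ⊎ S (a ⊕ c) ⊎ S (b ⊕ c)
decomposable-U₃₄ (whole l) a b _ _ = inj₁ (lin-+ l a b)
decomposable-U₃₄ {n} {S} (amalgam {S₁ = S₁} {S₂} {W₁} {W₂} l₁ l₂ cover meet S₁⊆ ⊆S₁ S₂⊆ ⊆S₂ d₁ d₂)
                 {a} {b} {c} sa sb sc sd =
  go (cover sa) (cover sb) (cover sc) (cover sd)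
  where
  Goal = S (a ⊕ b) ⊎ S (a ⊕ c) ⊎ S (b ⊕ c)
  d = (a ⊕ b) ⊕ c
  d-b : (d ⊕ a) ⊕ c ≡ b
  d-b = solve 3 (λ a b c → (((a ⊞ b) ⊞ c) ⊞ a) ⊞ c ⊜ b) refl a b c
  d-a : (d ⊕ b) ⊕ c ≡ a
  d-a = solve 3 (λ a b c → (((a ⊞ b) ⊞ c) ⊞ b) ⊞ c ⊜ a) refl a b c
  d-ac : d ⊕ b ≡ a ⊕ c
  d-ac = solve 3 (λ a b c → ((a ⊞ b) ⊞ c) ⊞ b ⊜ a ⊞ c) refl a b c
  d-bc : d ⊕ a ≡ b ⊕ c
  d-bc = solve 3 (λ a b c → ((a ⊞ b) ⊞ c) ⊞ a ⊜ b ⊞ c) refl a b c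
  module _ {W : V n → Set} (l : Linear W) where
    c∈ : W a → W b → W d → W c
    c∈ a b d = lin-cancelˡ l d (lin-+ l a b)
    b∈ : W a → W c → W d → W b
    b∈ a c d = subst W d-b (lin-+ l (lin-+ l d a) c)
    a∈ : W b → W c → W d → W a
    a∈ b c d = subst W d-a (lin-+ l (lin-+ l d b) c)
    ab∈ : W c → W d → W (a ⊕ b)
    ab∈ c d = lin-cancel l d c
    ac∈ : W b → W d → W (a ⊕ c)
    ac∈ b d = subst W d-ac (lin-+ l d b)
    bc∈ : W a → W d → W (b ⊕ c)
    bc∈ a d = subst W d-bc (lin-+ l d a)
  all₁ : W₁ a → W₁ b → W₁ c → Goal
  all₁ a b c = map⊎ (proj₁ ∘ S₁⊆) (map⊎ (proj₁ ∘ S₁⊆) (proj₁ ∘ S₁⊆))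
    (decomposable-U₃₄ d₁ (⊆S₁ sa a) (⊆S₁ sb b) (⊆S₁ sc c) (⊆S₁ sd (lin-+ l₁ (lin-+ l₁ a b) c)))
  all₂ : W₂ a → W₂ b → W₂ c → Goal
  all₂ a b c = map⊎ (proj₁ ∘ S₂⊆) (map⊎ (proj₁ ∘ S₂⊆) (proj₁ ∘ S₂⊆))
    (decomposable-U₃₄ d₂ (⊆S₂ sa a) (⊆S₂ sb b) (⊆S₂ sc c) (⊆S₂ sd (lin-+ l₂ (lin-+ l₂ a b) c)))
  go : W₁ a ⊎ W₂ a → W₁ b ⊎ W₂ b → W₁ c ⊎ W₂ c → W₁ d ⊎ W₂ d → Goal
  go (inj₁ a) (inj₁ b) (inj₁ c) _        = all₁ a b c
  go (inj₂ a) (inj₂ b) (inj₂ c) _        = all₂ a b c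
  go (inj₁ a) (inj₁ b) (inj₂ c) (inj₁ d) = all₁ a b (c∈ l₁ a b d)
  go (inj₁ a) (inj₁ b) (inj₂ c) (inj₂ d) = inj₁ (meet (lin-+ l₁ a b) (ab∈ l₂ c d))
  go (inj₂ a) (inj₂ b) (inj₁ c) (inj₂ d) = all₂ a b (c∈ l₂ a b d)
  go (inj₂ a) (inj₂ b) (inj₁ c) (inj₁ d) = inj₁ (meet (ab∈ l₁ c d) (lin-+ l₂ a b))
  go (inj₁ a) (inj₂ b) (inj₁ c) (inj₁ d) = all₁ a (b∈ l₁ a c d) c
  go (inj₁ a) (inj₂ b) (inj₁ c) (inj₂ d) = inj₂ (inj₁ (meet (lin-+ l₁ a c) (ac∈ l₂ b d)))
  go (inj₂ a) (inj₁ b) (inj₂ c) (inj₂ d) = all₂ a (b∈ l₂ a c d) c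
  go (inj₂ a) (inj₁ b) (inj₂ c) (inj₁ d) = inj₂ (inj₁ (meet (ac∈ l₁ b d) (lin-+ l₂ a c)))
  go (inj₂ a) (inj₁ b) (inj₁ c) (inj₁ d) = all₁ (a∈ l₁ b c d) b c
  go (inj₂ a) (inj₁ b) (inj₁ c) (inj₂ d) = inj₂ (inj₂ (meet (lin-+ l₁ b c) (bc∈ l₂ a d)))
  go (inj₁ a) (inj₂ b) (inj₂ c) (inj₂ d) = all₂ (a∈ l₂ b c d) b c
  go (inj₁ a) (inj₂ b) (inj₂ c) (inj₁ d) = inj₂ (inj₂ (meet (bc∈ l₁ a d) (lin-+ l₂ b c)))

-- Isomorphic families

Points : (Fin m → V n) → V n → Set
Points v u = u ≡ zeroV ⊎ ∃ λ i → v i ≡ u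

-- For distinct nonzero vectors: the family is a projective geometry.
Full : (Fin m → V n) → Set
Full v = ∀ Y → Points v (sumSel v Y)

sumSel-toggle : (v : Fin m → V n) (Y : Subset m) (i : Fin m) → sumSel v Y ≡ v i → sumSel v (Y ⊕ ⁅ i ⁆) ≡ zeroV
sumSel-toggle v Y i eq = trans (sumSel-⊕ v Y ⁅ i ⁆) (trans (cong₂ _⊕_ eq (sumSel-⁅⁆ v i)) (⊕-self (v i)))

sumSel-toggle⁻ : (v : Fin m → V n) (Y : Subset m) (i : Fin m) → sumSel v (Y ⊕ ⁅ i ⁆) ≡ zeroV → sumSel v Y ≡ v i
sumSel-toggle⁻ v Y i eq =
  ⊕≡0⇒≡ (trans (cong (sumSel v Y ⊕_) (sym (sumSel-⁅⁆ v i))) (trans (sym (sumSel-⊕ v Y ⁅ i ⁆)) eq))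

cycEq-sum : {v : Fin m → V n} {w : Fin m → V k} → CycEq v w → ∀ {Y i} → sumSel v Y ≡ v i → sumSel w Y ≡ w i
cycEq-sum {v = v} {w} vw {Y} {i} eq = sumSel-toggle⁻ w Y i (to (vw (Y ⊕ ⁅ i ⁆)) (sumSel-toggle v Y i eq))

points-resp : {v : Fin m → V n} {w : Fin m → V k} → CycEq v w → ∀ {Y} → Points v (sumSel v Y) → Points w (sumSel w Y)
points-resp vw {Y} (inj₁ eq)       = inj₁ (to (vw Y) eq)
points-resp vw     (inj₂ (i , eq)) = inj₂ (i , sym (cycEq-sum vw (sym eq)))

-- `S` may exceed the points of `v`, as only its trace on the span of `v` matters; this covers
-- isomorphisms, flats and contractions alike.
decomposable-resp : {v : Fin m → V n} {w : Fin m → V k} {S : V n → Set} → CycEq v w → Decomposable S →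
                    (∀ i → S (v i)) → (∀ Y → S (sumSel v Y) → Points v (sumSel v Y)) → Decomposable (Points w)
decomposable-resp {m = m} {n} {k} {v} {w} {S} vw d v∈S S∩ = decomposable-image {Γ = Γ} d
  (record { rel-0 = ⊥ , sumSel-⊥ v , sumSel-⊥ w
          ; rel-+ = λ { (Y , refl , refl) (Z , refl , refl) → Y ⊕ Z , sumSel-⊕ v Y Z , sumSel-⊕ w Y Z } })
  (λ { (Y , refl , eq) → subst S (sym (from (vw Y) eq)) (decomposable-0 d) })
  (λ { (inj₁ refl) → zeroV , decomposable-0 d , ⊥ , sumSel-⊥ v , sumSel-⊥ w
     ; (inj₂ (i , refl)) → v i , v∈S i , ⁅ i ⁆ , sumSel-⁅⁆ v i , sumSel-⁅⁆ w i })
  (λ { (a , s , Y , refl , refl) → points-resp {v = v} {w} vw {Y} (S∩ Y s) })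
  where
  Γ : V n → V k → Set
  Γ a b = ∃ λ Y → sumSel v Y ≡ a × sumSel w Y ≡ b

inSpan-resp : {v : Fin m → V n} {w : Fin m → V k} → CycEq v w → ∀ {X e} → InSpan v X (v e) → InSpan w X (w e)
inSpan-resp vw (Y , Y⊆ , eq) = Y , Y⊆ , cycEq-sum vw eq

-- An element of a zero-sum set of `v` is spanned by the others; carried over to `w`, this
-- contradicts independence.
span⇒linIndep : (v : Fin m → V n) (w : Fin m → V k) → (∀ X e → InSpan v X (v e) → InSpan w X (w e)) →
                ∀ X → LinIndep w X → LinIndep v X
span⇒linIndep v w sp X ind Y Y⊆ eq with Y ≟ⱽ ⊥
... | yes Y≡⊥ = Y≡⊥
... | no Y≢⊥ with y , y∈ ← ≢⊥-witness Y Y≢⊥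
             with Z , Z⊆ , eqZ ← sp (Y ⊕ ⁅ y ⁆) y (Y ⊕ ⁅ y ⁆ , id ,
                    trans (sumSel-⊕ v Y ⁅ y ⁆) (trans (cong₂ _⊕_ eq (sumSel-⁅⁆ v y)) (⊕-identityˡ (v y)))) =
  ⊥-elim (∉-⊕ Y ⁅ y ⁆ y∈ (x∈⁅x⁆ y) (Z⊆ (subst (y ∈_) (sym Z≡) (x∈⁅x⁆ y))))
  where
  y⊆ : ∀ {i} → i ∈ ⁅ y ⁆ → i ∈ Y
  y⊆ i∈ = subst (_∈ Y) (sym (x∈⁅y⁆⇒x≡y y i∈)) y∈
  Z≡ : Z ≡ ⁅ y ⁆
  Z≡ = ⊕≡0⇒≡ (ind (Z ⊕ ⁅ y ⁆)
    (λ i∈ → Y⊆ ([ (λ i∈Z → [ id , y⊆ ]′ (∈-⊕⁻ Y ⁅ y ⁆ (Z⊆ i∈Z))) , y⊆ ]′ (∈-⊕⁻ Z ⁅ y ⁆ i∈)))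
    (sumSel-toggle w Z y eqZ))

span⇒cycEq : (v : Fin m → V n) (w : Fin m → V k) → (∀ X e → InSpan v X (v e) → InSpan w X (w e)) →
             (∀ X e → InSpan w X (w e) → InSpan v X (v e)) → CycEq v w
span⇒cycEq v w vw wv = indep⇒cycEq (λ X → mk⇔ (span⇒linIndep w v wv X) (span⇒linIndep v w vw X))

-- Passing to minors

restrVia-cycEq : (N M : BinMat) {f : Fin (size N) → Fin (size M)} {T : Subset (size M)} →
                 RestrVia N M f T → CycEq (vec M ∘ f) (vec N)
restrVia-cycEq N M {f} {T} (f-inj , f∈ , _ , ind) = indep⇒cycEq λ X →
  let li = linIndep-image (vec M) f-inj X
      ri = subst (λ Z → Indep M (image f X) ⇔ Indep N Z) (pre-image f-inj X)
             (ind (image f X) (λ j∈ → let i , _ , eq = ∈-image⁻ f X j∈ in subst (_∈ T) eq (f∈ i))) in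
  mk⇔ (to ri ∘ from li) (to li ∘ from ri)

iso⇒restrVia : (N M : BinMat) (i : Iso N M) → RestrVia N M (proj₁ i) ⊤
iso⇒restrVia N M (σ , inj , surj , ind) = inj , (λ _ → ∈⊤) , (λ j _ → surj j) , λ X _ → ind X

module Contracted (N M : BinMat) (e : Fin (size M)) (g : Fin (size N) → Fin (size M))
  (g≢e : ∀ i → g i ≢ e) (covers : ∀ x → x ≢ e → ∃ λ i → InCl M (⁅ e ⁆ ∪ ⁅ g i ⁆) x)
  (unique : ∀ i j → InCl M (⁅ e ⁆ ∪ ⁅ g j ⁆) (g i) → i ≡ j)
  (ind : ∀ X → (∀ x → x ∈ X → ∃ λ i → g i ≡ x) → Indep M (X ∪ ⁅ e ⁆) ⇔ Indep N (pre g X)) where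

  g-inj : Inj g
  g-inj i j eq = unique i j (span-gen (vec M) (x∈p∪q⁺ (inj₂ (subst (_∈ ⁅ g j ⁆) (sym eq) (x∈⁅x⁆ (g j))))))

  -- For any representation `w`: decomposability uses `vec M`, the rank bound one in few
  -- coordinates.
  cycEq : (w : Fin (size M) → V n) → CycEq (vec M) w → (w e ≢ zeroV) → (q : Quotient (w e)) →
          CycEq (proj q ∘ w ∘ g) (vec N)
  cycEq w vw we≢0 q = indep⇒cycEq λ X →
    let X⊆ = λ j j∈ → let i , _ , eq = ∈-image⁻ g X j∈ in i , eq
        lc = subst (λ Z → LinIndep w (image g X ∪ ⁅ e ⁆) ⇔ LinIndep (proj q ∘ w ∘ g) Z) (pre-image g-inj X)
               (linIndep-contract w e we≢0 q g-inj g≢e (image g X) X⊆)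
        ci = cycEq⇒indep vw (image g X ∪ ⁅ e ⁆)
        ri = subst (λ Z → Indep M (image g X ∪ ⁅ e ⁆) ⇔ Indep N Z) (pre-image g-inj X) (ind (image g X) X⊆) in
    mk⇔ (to ri ∘ from ci ∘ from lc) (to lc ∘ to ci ∘ from ri)

  points : (q : Quotient (vec M e)) → ∀ {a} → Points (vec M) a → Points (proj q ∘ vec M ∘ g) (proj q a)
  points q (inj₁ refl) = inj₁ (additive-0 (proj-add q))
  points q (inj₂ (x , refl)) with x Fin.≟ e
  ... | yes refl = inj₁ (proj-x q)
  ... | no x≢e with i , x∈ ← covers x x≢e =
    [ inj₁ , (λ eq → inj₂ (i , sym eq)) ]′
      (span-least (vec M) (comap (proj q) (proj-add q) (ray (proj q (vec M (g i))))) gens x∈)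
    where
    gens : ∀ k → k ∈ ⁅ e ⁆ ∪ ⁅ g i ⁆ → proj q (vec M k) ≡ zeroV ⊎ proj q (vec M k) ≡ proj q (vec M (g i))
    gens k k∈ with x∈p∪q⁻ ⁅ e ⁆ ⁅ g i ⁆ k∈
    ... | inj₁ k∈e = inj₁ (trans (cong (proj q ∘ vec M) (x∈⁅y⁆⇒x≡y e k∈e)) (proj-x q))
    ... | inj₂ k∈g = inj₂ (cong (proj q ∘ vec M) (x∈⁅y⁆⇒x≡y (g i) k∈g))

Decomposableᴹ : BinMat → Set₁
Decomposableᴹ M = Decomposable (Points (vec M))

restriction-decomposable : (N M : BinMat) {f : Fin (size N) → Fin (size M)} {T : Subset (size M)} →
  RestrVia N M f T → Flat M T → Decomposableᴹ M → Decomposableᴹ N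
restriction-decomposable N M {f} {T} r@(_ , f∈ , onto , _) flat d =
  decomposable-resp {v = vec M ∘ f} {w = vec N} (restrVia-cycEq N M r) d (λ i → inj₂ (f i , refl)) inT
  where
  inT : ∀ Y → Points (vec M) (sumSel (vec M ∘ f) Y) → Points (vec M ∘ f) (sumSel (vec M ∘ f) Y)
  inT Y (inj₁ eq) = inj₁ eq
  inT Y (inj₂ (x , eq)) with i , refl ← onto x (flat x (image f Y ,
      (λ j∈ → let i , _ , eq = ∈-image⁻ f Y j∈ in subst (_∈ T) eq (f∈ i)) , trans (sumSel-image (vec M) f Y) (sym eq))) =
    inj₂ (i , eq)

contraction-decomposable : (N M : BinMat) → SimpContraction N M → Decomposableᴹ M → Decomposableᴹ N
contraction-decomposable N M (e , g , g≢e , covers , unique , ind) d =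
  decomposable-resp {v = proj q ∘ vec M ∘ g} {w = vec N}
    (C.cycEq (vec M) (λ _ → mk⇔ id id) (vec-nz M e) q)
    (decomposable-image {Γ = λ a b → proj q a ≡ b} {T = λ b → ∃ λ a → Points (vec M) a × proj q a ≡ b} d
      (record { rel-0 = additive-0 (proj-add q) ; rel-+ = λ { refl refl → proj-add q _ _ } })
      (λ {a} eq → [ inj₁ , (λ a≡e → inj₂ (e , sym a≡e)) ]′ (kernel q a eq)) id id)
    (λ i → vec M (g i) , inj₂ (g i , refl) , refl)
    (λ Y (a , s , eq) → subst (Points (proj q ∘ vec M ∘ g)) eq (C.points q s))
  where
  module C = Contracted N M e g g≢e covers unique ind
  q = quotient (vec M e) (vec-nz M e)

minor-decomposable : {N M : BinMat} → IndMinor N M → Decomposableᴹ M → Decomposableᴹ N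
minor-decomposable {N} {M} (base i) d = restriction-decomposable N M (iso⇒restrVia N M i) (λ _ _ → ∈⊤) d
minor-decomposable {N} {M} (viaRestr {M' = M′} (f , T , flat , r) i) d =
  minor-decomposable i (restriction-decomposable M′ M r flat d)
minor-decomposable {N} {M} (viaContr {M' = M′} c i) d = minor-decomposable i (contraction-decomposable M′ M c d)

¬decomposable-K₄ : ¬ Decomposableᴹ MK4
¬decomposable-K₄ d with decomposable-K₄ d {vec MK4 zero} {vec MK4 (suc zero)} {vec MK4 (suc (suc zero))}
  (inj₂ (zero , refl)) (inj₂ (suc zero , refl)) (inj₂ (suc (suc zero) , refl))
  (inj₂ (suc (suc (suc zero)) , refl)) (inj₂ (suc (suc (suc (suc zero))) , refl))
  (inj₂ (suc (suc (suc (suc (suc zero)))) , refl))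
... | inj₂ (zero , ())
... | inj₂ (suc zero , ())
... | inj₂ (suc (suc zero) , ())
... | inj₂ (suc (suc (suc zero)) , ())
... | inj₂ (suc (suc (suc (suc zero))) , ())
... | inj₂ (suc (suc (suc (suc (suc zero)))) , ())

¬decomposable-U₃₄ : ¬ Decomposableᴹ U34
¬decomposable-U₃₄ d with decomposable-U₃₄ d {vec U34 zero} {vec U34 (suc zero)} {vec U34 (suc (suc zero))}
  (inj₂ (zero , refl)) (inj₂ (suc zero , refl)) (inj₂ (suc (suc zero) , refl)) (inj₂ (suc (suc (suc zero)) , refl))
... | inj₁ (inj₂ (zero , ()))
... | inj₁ (inj₂ (suc zero , ()))
... | inj₁ (inj₂ (suc (suc zero) , ()))
... | inj₁ (inj₂ (suc (suc (suc zero)) , ()))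
... | inj₂ (inj₁ (inj₂ (zero , ())))
... | inj₂ (inj₁ (inj₂ (suc zero , ())))
... | inj₂ (inj₁ (inj₂ (suc (suc zero) , ())))
... | inj₂ (inj₁ (inj₂ (suc (suc (suc zero)) , ())))
... | inj₂ (inj₂ (inj₂ (zero , ())))
... | inj₂ (inj₂ (inj₂ (suc zero , ())))
... | inj₂ (inj₂ (inj₂ (suc (suc zero) , ())))
... | inj₂ (inj₂ (inj₂ (suc (suc (suc zero)) , ())))

-- Generalized parallel connections are decomposable

full-resp : {v : Fin m → V n} {w : Fin m → V k} → CycEq v w → Full v → Full w
full-resp {v = v} {w} vw full Y = points-resp {v = v} {w} vw {Y} (full Y)

module PG (M : BinMat) (isPG : IsPG M) where
  private
    φ = proj₁ (proj₂ isPG)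

    φ-full : Full φ
    φ-full Y with sumSel φ Y ≟ⱽ zeroV
    ... | yes eq = inj₁ eq
    ... | no neq = inj₂ (proj₁ (proj₂ (proj₂ (proj₂ (proj₂ isPG)))) (sumSel φ Y) neq)

    φ-cycEq : CycEq φ (vec M)
    φ-cycEq = cycEq-sym {v = vec M} {w = φ} (indep⇒cycEq (proj₂ (proj₂ (proj₂ (proj₂ (proj₂ isPG))))))

  full : Full (vec M)
  full = full-resp {v = φ} {w = vec M} φ-cycEq φ-full

  decomposable : Decomposableᴹ M
  decomposable = decomposable-resp {v = φ} {w = vec M} {S = λ _ → Unit} φ-cycEq
    (whole (record { lin-0 = tt ; lin-+ = λ _ _ → tt })) (λ _ → tt) (λ Y _ → φ-full Y)

span-mono : (v : Fin m → V n) {X Y : Subset m} → X ⊆ Y → ∀ {u} → InSpan v X u → InSpan v Y u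
span-mono v X⊆Y (Z , Z⊆ , eq) = Z , (λ i∈ → X⊆Y (Z⊆ i∈)) , eq

span-reindex : (v : Fin m → V n) {f : Fin k → Fin m} {X : Subset k} {Y : Subset m} →
               (∀ i → i ∈ X → f i ∈ Y) → ∀ {u} → InSpan (v ∘ f) X u → InSpan v Y u
span-reindex v {f} {Y = Y} f∈ = span-least (v ∘ f) (span v Y) (λ i i∈ → span-gen v (f∈ i i∈))

-- One of the two sides of a connection along the family indexed by Fin l.
module Side {M₁ M₂ M : BinMat} (f₁ : Fin (size M₁) → Fin (size M)) (f₂ : Fin (size M₂) → Fin (size M))
  (f₁-inj : Inj f₁) (l : ℕ) (g₁ : Fin l → Fin (size M₁)) (g₂ : Fin l → Fin (size M₂))
  (g-cycEq : CycEq (vec M₂ ∘ g₂) (vec M₁ ∘ g₁)) (g₂-full : Full (vec M₂ ∘ g₂))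
  (glue : ∀ k → f₁ (g₁ k) ≡ f₂ (g₂ k))
  (shared : ∀ i j → f₁ i ≡ f₂ j → ∃ λ k → g₁ k ≡ i × g₂ k ≡ j)
  (flats : ∀ X → Flat M X ⇔ (Flat M₁ (pre f₁ X) × Flat M₂ (pre f₂ X))) where

  span-into : ∀ X e → InSpan (vec M₁) X (vec M₁ e) → InSpan (vec M ∘ f₁) X (vec M (f₁ e))
  span-into X e e∈ = ∈-comprehend⁻ (mem? sp ∘ vec M) (∈-pre⁻ (proj₁ (to (flats F) (trace-flat M sp)) e
    (span-mono (vec M₁) X⊆ e∈)))
    where
    sp = span (vec M ∘ f₁) X
    F = trace M sp
    X⊆ : X ⊆ pre f₁ F
    X⊆ i∈ = ∈-pre⁺ (∈-comprehend⁺ (mem? sp ∘ vec M) (span-gen (vec M ∘ f₁) i∈))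

  -- A flat F of `M₁` remains a flat in `M`. Its trace on `M₂` consists of common points; as these
  -- form a full family, whatever they span in `M₂` is again a common point, and it lies in F by
  -- flatness.
  span-from : ∀ X e → InSpan (vec M ∘ f₁) X (vec M (f₁ e)) → InSpan (vec M₁) X (vec M₁ e)
  span-from X e e∈ = F⁻ (f₁-F′⁻ (flat-F′ (f₁ e) (span-reindex (vec M)
      (λ i i∈ → F′⁺ (i , refl , F⁺ (span-gen (vec M₁) i∈))) e∈)))
    where
    sp = span (vec M₁) X
    F = trace M₁ sp
    F⁺ : ∀ {i} → Mem sp (vec M₁ i) → i ∈ F
    F⁺ = ∈-comprehend⁺ (mem? sp ∘ vec M₁)
    F⁻ : ∀ {i} → i ∈ F → Mem sp (vec M₁ i)
    F⁻ = ∈-comprehend⁻ (mem? sp ∘ vec M₁)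
    F′? : ∀ x → Dec (∃ λ i → f₁ i ≡ x × i ∈ F)
    F′? x = Fin.any? (λ i → (f₁ i Fin.≟ x) ×-dec (i ∈? F))
    F′ : Subset (size M)
    F′ = comprehend F′?
    F′⁺ : ∀ {x} → (∃ λ i → f₁ i ≡ x × i ∈ F) → x ∈ F′
    F′⁺ = ∈-comprehend⁺ F′?
    f₁-F′⁻ : ∀ {i} → f₁ i ∈ F′ → i ∈ F
    f₁-F′⁻ {i} i∈ with i′ , eq , i′∈ ← ∈-comprehend⁻ F′? i∈ = subst (_∈ F) (f₁-inj i′ i eq) i′∈
    flat₁ : Flat M₁ (pre f₁ F′)
    flat₁ j j∈ = ∈-pre⁺ (F′⁺ (j , refl , trace-flat M₁ sp j (span-mono (vec M₁) (λ i∈ → f₁-F′⁻ (∈-pre⁻ i∈)) j∈)))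
    K = pre g₁ F
    gens : ∀ j → j ∈ pre f₂ F′ → InSpan (vec M₂ ∘ g₂) K (vec M₂ j)
    gens j j∈ with i , eq , i∈ ← ∈-comprehend⁻ F′? (∈-pre⁻ j∈) | shared i j eq
    ... | k , refl , refl = span-gen (vec M₂ ∘ g₂) (∈-pre⁺ i∈)
    flat₂ : Flat M₂ (pre f₂ F′)
    flat₂ j j∈ with Y , Y⊆ , eq ← span-least (vec M₂) (span (vec M₂ ∘ g₂) K) gens j∈ | g₂-full Y
    ... | inj₁ eq₀ = ⊥-elim (vec-nz M₂ j (trans (sym eq) eq₀))
    ... | inj₂ (k , eqₖ) with refl ← vec-inj M₂ (g₂ k) j (trans eqₖ eq) =
      ∈-pre⁺ (subst (_∈ F′) (glue k) (F′⁺ (g₁ k , refl , trace-flat M₁ sp (g₁ k)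
        (span-reindex (vec M₁) (λ _ → ∈-pre⁻) (inSpan-resp {v = vec M₂ ∘ g₂} {w = vec M₁ ∘ g₁} g-cycEq (Y , Y⊆ , eq))))))
    flat-F′ : Flat M F′
    flat-F′ = from (flats F′) (flat₁ , flat₂)

  -- A connection is specified by flats only; agreement of spans is what recovers `M₁` as the
  -- restriction of `M` along `f₁`.
  cycEq : CycEq (vec M₁) (vec M ∘ f₁)
  cycEq = span⇒cycEq (vec M₁) (vec M ∘ f₁) span-into span-from

  common-full : Full (vec M ∘ f₁ ∘ g₁)
  common-full = full-resp {v = vec M₂ ∘ g₂} {w = vec M ∘ f₁ ∘ g₁}
    (cycEq-trans {v = vec M₁ ∘ g₁} {w = vec M ∘ f₁ ∘ g₁} g-cycEq
      (cycEq-reindex {v = vec M₁} {w = vec M ∘ f₁} cycEq g₁)) g₂-full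

  W₁ W₂ : V (dim M) → Set
  W₁ u = ∃ λ Y → sumSel (vec M ∘ f₁) Y ≡ u
  W₂ u = ∃ λ Y → sumSel (vec M ∘ f₂) Y ≡ u

  common : Subspace (dim M)
  common = span (vec M ∘ f₁ ∘ g₁) ⊤

  -- A chain from the common span up to the span of `M₁`, one generator at a time.
  L : List (Fin (size M₁)) → Subspace (dim M)
  L []       = common
  L (i ∷ as) = L as ⊔ ray (vec M (f₁ i))

  L-common : ∀ as k → Mem (L as) (vec M (f₁ (g₁ k)))
  L-common []       k = span-gen (vec M ∘ f₁ ∘ g₁) ∈⊤
  L-common (i ∷ as) k = ⊔-introˡ (L as) (ray (vec M (f₁ i))) (L-common as k)

  L-gen : ∀ as {i} → i ∈ₗ as → Mem (L as) (vec M (f₁ i))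
  L-gen (i ∷ as) (here refl) = ⊔-introʳ (L as) (ray (vec M (f₁ i))) (inj₂ refl)
  L-gen (i ∷ as) (there i∈)  = ⊔-introˡ (L as) (ray (vec M (f₁ i))) (L-gen as i∈)

  L-least : (P : Subspace (dim M)) → ∀ as → (∀ k → Mem P (vec M (f₁ (g₁ k)))) →
            (∀ {i} → i ∈ₗ as → Mem P (vec M (f₁ i))) → ∀ {u} → Mem (L as) u → Mem P u
  L-least P []       pk pa u∈ = span-least (vec M ∘ f₁ ∘ g₁) P (λ k _ → pk k) u∈
  L-least P (i ∷ as) pk pa (a , a∈ , inj₁ eq) = subst (Mem P) (sym (⊕≡0⇒≡ eq)) (L-least P as pk (pa ∘ there) a∈)
  L-least P (i ∷ as) pk pa (a , a∈ , inj₂ eq) =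
    cancel∈ P (subst (Mem P) (sym eq) (pa (here refl))) (L-least P as pk (pa ∘ there) a∈)

  -- The flat spanned by L as in M₁ together with all of M₂ is a flat of M, hence a vector
  -- of M₁ in the span of L as and M₂ already lies in L as.
  module Exchange (as : List (Fin (size M₁))) where

    X? : ∀ x → Dec ((∃ λ i → f₁ i ≡ x × Mem (L as) (vec M (f₁ i))) ⊎ (∃ λ j → f₂ j ≡ x))
    X? x = Fin.any? (λ i → (f₁ i Fin.≟ x) ×-dec mem? (L as) (vec M (f₁ i))) ⊎-dec Fin.any? (λ j → f₂ j Fin.≟ x)

    X : Subset (size M)
    X = comprehend X?

    X₁⁻ : ∀ {i} → f₁ i ∈ X → Mem (L as) (vec M (f₁ i))
    X₁⁻ {i} i∈ with ∈-comprehend⁻ X? i∈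
    ... | inj₁ (i′ , eq , i′∈) = subst (Mem (L as) ∘ vec M) eq i′∈
    ... | inj₂ (j , eq) with k , refl , _ ← shared i j (sym eq) = L-common as k

    flat₁ : Flat M₁ (pre f₁ X)
    flat₁ e e∈ = ∈-pre⁺ (∈-comprehend⁺ X? (inj₁ (e , refl ,
      span-least (vec M ∘ f₁) (L as) (λ i i∈ → X₁⁻ (∈-pre⁻ i∈)) (span-into (pre f₁ X) e e∈))))

    flat-X : Flat M X
    flat-X = from (flats X) (flat₁ , λ j _ → ∈-pre⁺ (∈-comprehend⁺ X? (inj₂ (j , refl))))

    exchange : ∀ {i a u} → Mem (L as) a → W₂ u → u ⊕ a ≡ vec M (f₁ i) → Mem (L as) (vec M (f₁ i))
    exchange {i} a∈ (Y , refl) eq = X₁⁻ (flat-X (f₁ i) (subst (InSpan (vec M) X) eq (add∈ (span (vec M) X)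
      (sumSel∈ (span (vec M) X) (vec M ∘ f₂) Y (λ j _ → span-gen (vec M) (∈-comprehend⁺ X? (inj₂ (j , refl)))))
      (L-least (span (vec M) X) as (λ k → in-X (L-common as k)) (λ i∈ → in-X (L-gen as i∈)) a∈))))
      where
      in-X : ∀ {i} → Mem (L as) (vec M (f₁ i)) → InSpan (vec M) X (vec M (f₁ i))
      in-X {i} i∈ = span-gen (vec M) (∈-comprehend⁺ X? (inj₁ (i , refl , i∈)))

  -- If `u` in `W₂` uses the generator `i`, then that generator is spanned by `L as` and `W₂`, so by
  -- `exchange` it is redundant.
  descend : ∀ as {u} → Mem (L as) u → W₂ u → Mem common u
  descend []       u∈ w₂ = u∈
  descend (i ∷ as) {u} (a , a∈ , inj₁ eq) w₂ = descend as (subst (Mem (L as)) (sym (⊕≡0⇒≡ eq)) a∈) w₂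
  descend (i ∷ as) {u} (a , a∈ , inj₂ eq) w₂ =
    descend as (cancel∈ (L as) (subst (Mem (L as)) (sym eq) (Exchange.exchange as a∈ w₂ eq)) a∈) w₂

  meet : ∀ {u} → W₁ u → W₂ u → Points (vec M ∘ f₁ ∘ g₁) u
  meet (Y , refl) w₂
    with Z , _ , eq ← descend (List.allFin (size M₁))
           (sumSel∈ (L (List.allFin (size M₁))) (vec M ∘ f₁) Y (λ i _ → L-gen (List.allFin (size M₁)) (List∈.∈-allFin i))) w₂ =
    subst (Points (vec M ∘ f₁ ∘ g₁)) eq (common-full Z)

  points-decomposable : Decomposableᴹ M₁ → Decomposable (Points (vec M ∘ f₁))
  points-decomposable d = decomposable-resp {v = vec M₁} {w = vec M ∘ f₁} cycEq d (λ i → inj₂ (i , refl)) (λ _ s → s)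

sums-linear : (v : Fin m → V n) → Linear (λ u → ∃ λ Y → sumSel v Y ≡ u)
sums-linear v = record
  { lin-0 = ⊥ , sumSel-⊥ v ; lin-+ = λ { (Y , refl) (Z , refl) → Y ⊕ Z , sumSel-⊕ v Y Z } }

gpc-decomposable : {M₁ M₂ M : BinMat} → GPC M₁ M₂ M → Decomposableᴹ M₁ → Decomposableᴹ M₂ → Decomposableᴹ M
gpc-decomposable {M₁} {M₂} {M} G d₁ d₂ =
  amalgam (sums-linear (vec M ∘ f₁)) (sums-linear (vec M ∘ f₂)) cover-points
    (λ w₁ w₂ → in-M f₁ (common⊆₁ (S₁.meet w₁ w₂)))
    (λ s → in-M f₁ s , sums s)
    (λ { (inj₁ eq) _ → inj₁ eq ; (inj₂ (x , refl)) w₁ → side₁ x w₁ (cover x) })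
    (λ s → in-M f₂ s , sums s)
    (λ { (inj₁ eq) _ → inj₁ eq ; (inj₂ (x , refl)) w₂ → side₂ x w₂ (cover x) })
    (S₁.points-decomposable d₁) (S₂.points-decomposable d₂)
  where
  open GPC G
  r₁ = restrVia-cycEq N M₁ restr₁
  r₂ = restrVia-cycEq N M₂ restr₂
  N-full = PG.full N N-PG
  g-cycEq : CycEq (vec M₁ ∘ g₁) (vec M₂ ∘ g₂)
  g-cycEq = cycEq-trans {v = vec N} {w = vec M₂ ∘ g₂} r₁ (cycEq-sym {v = vec M₂ ∘ g₂} {w = vec N} r₂)
  shared : ∀ i j → f₁ i ≡ f₂ j → ∃ λ k → g₁ k ≡ i × g₂ k ≡ j
  shared i j eq with k , refl ← overlap-T i j eq = k , refl , f₂-inj (g₂ k) j (trans (sym (glue k)) eq)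
  shared′ : ∀ j i → f₂ j ≡ f₁ i → ∃ λ k → g₂ k ≡ j × g₁ k ≡ i
  shared′ j i eq = let k , e₁ , e₂ = shared i j (sym eq) in k , e₂ , e₁
  flats′ : ∀ X → Flat M X ⇔ (Flat M₂ (pre f₂ X) × Flat M₁ (pre f₁ X))
  flats′ X = mk⇔ (swap ∘ to (flats X)) (from (flats X) ∘ swap)
  module S₁ = Side {M₁} {M₂} {M} f₁ f₂ f₁-inj (size N) g₁ g₂ (cycEq-sym {v = vec M₁ ∘ g₁} {w = vec M₂ ∘ g₂} g-cycEq)
    (full-resp {v = vec N} {w = vec M₂ ∘ g₂} (cycEq-sym {v = vec M₂ ∘ g₂} {w = vec N} r₂) N-full) glue shared flats
  module S₂ = Side {M₂} {M₁} {M} f₂ f₁ f₂-inj (size N) g₂ g₁ g-cycEq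
    (full-resp {v = vec N} {w = vec M₁ ∘ g₁} (cycEq-sym {v = vec M₁ ∘ g₁} {w = vec N} r₁) N-full) (sym ∘ glue)
    shared′ flats′

  in-M : ∀ {l} (f : Fin l → Fin (size M)) {u} → Points (vec M ∘ f) u → Points (vec M) u
  in-M f (inj₁ eq)       = inj₁ eq
  in-M f (inj₂ (i , eq)) = inj₂ (f i , eq)
  sums : ∀ {l} {f : Fin l → Fin (size M)} {u} → Points (vec M ∘ f) u → ∃ λ Y → sumSel (vec M ∘ f) Y ≡ u
  sums {f = f} (inj₁ refl)       = ⊥ , sumSel-⊥ (vec M ∘ f)
  sums {f = f} (inj₂ (i , refl)) = ⁅ i ⁆ , sumSel-⁅⁆ (vec M ∘ f) i
  common⊆₁ : ∀ {u} → Points (vec M ∘ f₁ ∘ g₁) u → Points (vec M ∘ f₁) u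
  common⊆₁ (inj₁ eq)       = inj₁ eq
  common⊆₁ (inj₂ (k , eq)) = inj₂ (g₁ k , eq)
  common⊆₂ : ∀ {u} → Points (vec M ∘ f₂ ∘ g₂) u → Points (vec M ∘ f₂) u
  common⊆₂ (inj₁ eq)       = inj₁ eq
  common⊆₂ (inj₂ (k , eq)) = inj₂ (g₂ k , eq)
  cover-points : ∀ {u} → Points (vec M) u → S₁.W₁ u ⊎ S₁.W₂ u
  cover-points (inj₁ refl) = inj₁ (lin-0 (sums-linear (vec M ∘ f₁)))
  cover-points (inj₂ (x , refl)) with cover x
  ... | inj₁ (i , refl) = inj₁ (sums (inj₂ (i , refl)))
  ... | inj₂ (j , refl) = inj₂ (sums (inj₂ (j , refl)))
  side₁ : ∀ x → S₁.W₁ (vec M x) → (∃ λ i → f₁ i ≡ x) ⊎ (∃ λ j → f₂ j ≡ x) → Points (vec M ∘ f₁) (vec M x)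
  side₁ x w₁ (inj₁ (i , refl)) = inj₂ (i , refl)
  side₁ x w₁ (inj₂ (j , refl)) = common⊆₁ (S₁.meet w₁ (sums (inj₂ (j , refl))))
  side₂ : ∀ x → S₁.W₂ (vec M x) → (∃ λ i → f₁ i ≡ x) ⊎ (∃ λ j → f₂ j ≡ x) → Points (vec M ∘ f₂) (vec M x)
  side₂ x w₂ (inj₁ (i , refl)) = common⊆₂ (S₂.meet w₂ (sums (inj₂ (i , refl))))
  side₂ x w₂ (inj₂ (j , refl)) = inj₂ (j , refl)

InM2⇒decomposable : {M : BinMat} → InM2 M → Decomposableᴹ M
InM2⇒decomposable (pg {M} isPG)  = PG.decomposable M isPG
InM2⇒decomposable (gpc m₁ m₂ G) = gpc-decomposable G (InM2⇒decomposable m₁) (InM2⇒decomposable m₂)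

InM2⇒free : {M : BinMat} → InM2 M → Free M
InM2⇒free m =
  (λ minor → ¬decomposable-K₄ (minor-decomposable minor (InM2⇒decomposable m))) ,
  (λ minor → ¬decomposable-U₃₄ (minor-decomposable minor (InM2⇒decomposable m)))

-- Proper minors have smaller rank

-- Rank bounded through a representation in fewer than `b` coordinates, so that a quotient map
-- lowers the bound directly.
RankBelow : ℕ → BinMat → Set
RankBelow b M = ∃ λ k → k < b × ∃ λ (w : Fin (size M) → V k) → CycEq (vec M) w

iso-trans : {L M N : BinMat} → Iso L M → Iso M N → Iso L N
iso-trans {L} {M} {N} (σ , σ-inj , σ-surj , σ-ind) (τ , τ-inj , τ-surj , τ-ind) =
  τ ∘ σ , (λ i j eq → σ-inj i j (τ-inj (σ i) (σ j) eq)) ,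
  (λ j → let j′ , eq = τ-surj j ; i , eq′ = σ-surj j′ in i , trans (cong τ eq′) eq) ,
  λ X → subst (λ Z → Indep N X ⇔ Indep L Z) (Vec.tabulate-cong (λ i → Vec.lookup∘tabulate (lookup X ∘ τ) (σ i)))
    (mk⇔ (to (σ-ind (pre τ X)) ∘ to (τ-ind X)) (from (τ-ind X) ∘ from (σ-ind (pre τ X))))

vec-nz-resp : (M : BinMat) {w : Fin (size M) → V k} → CycEq (vec M) w → ∀ e → w e ≢ zeroV
vec-nz-resp M {w} vw e eq = vec-nz M e (trans (sym (sumSel-⁅⁆ (vec M) e)) (from (vw ⁅ e ⁆) (trans (sumSel-⁅⁆ w e) eq)))

codim-< : ∀ {b} {x : V n} (q : Quotient x) → n < suc b → codim q < b
codim-< q (s≤s n≤b) = subst (_≤ _) (dim≡ q) n≤b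

restriction-rank : (N M : BinMat) {f : Fin (size N) → Fin (size M)} {T : Subset (size M)} →
                   RestrVia N M f T → ∀ {b} → RankBelow b M → RankBelow b N
restriction-rank N M {f} r (k , k<b , w , vw) =
  k , k<b , w ∘ f , cycEq-trans {v = vec M ∘ f} {w = w ∘ f} (cycEq-sym {v = vec M ∘ f} {w = vec N} (restrVia-cycEq N M r))
    (cycEq-reindex {v = vec M} {w = w} vw f)

contraction-rank : (N M : BinMat) → SimpContraction N M → ∀ {b} → RankBelow (suc b) M → RankBelow b N
contraction-rank N M (e , g , g≢e , covers , unique , ind) (k , k<b , w , vw) =
  codim q , codim-< q k<b , proj q ∘ w ∘ g ,
  cycEq-sym {v = proj q ∘ w ∘ g} {w = vec N} (Contracted.cycEq N M e g g≢e covers unique ind w vw we≢0 q)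
  where
  we≢0 = vec-nz-resp M {w = w} vw e
  q = quotient (w e) we≢0

-- A proper flat avoids some element j, so quotienting by j does not collapse its span.
flat-rank : (N M : BinMat) {f : Fin (size N) → Fin (size M)} {T : Subset (size M)} → RestrVia N M f T → Flat M T →
            ∀ {j} → j ∉ T → ∀ {b} → RankBelow (suc b) M → RankBelow b N
flat-rank N M {f} {T} r@(_ , f∈ , _) flat {j} j∉T (k , k<b , w , vw) =
  codim q , codim-< q k<b , proj q ∘ w ∘ f ,
  cycEq-trans {v = w ∘ f} {w = proj q ∘ w ∘ f} (proj₂ (proj₂ (proj₂ (restriction-rank N M r (k , k<b , w , vw))))) collapse
  where
  q = quotient (w j) (vec-nz-resp M {w = w} vw j)
  collapse : CycEq (w ∘ f) (proj q ∘ w ∘ f)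
  collapse Y = mk⇔ (λ eq → trans (sumSel-map (proj-add q) (w ∘ f) Y) (trans (cong (proj q) eq) (additive-0 (proj-add q))))
    (λ eq → [ id , (λ eq′ → ⊥-elim (j∉T (flat j (inSpan-resp {v = w} {w = vec M} (cycEq-sym {v = vec M} {w = w} vw)
      (image f Y , (λ i∈ → let i , _ , e = ∈-image⁻ f Y i∈ in subst (_∈ T) e (f∈ i)) ,
       trans (sumSel-image w f Y) eq′))))) ]′
      (kernel q _ (trans (sym (sumSel-map (proj-add q) (w ∘ f) Y)) eq)))

minor-rank : {N M : BinMat} → IndMinor N M → ∀ {b} → RankBelow b M → RankBelow b N
minor-rank {N} {M} (base i) r = restriction-rank N M (iso⇒restrVia N M i) r
minor-rank {N} {M} (viaRestr {M' = M′} (f , T , _ , ri) i) r = minor-rank i (restriction-rank M′ M ri r)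
minor-rank {N} {M} (viaContr {M' = M′} c i) (k , k<b , r) =
  let k′ , k′<k , r′ = contraction-rank M′ M c (k , ℕ.n<1+n k , r) in minor-rank i (k′ , ℕ.<-trans k′<k k<b , r′)

-- Contraction and restriction to a proper flat both lower the rank; restriction to the whole ground
-- set is an isomorphism and is composed with what follows.
proper-minor-rank : {N M : BinMat} → IndMinor N M → ∀ {b} → RankBelow (suc b) M → Iso N M ⊎ RankBelow b N
proper-minor-rank (base i) r = inj₁ i
proper-minor-rank {N} {M} (viaContr {M' = M′} c i) r = inj₂ (minor-rank i (contraction-rank M′ M c r))
proper-minor-rank {N} {M} (viaRestr {M' = M′} (f , T , flat , ri@(f-inj , f∈ , onto , ind)) i) r
  with Fin.any? (λ j → ¬? (j ∈? T))
... | yes (j , j∉T) = inj₂ (minor-rank i (flat-rank M′ M ri flat j∉T r))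
... | no all with proper-minor-rank i (restriction-rank M′ M ri r)
...   | inj₂ r′  = inj₂ r′
...   | inj₁ iso = inj₁ (iso-trans {N} {M′} {M} iso (f , f-inj , (λ j → onto j (in-T j)) , λ X → ind X (λ {j} _ → in-T j)))
  where
  in-T : ∀ j → j ∈ T
  in-T j = decidable-¬¬ (j ∈? T) (λ j∉ → all (j , j∉))

basis⇒¬rank<3 : (M : BinMat) {h : V 3 → Subset (size M)} → Additive h →
                (∀ a → sumSel (vec M) (h a) ≡ zeroV → a ≡ zeroV) → ¬ RankBelow 3 M
basis⇒¬rank<3 M {h} add ind (k , k<3 , w , vw) = ℕ.<⇒≱ k<3
  (injection⇒≤ (sumSel w ∘ h) (additive-injective
    (λ a b → trans (cong (sumSel w) (add a b)) (sumSel-⊕ w (h a) (h b)))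
    (λ a eq → ind a (from (vw (h a)) eq))))

¬K₄-rank<3 : ¬ RankBelow 3 MK4
-- The subsets of the first three elements, which are the unit vectors.
¬K₄-rank<3 = basis⇒¬rank<3 MK4 {λ a → a Vec.++ ⊥}
  (λ { (_ ∷ _ ∷ _ ∷ []) (_ ∷ _ ∷ _ ∷ []) → refl })
  (λ { (false ∷ false ∷ false ∷ []) _ → refl
     ; (true  ∷ false ∷ false ∷ []) ()
     ; (false ∷ true  ∷ false ∷ []) ()
     ; (false ∷ false ∷ true  ∷ []) ()
     ; (true  ∷ true  ∷ false ∷ []) ()
     ; (true  ∷ false ∷ true  ∷ []) ()
     ; (false ∷ true  ∷ true  ∷ []) ()
     ; (true  ∷ true  ∷ true  ∷ []) () })

¬U₃₄-rank<3 : ¬ RankBelow 3 U34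
¬U₃₄-rank<3 = basis⇒¬rank<3 U34 {λ a → a Vec.++ ⊥}
  (λ { (_ ∷ _ ∷ _ ∷ []) (_ ∷ _ ∷ _ ∷ []) → refl })
  (λ { (false ∷ false ∷ false ∷ []) _ → refl
     ; (true  ∷ false ∷ false ∷ []) ()
     ; (false ∷ true  ∷ false ∷ []) ()
     ; (false ∷ false ∷ true  ∷ []) ()
     ; (true  ∷ true  ∷ false ∷ []) ()
     ; (true  ∷ false ∷ true  ∷ []) ()
     ; (false ∷ true  ∷ true  ∷ []) ()
     ; (true  ∷ true  ∷ true  ∷ []) () })

proper-minor-InM2 : {M N : BinMat} → dim M ≡ 3 → ProperIndMinor N M → InM2 N
proper-minor-InM2 {M} {N} dim≡3 (minor , ¬iso)
  -- Ambient dimension 3 gives `RankBelow 4`; properness lowers this to `RankBelow 3`, which neither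
  -- excluded matroid satisfies.
  with proper-minor-rank minor (dim M , subst (_< 4) (sym dim≡3) (ℕ.n<1+n 3) , vec M , λ _ → mk⇔ id id)
... | inj₁ iso = ⊥-elim (¬iso iso)
... | inj₂ r = free⇒InM2 _ N ℕ.≤-refl (¬K₄-rank<3 ∘ (λ i → minor-rank i r) , ¬U₃₄-rank<3 ∘ (λ i → minor-rank i r))

theorem1p3 : (∀ (M : BinMat) → InM2 M ⇔ (¬ IndMinor MK4 M × ¬ IndMinor U34 M)) ×
    (¬ InM2 MK4 × (∀ N → ProperIndMinor N MK4 → InM2 N)) ×
    (¬ InM2 U34 × (∀ N → ProperIndMinor N U34 → InM2 N))
theorem1p3 =
  (λ M → mk⇔ InM2⇒free (free⇒InM2 _ M ℕ.≤-refl)) ,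
  (¬decomposable-K₄ ∘ InM2⇒decomposable , λ N → proper-minor-InM2 refl) ,
  (¬decomposable-U₃₄ ∘ InM2⇒decomposable , λ N → proper-minor-InM2 refl)
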